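{- Let $\epsilon > 0$. Then almost all positive integers $n$ satisfy $$|\omega(n) - \ln\ln n| < \epsilon \cdot \ln\ln n,$$ where $\omega(n)$ is the number of distinct prime factors of $n$; that is, $$\lim_{N \to \infty} \frac{1}{N} \#\{\, 3 \le n \le N : |\omega(n) - \ln\ln n| < \epsilon \ln\ln n \,\} = 1.$$
   Context: For a positive integer $n$, $\omega(n)$ denotes the number of distinct primes dividing $n$. $\ln$ is the natural logarithm. "Almost all positive integers" means all integers outside a set of natural density $0$; the restriction $n \ge 3$ only ensures $\ln\ln n > 0$. -}

module Defs where

open import Data.Empty using (⊥-elim)
import Data.Integer as ℤ
import Data.Integer.Properties as ℤP
open import Data.List using (List; length; filter; upTo)
open import Data.List.Relation.Unary.All using (All)
open import Data.List.Relation.Unary.Unique.Propositional using (Unique)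
open import Data.Nat as ℕ using (ℕ; zero; suc; z≤n; s≤s)
open import Data.Nat.Divisibility using (_∣_; _∣?_)
open import Data.Nat.Primality using (Prime; prime?)
import Data.Nat.Properties as ℕP
open import Data.Product using (Σ; ∃; ∃₂; _×_; _,_; proj₁; proj₂; Σ-syntax; ∃-syntax)
open import Data.Rational
open import Data.Rational.Properties
open import Data.Rational.Solver using (module +-*-Solver)
import Data.Rational.Unnormalised as ℚᵘ
import Data.Rational.Unnormalised.Properties as ℚᵘP
open import Data.Sum using (inj₁; inj₂)
open import Relation.Binary.PropositionalEquality
open import Relation.Nullary using (¬_; yes; no)
open import Relation.Nullary.Decidable using (_×-dec_)
open import Relation.Binary.Definitions using (tri<; tri≈; tri>)
open import Relation.Unary using (Pred)
open import Level using (0ℓ)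

fromℕ : ℕ → ℚ
fromℕ n = ℤ.+ n / 1

-- Total, with recip 0 = 0.  In ln below, the denominators are eventually bounded
-- away from 0, so the convention does not affect the limit.
recip : ℚ → ℚ
recip q with q ≟ 0ℚ
... | yes _  = 0ℚ
... | no q≢0 = (1/ q) {{≢-nonZero q≢0}}

sum : ℕ → (ℕ → ℚ) → ℚ
sum zero    f = 0ℚ
sum (suc n) f = sum n f + f n

-- The left-endpoint Riemann sum of ∫₁^q dt/t over n equal subintervals.
riemann : ℕ → ℚ → ℚ
riemann n q = sum n (λ i → h * recip (1ℚ + fromℕ i * h))
  where
  h : ℚ
  h = (q - 1ℚ) * recip (fromℕ n)

module Lemmas where

  open +-*-Solver

  0≤1 : 0ℚ ≤ 1ℚ
  0≤1 = *≤* (ℤ.+≤+ z≤n)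

  0<1 : 0ℚ < 1ℚ
  0<1 = *<* (ℤ.+<+ (s≤s z≤n))

  0<½ : 0ℚ < ½
  0<½ = *<* (ℤ.+<+ (s≤s z≤n))

  mulˡ-≤ : ∀ {r p q} → 0ℚ ≤ r → p ≤ q → r * p ≤ r * q
  mulˡ-≤ {r} 0≤r = *-monoˡ-≤-nonNeg r {{nonNegative 0≤r}}

  mulʳ-≤ : ∀ {r p q} → 0ℚ ≤ r → p ≤ q → p * r ≤ q * r
  mulʳ-≤ {r} 0≤r = *-monoʳ-≤-nonNeg r {{nonNegative 0≤r}}

  mulˡ-< : ∀ {r p q} → 0ℚ < r → p < q → r * p < r * q
  mulˡ-< {r} 0<r = *-monoʳ-<-pos r {{positive 0<r}}

  0≤* : ∀ {p q} → 0ℚ ≤ p → 0ℚ ≤ q → 0ℚ ≤ p * q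
  0≤* {p} {q} 0≤p 0≤q = subst (_≤ p * q) (*-zeroʳ p) (mulˡ-≤ 0≤p 0≤q)

  0<* : ∀ {p q} → 0ℚ < p → 0ℚ < q → 0ℚ < p * q
  0<* {p} {q} 0<p 0<q = subst (_< p * q) (*-zeroʳ p) (mulˡ-< 0<p 0<q)

  mul-≤ : ∀ {a b c d} → 0ℚ ≤ c → 0ℚ ≤ b → a ≤ b → c ≤ d → a * c ≤ b * d
  mul-≤ 0≤c 0≤b a≤b c≤d = ≤-trans (mulʳ-≤ 0≤c a≤b) (mulˡ-≤ 0≤b c≤d)

  0≤+ : ∀ {p q} → 0ℚ ≤ p → 0ℚ ≤ q → 0ℚ ≤ p + q
  0≤+ 0≤p 0≤q = ≤-trans (≤-reflexive (sym (+-identityʳ 0ℚ))) (+-mono-≤ 0≤p 0≤q)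

  p≤q⇒0≤q-p : ∀ {p q} → p ≤ q → 0ℚ ≤ q - p
  p≤q⇒0≤q-p {p} {q} p≤q =
    subst (_≤ q - p) (+-inverseʳ p) (+-monoˡ-≤ (- p) p≤q)

  0≤q-p⇒p≤q : ∀ {p q} → 0ℚ ≤ q - p → p ≤ q
  0≤q-p⇒p≤q {p} {q} h = subst₂ _≤_ (+-identityˡ p)
    (solve 2 (λ q p → (q :- p) :+ p := q) refl q p) (+-monoˡ-≤ p h)

  half+half : ∀ δ → δ * ½ + δ * ½ ≡ δ
  half+half δ = trans (sym (*-distribˡ-+ δ ½ ½)) (*-identityʳ δ)

  fromℕ-+ : ∀ m n → fromℕ (m ℕ.+ n) ≡ fromℕ m + fromℕ n
  fromℕ-+ m n = toℚᵘ-injective (begin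
      toℚᵘ (fromℕ (m ℕ.+ n))           ≈⟨ toℚᵘ-fromℚᵘ (ℚᵘ.mkℚᵘ (ℤ.+ (m ℕ.+ n)) 0) ⟩
      ℚᵘ.mkℚᵘ (ℤ.+ (m ℕ.+ n)) 0        ≈⟨ ℚᵘ.*≡* (cong (ℤ._* ℤ.1ℤ) (sym (cong₂ ℤ._+_ (ℤP.*-identityʳ (ℤ.+ m)) (ℤP.*-identityʳ (ℤ.+ n))))) ⟩
      ℚᵘ.mkℚᵘ (ℤ.+ m) 0 ℚᵘ.+ ℚᵘ.mkℚᵘ (ℤ.+ n) 0
        ≈⟨ ℚᵘP.+-cong (ℚᵘP.≃-sym (toℚᵘ-fromℚᵘ (ℚᵘ.mkℚᵘ (ℤ.+ m) 0))) (ℚᵘP.≃-sym (toℚᵘ-fromℚᵘ (ℚᵘ.mkℚᵘ (ℤ.+ n) 0))) ⟩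
      toℚᵘ (fromℕ m) ℚᵘ.+ toℚᵘ (fromℕ n) ≈⟨ toℚᵘ-homo-+ (fromℕ m) (fromℕ n) ⟨
      toℚᵘ (fromℕ m + fromℕ n) ∎)
    where open ℚᵘP.≃-Reasoning

  fromℕ-suc : ∀ n → fromℕ (suc n) ≡ fromℕ n + 1ℚ
  fromℕ-suc n = trans (cong fromℕ (ℕP.+-comm 1 n)) (fromℕ-+ n 1)

  fromℕ-* : ∀ m n → fromℕ (m ℕ.* n) ≡ fromℕ m * fromℕ n
  fromℕ-* zero    n = sym (*-zeroˡ (fromℕ n))
  fromℕ-* (suc m) n = begin
    fromℕ (n ℕ.+ m ℕ.* n)         ≡⟨ fromℕ-+ n (m ℕ.* n) ⟩
    fromℕ n + fromℕ (m ℕ.* n)     ≡⟨ cong (fromℕ n +_) (fromℕ-* m n) ⟩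
    fromℕ n + fromℕ m * fromℕ n   ≡⟨ solve 2 (λ a b → b :+ a :* b := (a :+ con 1ℚ) :* b) refl (fromℕ m) (fromℕ n) ⟩
    (fromℕ m + 1ℚ) * fromℕ n      ≡⟨ cong (_* fromℕ n) (fromℕ-suc m) ⟨
    fromℕ (suc m) * fromℕ n       ∎
    where open ≡-Reasoning

  0≤fromℕ : ∀ n → 0ℚ ≤ fromℕ n
  0≤fromℕ zero    = ≤-refl
  0≤fromℕ (suc n) = subst (0ℚ ≤_) (sym (fromℕ-suc n)) (0≤+ (0≤fromℕ n) 0≤1)

  fromℕ-mono-≤ : ∀ {m n} → m ℕ.≤ n → fromℕ m ≤ fromℕ n
  fromℕ-mono-≤ {m} {n} m≤n = subst₂ _≤_ (+-identityʳ (fromℕ m))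
    (trans (sym (fromℕ-+ m (n ℕ.∸ m))) (cong fromℕ (ℕP.m+[n∸m]≡n m≤n)))
    (+-monoʳ-≤ (fromℕ m) (0≤fromℕ (n ℕ.∸ m)))

  0<fromℕ-suc : ∀ n → 0ℚ < fromℕ (suc n)
  0<fromℕ-suc n = <-≤-trans 0<1 (fromℕ-mono-≤ {1} {suc n} (s≤s z≤n))

  archimedean : ∀ p → ∃[ n ] p < fromℕ n
  archimedean p@(mkℚ (ℤ.-[1+ _ ]) _ _) = 1 , <-trans (negative⁻¹ p) 0<1
  archimedean p@(mkℚ (ℤ.+ a) d _) = suc a , toℚᵘ-cancel-<
    (ℚᵘP.<-respʳ-≃ (ℚᵘP.≃-sym (toℚᵘ-fromℚᵘ (ℚᵘ.mkℚᵘ (ℤ.+ suc a) 0)))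
      (ℚᵘ.*<* (ℤP.<-≤-trans
        (subst (ℤ._< ℤ.+ suc a) (sym (ℤP.*-identityʳ (ℤ.+ a))) (ℤ.+<+ ℕP.≤-refl))
        (ℤ.+≤+ (ℕP.m≤m*n (suc a) (suc d))))))

  recip-inverseʳ : ∀ {q} → 0ℚ < q → q * recip q ≡ 1ℚ
  recip-inverseʳ {q} 0<q with q ≟ 0ℚ
  ... | yes refl = ⊥-elim (<-irrefl refl 0<q)
  ... | no q≢0   = *-inverseʳ q {{≢-nonZero q≢0}}

  0<recip : ∀ {q} → 0ℚ < q → 0ℚ < recip q
  0<recip {q} 0<q with <-cmp 0ℚ (recip q)
  ... | tri< 0<r _ _ = 0<r

  ... | tri≈ _ 0≡r _ = ⊥-elim (<-irrefl
          (trans (trans (sym (*-zeroʳ q)) (cong (q *_) 0≡r)) (recip-inverseʳ 0<q)) 0<1)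
  ... | tri> _ _ r<0 = ⊥-elim (<-asym 0<1
          (subst₂ _<_ (recip-inverseʳ 0<q) (*-zeroʳ q) (mulˡ-< 0<q r<0)))

  recip-antimono : ∀ {p q} → 0ℚ < p → p ≤ q → recip q ≤ recip p
  recip-antimono {p} {q} 0<p p≤q = subst₂ _≤_
    (begin
      (rp * rq) * p  ≡⟨ solve 3 (λ p rp rq → (rp :* rq) :* p := (p :* rp) :* rq) refl p rp rq ⟩
      (p * rp) * rq  ≡⟨ cong (_* rq) (recip-inverseʳ 0<p) ⟩
      1ℚ * rq        ≡⟨ *-identityˡ rq ⟩
      rq             ∎)
    (begin
      (rp * rq) * q  ≡⟨ solve 3 (λ q rp rq → (rp :* rq) :* q := (q :* rq) :* rp) refl q rp rq ⟩
      (q * rq) * rp  ≡⟨ cong (_* rp) (recip-inverseʳ 0<q) ⟩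
      1ℚ * rp        ≡⟨ *-identityˡ rp ⟩
      rp             ∎)
    (mulˡ-≤ (0≤* (<⇒≤ (0<recip 0<p)) (<⇒≤ (0<recip 0<q))) p≤q)
    where
    open ≡-Reasoning
    rp rq : ℚ
    rp = recip p
    rq = recip q
    0<q : 0ℚ < q
    0<q = <-≤-trans 0<p p≤q

  recip-* : ∀ {p q} → 0ℚ < p → 0ℚ < q → recip (p * q) ≡ recip p * recip q
  recip-* {p} {q} 0<p 0<q = begin
    r                       ≡⟨ solve 1 (λ r → r := con 1ℚ :* con 1ℚ :* r) refl r ⟩
    1ℚ * 1ℚ * r             ≡⟨ cong₂ (λ a b → a * b * r) (recip-inverseʳ 0<p) (recip-inverseʳ 0<q) ⟨
    (p * rp) * (q * rq) * r ≡⟨ solve 5 (λ p q rp rq r → (p :* rp) :* (q :* rq) :* r := ((p :* q) :* r) :* (rp :* rq)) refl p q rp rq r ⟩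
    ((p * q) * r) * (rp * rq) ≡⟨ cong (_* (rp * rq)) (recip-inverseʳ (0<* 0<p 0<q)) ⟩
    1ℚ * (rp * rq)          ≡⟨ *-identityˡ (rp * rq) ⟩
    rp * rq                 ∎
    where
    open ≡-Reasoning
    rp rq r : ℚ
    rp = recip p
    rq = recip q
    r  = recip (p * q)

  ∣p-q∣≡∣q-p∣ : ∀ p q → ∣ p - q ∣ ≡ ∣ q - p ∣
  ∣p-q∣≡∣q-p∣ p q = trans (sym (∣-p∣≡∣p∣ (p - q)))
    (cong ∣_∣ (solve 2 (λ p q → :- (p :- q) := q :- p) refl p q))

  triangle : ∀ p q r → ∣ p - r ∣ ≤ ∣ p - q ∣ + ∣ q - r ∣
  triangle p q r = subst (λ z → ∣ z ∣ ≤ ∣ p - q ∣ + ∣ q - r ∣)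
    (solve 3 (λ p q r → (p :- q) :+ (q :- r) := p :- r) refl p q r)
    (∣p+q∣≤∣p∣+∣q∣ (p - q) (q - r))

  p≤∣p∣ : ∀ p → p ≤ ∣ p ∣
  p≤∣p∣ p with ≤-total 0ℚ p
  ... | inj₁ 0≤p = ≤-reflexive (sym (0≤p⇒∣p∣≡p 0≤p))
  ... | inj₂ p≤0 = ≤-trans p≤0 (0≤∣p∣ p)

  abs-≤ : ∀ {p b} → p ≤ b → - p ≤ b → ∣ p ∣ ≤ b
  abs-≤ {p} {b} p≤b -p≤b with ∣p∣≡p∨∣p∣≡-p p
  ... | inj₁ e = subst (_≤ b) (sym e) p≤b
  ... | inj₂ e = subst (_≤ b) (sym e) -p≤b

  ∣p∣≤∣q∣+∣p-q∣ : ∀ p q → ∣ p ∣ ≤ ∣ q ∣ + ∣ p - q ∣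
  ∣p∣≤∣q∣+∣p-q∣ p q = subst (λ z → ∣ z ∣ ≤ ∣ q ∣ + ∣ p - q ∣)
    (solve 2 (λ p q → q :+ (p :- q) := p) refl p q) (∣p+q∣≤∣p∣+∣q∣ q (p - q))

  shift : ∀ {a b c} → a ≤ b + c → a - b ≤ c
  shift {a} {b} {c} h = subst (a - b ≤_)
    (solve 2 (λ b c → (b :+ c) :- b := c) refl b c) (+-monoˡ-≤ (- b) h)

  ∣∣p∣-∣q∣∣≤∣p-q∣ : ∀ p q → ∣ ∣ p ∣ - ∣ q ∣ ∣ ≤ ∣ p - q ∣
  ∣∣p∣-∣q∣∣≤∣p-q∣ p q = abs-≤ (shift (∣p∣≤∣q∣+∣p-q∣ p q))
    (subst₂ _≤_ (solve 2 (λ a b → b :- a := :- (a :- b)) refl ∣ p ∣ ∣ q ∣)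
      (∣p-q∣≡∣q-p∣ q p) (shift (∣p∣≤∣q∣+∣p-q∣ q p)))

  sum-cong : ∀ n {f g : ℕ → ℚ} → (∀ i → f i ≡ g i) → sum n f ≡ sum n g
  sum-cong zero    f≡g = refl
  sum-cong (suc n) f≡g = cong₂ _+_ (sum-cong n f≡g) (f≡g n)

  sum-const : ∀ n c → sum n (λ _ → c) ≡ fromℕ n * c
  sum-const zero    c = sym (*-zeroˡ c)
  sum-const (suc n) c = begin
    sum n (λ _ → c) + c  ≡⟨ cong (_+ c) (sum-const n c) ⟩
    fromℕ n * c + c      ≡⟨ solve 2 (λ m c → m :* c :+ c := (m :+ con 1ℚ) :* c) refl (fromℕ n) c ⟩
    (fromℕ n + 1ℚ) * c   ≡⟨ cong (_* c) (fromℕ-suc n) ⟨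
    fromℕ (suc n) * c    ∎
    where open ≡-Reasoning

  sum-mono-≤ : ∀ n {f g : ℕ → ℚ} → (∀ i → i ℕ.< n → f i ≤ g i) → sum n f ≤ sum n g
  sum-mono-≤ zero    f≤g = ≤-refl
  sum-mono-≤ (suc n) f≤g = +-mono-≤
    (sum-mono-≤ n (λ i i<n → f≤g i (ℕP.m<n⇒m<1+n i<n))) (f≤g n ℕP.≤-refl)

  sum-dist : ∀ n {f g : ℕ → ℚ} b → (∀ i → i ℕ.< n → ∣ f i - g i ∣ ≤ b) →
             ∣ sum n f - sum n g ∣ ≤ fromℕ n * b
  sum-dist zero    b h = ≤-reflexive (sym (*-zeroˡ b))
  sum-dist (suc n) {f} {g} b h = subst₂ (λ y z → ∣ y ∣ ≤ z)
    (solve 4 (λ a b c d → (a :- b) :+ (c :- d) := (a :+ c) :- (b :+ d)) refl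
      (sum n f) (sum n g) (f n) (g n))
    (trans (solve 2 (λ m c → m :* c :+ c := (m :+ con 1ℚ) :* c) refl (fromℕ n) b)
      (cong (_* b) (sym (fromℕ-suc n))))
    (≤-trans (∣p+q∣≤∣p∣+∣q∣ (sum n f - sum n g) (f n - g n))
      (+-mono-≤ (sum-dist n b (λ i i<n → h i (ℕP.m<n⇒m<1+n i<n))) (h n ℕP.≤-refl)))

  sum-+ : ∀ a b f → sum (a ℕ.+ b) f ≡ sum a f + sum b (λ j → f (a ℕ.+ j))
  sum-+ a zero    f = trans (cong (λ n → sum n f) (ℕP.+-identityʳ a)) (sym (+-identityʳ (sum a f)))
  sum-+ a (suc b) f = begin
    sum (a ℕ.+ suc b) f             ≡⟨ cong (λ n → sum n f) (ℕP.+-suc a b) ⟩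
    sum (a ℕ.+ b) f + f (a ℕ.+ b)   ≡⟨ cong (_+ f (a ℕ.+ b)) (sum-+ a b f) ⟩
    (sum a f + sum b (λ j → f (a ℕ.+ j))) + f (a ℕ.+ b)
                                    ≡⟨ +-assoc (sum a f) (sum b (λ j → f (a ℕ.+ j))) (f (a ℕ.+ b)) ⟩
    sum a f + sum (suc b) (λ j → f (a ℕ.+ j)) ∎
    where open ≡-Reasoning

  sum-blocks : ∀ a b f → sum (a ℕ.* b) f ≡ sum a (λ i → sum b (λ j → f (i ℕ.* b ℕ.+ j)))
  sum-blocks zero    b f = refl
  sum-blocks (suc a) b f = begin
    sum (b ℕ.+ a ℕ.* b) f   ≡⟨ cong (λ n → sum n f) (ℕP.+-comm b (a ℕ.* b)) ⟩
    sum (a ℕ.* b ℕ.+ b) f   ≡⟨ sum-+ (a ℕ.* b) b f ⟩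
    sum (a ℕ.* b) f + sum b (λ j → f (a ℕ.* b ℕ.+ j))
      ≡⟨ cong (_+ sum b (λ j → f (a ℕ.* b ℕ.+ j))) (sum-blocks a b f) ⟩
    sum (suc a) (λ i → sum b (λ j → f (i ℕ.* b ℕ.+ j))) ∎
    where open ≡-Reasoning

  recip-dist : ∀ {c a b} → 0ℚ < c → c ≤ a → c ≤ b →
               ∣ recip a - recip b ∣ ≤ ∣ a - b ∣ * (recip c * recip c)
  recip-dist {c} {a} {b} 0<c c≤a c≤b = begin
    ∣ ra - rb ∣                         ≡⟨ cong ∣_∣ eq ⟩
    ∣ (b - a) * (ra * rb) ∣             ≡⟨ ∣p*q∣≡∣p∣*∣q∣ (b - a) (ra * rb) ⟩
    ∣ b - a ∣ * ∣ ra * rb ∣             ≡⟨ cong₂ _*_ (∣p-q∣≡∣q-p∣ b a) (0≤p⇒∣p∣≡p (0≤* 0≤ra 0≤rb)) ⟩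
    ∣ a - b ∣ * (ra * rb)               ≤⟨ mulˡ-≤ (0≤∣p∣ (a - b)) (mul-≤ 0≤rb (≤-trans 0≤ra (recip-antimono 0<c c≤a))
                                             (recip-antimono 0<c c≤a) (recip-antimono 0<c c≤b)) ⟩
    ∣ a - b ∣ * (recip c * recip c)     ∎
    where
    open ≤-Reasoning
    ra rb : ℚ
    ra = recip a
    rb = recip b
    0<a : 0ℚ < a
    0<a = <-≤-trans 0<c c≤a
    0<b : 0ℚ < b
    0<b = <-≤-trans 0<c c≤b
    0≤ra : 0ℚ ≤ ra
    0≤ra = <⇒≤ (0<recip 0<a)
    0≤rb : 0ℚ ≤ rb
    0≤rb = <⇒≤ (0<recip 0<b)
    eq : ra - rb ≡ (b - a) * (ra * rb)
    eq = trans (solve 2 (λ ra rb → ra :- rb := con 1ℚ :* ra :- con 1ℚ :* rb) refl ra rb)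
      (trans (cong₂ (λ y z → y * ra - z * rb) (sym (recip-inverseʳ 0<b)) (sym (recip-inverseʳ 0<a)))
        (solve 4 (λ a b ra rb → (b :* rb) :* ra :- (a :* ra) :* rb := (b :- a) :* (ra :* rb)) refl a b ra rb))

  point-≥ : ∀ {c q} n i → 0ℚ < fromℕ n → i ℕ.≤ n → c ≤ 1ℚ → c ≤ q →
            c ≤ 1ℚ + fromℕ i * ((q - 1ℚ) * recip (fromℕ n))
  point-≥ {c} {q} n i 0<n i≤n c≤1 c≤q = subst₂ _≤_
    (solve 2 (λ c t → (con 1ℚ :- t) :* c :+ t :* c := c) refl c t)
    (solve 3 (λ i q r → (con 1ℚ :- i :* r) :* con 1ℚ :+ (i :* r) :* q := con 1ℚ :+ i :* ((q :- con 1ℚ) :* r))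
      refl (fromℕ i) q (recip (fromℕ n)))
    (+-mono-≤ (mulˡ-≤ (p≤q⇒0≤q-p t≤1) c≤1) (mulˡ-≤ 0≤t c≤q))
    where
    t : ℚ
    t = fromℕ i * recip (fromℕ n)
    0≤t : 0ℚ ≤ t
    0≤t = 0≤* (0≤fromℕ i) (<⇒≤ (0<recip 0<n))
    t≤1 : t ≤ 1ℚ
    t≤1 = subst (t ≤_) (recip-inverseʳ 0<n) (mulʳ-≤ (<⇒≤ (0<recip 0<n)) (fromℕ-mono-≤ i≤n))

  module _ {c : ℚ} (0<c : 0ℚ < c) (c≤1 : c ≤ 1ℚ) where

    private
      K : ℚ
      K = recip c * recip c

      0≤rc : 0ℚ ≤ recip c
      0≤rc = <⇒≤ (0<recip 0<c)

    riemann-lipschitz : ∀ n {p q} → c ≤ p → c ≤ q →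
      ∣ riemann n p - riemann n q ∣ ≤ ∣ p - q ∣ * (recip c * recip c)
    riemann-lipschitz zero {p} {q} c≤p c≤q = 0≤* (0≤∣p∣ (p - q)) (0≤* 0≤rc 0≤rc)
    riemann-lipschitz n@(suc n-1) {p} {q} c≤p c≤q = subst (∣ riemann n p - riemann n q ∣ ≤_)
      (trans (solve 4 (λ m d r k → m :* (d :* r :* k) := (m :* r) :* (d :* k)) refl (fromℕ n) ∣ p - q ∣ r K)
        (trans (cong (_* (∣ p - q ∣ * K)) (recip-inverseʳ 0<n)) (*-identityˡ (∣ p - q ∣ * K))))
      (sum-dist n (∣ p - q ∣ * r * K) term)
      where
      0<n : 0ℚ < fromℕ n
      0<n = 0<fromℕ-suc n-1
      r h h′ : ℚ
      r  = recip (fromℕ n)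
      h  = (p - 1ℚ) * r
      h′ = (q - 1ℚ) * r
      0≤r : 0ℚ ≤ r
      0≤r = <⇒≤ (0<recip 0<n)
      ∣h-h′∣ : ∣ h - h′ ∣ ≡ ∣ p - q ∣ * r
      ∣h-h′∣ = trans
        (cong ∣_∣ (solve 3 (λ p q r → (p :- con 1ℚ) :* r :- (q :- con 1ℚ) :* r := (p :- q) :* r) refl p q r))
        (trans (∣p*q∣≡∣p∣*∣q∣ (p - q) r) (cong (∣ p - q ∣ *_) (0≤p⇒∣p∣≡p 0≤r)))
      term : ∀ i → i ℕ.< n →
             ∣ h * recip (1ℚ + fromℕ i * h) - h′ * recip (1ℚ + fromℕ i * h′) ∣ ≤ ∣ p - q ∣ * r * K
      term i i<n = begin
        ∣ h * ra - h′ * rb ∣           ≡⟨ cong ∣_∣ eq ⟩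
        ∣ (h - h′) * (ra * rb) ∣       ≡⟨ ∣p*q∣≡∣p∣*∣q∣ (h - h′) (ra * rb) ⟩
        ∣ h - h′ ∣ * ∣ ra * rb ∣       ≡⟨ cong₂ _*_ ∣h-h′∣ (0≤p⇒∣p∣≡p (0≤* 0≤ra 0≤rb)) ⟩
        ∣ p - q ∣ * r * (ra * rb)      ≤⟨ mulˡ-≤ (0≤* (0≤∣p∣ (p - q)) 0≤r)
                                            (mul-≤ 0≤rb 0≤rc (recip-antimono 0<c c≤a) (recip-antimono 0<c c≤b)) ⟩
        ∣ p - q ∣ * r * K              ∎
        where
        open ≤-Reasoning
        a b ra rb : ℚ
        a = 1ℚ + fromℕ i * h
        b = 1ℚ + fromℕ i * h′
        ra = recip a
        rb = recip b
        c≤a : c ≤ a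
        c≤a = point-≥ n i 0<n (ℕP.<⇒≤ i<n) c≤1 c≤p
        c≤b : c ≤ b
        c≤b = point-≥ n i 0<n (ℕP.<⇒≤ i<n) c≤1 c≤q
        0≤ra : 0ℚ ≤ ra
        0≤ra = <⇒≤ (0<recip (<-≤-trans 0<c c≤a))
        0≤rb : 0ℚ ≤ rb
        0≤rb = <⇒≤ (0<recip (<-≤-trans 0<c c≤b))
        eq : h * ra - h′ * rb ≡ (h - h′) * (ra * rb)
        eq = trans (solve 4 (λ h h′ ra rb → h :* ra :- h′ :* rb := h :* con 1ℚ :* ra :- h′ :* con 1ℚ :* rb) refl h h′ ra rb)
          (trans (cong₂ (λ y z → h * y * ra - h′ * z * rb)
                   (sym (recip-inverseʳ (<-≤-trans 0<c c≤b))) (sym (recip-inverseʳ (<-≤-trans 0<c c≤a))))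
            (solve 5 (λ h h′ ra rb i →
               h :* ((con 1ℚ :+ i :* h′) :* rb) :* ra :- h′ :* ((con 1ℚ :+ i :* h) :* ra) :* rb
               := (h :- h′) :* (ra :* rb)) refl h h′ ra rb (fromℕ i)))

    riemann-refine : ∀ m n {q} → 0ℚ < fromℕ m → 0ℚ < fromℕ n → c ≤ q →
      ∣ riemann m q - riemann (m ℕ.* n) q ∣ ≤
        (∣ q - 1ℚ ∣ * ∣ q - 1ℚ ∣ * (recip c * recip c)) * recip (fromℕ m)
    riemann-refine m n {q} 0<m 0<n c≤q = subst₂ (λ y z → ∣ riemann m q - y ∣ ≤ z)
      (sym (sum-blocks m n (λ i → h * recip (1ℚ + fromℕ i * h)))) total
      (sum-dist m (fromℕ n * e) block)
      where
      u v h H d e : ℚ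
      u = recip (fromℕ m)
      v = recip (fromℕ n)
      h = (q - 1ℚ) * recip (fromℕ (m ℕ.* n))
      H = (q - 1ℚ) * u
      d = ∣ q - 1ℚ ∣
      e = ∣ h ∣ * ((fromℕ n * ∣ h ∣) * K)
      0<mn : 0ℚ < fromℕ (m ℕ.* n)
      0<mn = subst (0ℚ <_) (sym (fromℕ-* m n)) (0<* 0<m 0<n)
      ruv : recip (fromℕ (m ℕ.* n)) ≡ u * v
      ruv = trans (cong recip (fromℕ-* m n)) (recip-* 0<m 0<n)
      nh≡H : fromℕ n * h ≡ H
      nh≡H = begin
        fromℕ n * h                         ≡⟨ cong (λ z → fromℕ n * ((q - 1ℚ) * z)) ruv ⟩
        fromℕ n * ((q - 1ℚ) * (u * v))      ≡⟨ solve 4 (λ n p u v → n :* (p :* (u :* v)) := (n :* v) :* (p :* u)) refl (fromℕ n) (q - 1ℚ) u v ⟩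
        (fromℕ n * v) * H                   ≡⟨ cong (_* H) (recip-inverseʳ 0<n) ⟩
        1ℚ * H                              ≡⟨ *-identityˡ H ⟩
        H                                   ∎
        where open ≡-Reasoning
      n∣h∣ : fromℕ n * ∣ h ∣ ≡ d * u
      n∣h∣ = begin
        fromℕ n * ∣ h ∣        ≡⟨ cong (_* ∣ h ∣) (0≤p⇒∣p∣≡p (0≤fromℕ n)) ⟨
        ∣ fromℕ n ∣ * ∣ h ∣    ≡⟨ ∣p*q∣≡∣p∣*∣q∣ (fromℕ n) h ⟨
        ∣ fromℕ n * h ∣        ≡⟨ cong ∣_∣ nh≡H ⟩
        ∣ H ∣                  ≡⟨ ∣p*q∣≡∣p∣*∣q∣ (q - 1ℚ) u ⟩
        d * ∣ u ∣              ≡⟨ cong (d *_) (0≤p⇒∣p∣≡p (<⇒≤ (0<recip 0<m))) ⟩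
        d * u                  ∎
        where open ≡-Reasoning
      total : fromℕ m * (fromℕ n * e) ≡ (d * d * K) * u
      total = begin
        fromℕ m * (fromℕ n * e)
          ≡⟨ solve 4 (λ m n h k → m :* (n :* (h :* ((n :* h) :* k))) := m :* ((n :* h) :* ((n :* h) :* k))) refl (fromℕ m) (fromℕ n) ∣ h ∣ K ⟩
        fromℕ m * ((fromℕ n * ∣ h ∣) * ((fromℕ n * ∣ h ∣) * K))
          ≡⟨ cong (λ z → fromℕ m * (z * (z * K))) n∣h∣ ⟩
        fromℕ m * ((d * u) * ((d * u) * K))
          ≡⟨ solve 4 (λ m d u k → m :* ((d :* u) :* ((d :* u) :* k)) := (m :* u) :* ((d :* d :* k) :* u)) refl (fromℕ m) d u K ⟩
        (fromℕ m * u) * ((d * d * K) * u)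
          ≡⟨ cong (_* ((d * d * K) * u)) (recip-inverseʳ 0<m) ⟩
        1ℚ * ((d * d * K) * u)   ≡⟨ *-identityˡ ((d * d * K) * u) ⟩
        (d * d * K) * u          ∎
        where open ≡-Reasoning
      block : ∀ i → i ℕ.< m →
        ∣ H * recip (1ℚ + fromℕ i * H)
          - sum n (λ j → h * recip (1ℚ + fromℕ (i ℕ.* n ℕ.+ j) * h)) ∣ ≤ fromℕ n * e
      block i i<m = subst
        (λ y → ∣ y - sum n (λ j → h * recip (1ℚ + fromℕ (i ℕ.* n ℕ.+ j) * h)) ∣ ≤ fromℕ n * e)
        (trans (sum-const n (h * ra))
          (trans (sym (*-assoc (fromℕ n) h ra)) (cong (_* ra) nh≡H)))
        (sum-dist n e term)
        where
        a ra : ℚ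
        a  = 1ℚ + fromℕ i * H
        ra = recip a
        term : ∀ j → j ℕ.< n →
          ∣ h * ra - h * recip (1ℚ + fromℕ (i ℕ.* n ℕ.+ j) * h) ∣ ≤ e
        term j j<n = begin
          ∣ h * ra - h * rb ∣       ≡⟨ cong ∣_∣ (solve 3 (λ h a b → h :* a :- h :* b := h :* (a :- b)) refl h ra rb) ⟩
          ∣ h * (ra - rb) ∣         ≡⟨ ∣p*q∣≡∣p∣*∣q∣ h (ra - rb) ⟩
          ∣ h ∣ * ∣ ra - rb ∣       ≤⟨ mulˡ-≤ (0≤∣p∣ h) (recip-dist 0<c c≤a c≤b) ⟩
          ∣ h ∣ * (∣ a - b ∣ * K)   ≤⟨ mulˡ-≤ (0≤∣p∣ h) (mulʳ-≤ (0≤* 0≤rc 0≤rc) a-b) ⟩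
          e                         ∎
          where
          open ≤-Reasoning
          b rb : ℚ
          b  = 1ℚ + fromℕ (i ℕ.* n ℕ.+ j) * h
          rb = recip b
          c≤a : c ≤ a
          c≤a = point-≥ m i 0<m (ℕP.<⇒≤ i<m) c≤1 c≤q
          idx : i ℕ.* n ℕ.+ j ℕ.≤ m ℕ.* n
          idx = ℕP.≤-trans (ℕP.+-monoʳ-≤ (i ℕ.* n) (ℕP.<⇒≤ j<n))
            (subst (ℕ._≤ m ℕ.* n) (ℕP.+-comm n (i ℕ.* n)) (ℕP.*-monoˡ-≤ n i<m))
          c≤b : c ≤ b
          c≤b = point-≥ (m ℕ.* n) (i ℕ.* n ℕ.+ j) 0<mn idx c≤1 c≤q
          b≡ : b ≡ 1ℚ + (fromℕ i * (fromℕ n * h) + fromℕ j * h)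
          b≡ = trans
            (cong (λ z → 1ℚ + z * h) (trans (fromℕ-+ (i ℕ.* n) j) (cong (_+ fromℕ j) (fromℕ-* i n))))
            (solve 4 (λ i n j h → con 1ℚ :+ (i :* n :+ j) :* h := con 1ℚ :+ (i :* (n :* h) :+ j :* h)) refl
              (fromℕ i) (fromℕ n) (fromℕ j) h)
          b-a≡ : b - a ≡ fromℕ j * h
          b-a≡ = trans (cong (_- a) (trans b≡ (cong (λ z → 1ℚ + (fromℕ i * z + fromℕ j * h)) nh≡H)))
            (solve 3 (λ i H y → (con 1ℚ :+ (i :* H :+ y)) :- (con 1ℚ :+ i :* H) := y) refl
              (fromℕ i) H (fromℕ j * h))
          a-b : ∣ a - b ∣ ≤ fromℕ n * ∣ h ∣
          a-b = begin
            ∣ a - b ∣              ≡⟨ ∣p-q∣≡∣q-p∣ a b ⟩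
            ∣ b - a ∣              ≡⟨ cong ∣_∣ b-a≡ ⟩
            ∣ fromℕ j * h ∣        ≡⟨ ∣p*q∣≡∣p∣*∣q∣ (fromℕ j) h ⟩
            ∣ fromℕ j ∣ * ∣ h ∣    ≡⟨ cong (_* ∣ h ∣) (0≤p⇒∣p∣≡p (0≤fromℕ j)) ⟩
            fromℕ j * ∣ h ∣        ≤⟨ mulʳ-≤ (0≤∣p∣ h) (fromℕ-mono-≤ (ℕP.<⇒≤ j<n)) ⟩
            fromℕ n * ∣ h ∣        ∎

    riemann-dist : ∀ m n {q} → 0ℚ < fromℕ m → 0ℚ < fromℕ n → c ≤ q →
      ∣ riemann m q - riemann n q ∣ ≤
        (∣ q - 1ℚ ∣ * ∣ q - 1ℚ ∣ * (recip c * recip c)) * (recip (fromℕ m) + recip (fromℕ n))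
    riemann-dist m n {q} 0<m 0<n c≤q = ≤-trans (triangle (riemann m q) (riemann (m ℕ.* n) q) (riemann n q))
      (subst (∣ riemann m q - riemann (m ℕ.* n) q ∣ + ∣ riemann (m ℕ.* n) q - riemann n q ∣ ≤_)
        (sym (*-distribˡ-+ C (recip (fromℕ m)) (recip (fromℕ n))))
        (+-mono-≤ (riemann-refine m n 0<m 0<n c≤q)
          (subst (_≤ C * recip (fromℕ n))
            (trans (∣p-q∣≡∣q-p∣ (riemann n q) (riemann (n ℕ.* m) q))
              (cong (λ k → ∣ riemann k q - riemann n q ∣) (ℕP.*-comm n m)))
            (riemann-refine n m 0<n 0<m c≤q))))
      where
      C : ℚ
      C = ∣ q - 1ℚ ∣ * ∣ q - 1ℚ ∣ * K

open Lemmas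

IsCauchy : (ℕ → ℚ) → Set
IsCauchy s = ∀ δ → 0ℚ < δ →
  ∃[ K ] ∀ m n → K ℕ.≤ m → K ℕ.≤ n → ∣ s m - s n ∣ < δ

-- Cauchy sequences of rationals, as representatives: order and the operations are
-- insensitive to passing to an equivalent sequence, so no quotient is needed.
record ℝ : Set where
  field
    seq      : ℕ → ℚ
    isCauchy : IsCauchy seq

open ℝ public

infix  4 _<ᴿ_
infixl 6 _-ᴿ_
infixl 7 _*ᴿ_

_<ᴿ_ : ℝ → ℝ → Set
x <ᴿ y = ∃[ δ ] 0ℚ < δ × ∃[ K ] ∀ m → K ℕ.≤ m → seq x m + δ ≤ seq y m

module CauchyLemmas where

  open +-*-Solver

  const-cauchy : ∀ q → IsCauchy (λ _ → q)
  const-cauchy q δ 0<δ = 0 , λ _ _ _ _ → subst (λ z → ∣ z ∣ < δ) (sym (+-inverseʳ q)) 0<δ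

  0<half : ∀ {δ} → 0ℚ < δ → 0ℚ < δ * ½
  0<half 0<δ = 0<* 0<δ 0<½

  split : ∀ {a b δ} → a < δ * ½ → b < δ * ½ → a + b < δ
  split {a} {b} {δ} h k = subst (a + b <_) (half+half δ) (+-mono-< h k)

  scale : ∀ {B d δ} → 0ℚ < B → d < δ * recip B → B * d < δ
  scale {B} {d} {δ} 0<B h = subst (B * d <_)
    (trans (solve 3 (λ B δ r → B :* (δ :* r) := (B :* r) :* δ) refl B δ (recip B))
      (trans (cong (_* δ) (recip-inverseʳ 0<B)) (*-identityˡ δ)))
    (mulˡ-< 0<B h)

  sub-cauchy : ∀ {s t} → IsCauchy s → IsCauchy t → IsCauchy (λ m → s m - t m)
  sub-cauchy {s} {t} cs ct δ 0<δ with cs (δ * ½) (0<half 0<δ) | ct (δ * ½) (0<half 0<δ)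
  ... | K , hs | L , ht = K ℕ.⊔ L , λ m n km kn → ≤-<-trans
    (subst₂ (λ y z → ∣ y ∣ ≤ ∣ s m - s n ∣ + z)
      (solve 4 (λ a b c d → (a :- b) :+ :- (c :- d) := (a :- c) :- (b :- d)) refl (s m) (s n) (t m) (t n))
      (∣-p∣≡∣p∣ (t m - t n))
      (∣p+q∣≤∣p∣+∣q∣ (s m - s n) (- (t m - t n))))
    (split {δ = δ} (hs m n (ℕP.m⊔n≤o⇒m≤o K L km) (ℕP.m⊔n≤o⇒m≤o K L kn))
                   (ht m n (ℕP.m⊔n≤o⇒n≤o K L km) (ℕP.m⊔n≤o⇒n≤o K L kn)))

  abs-cauchy : ∀ {s} → IsCauchy s → IsCauchy (λ m → ∣ s m ∣)
  abs-cauchy {s} cs δ 0<δ with cs δ 0<δ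
  ... | K , hs = K , λ m n km kn → ≤-<-trans (∣∣p∣-∣q∣∣≤∣p-q∣ (s m) (s n)) (hs m n km kn)

  EventuallyBounded : (ℕ → ℚ) → Set
  EventuallyBounded f = ∃[ B ] 0ℚ < B × ∃[ K ] ∀ m → K ℕ.≤ m → ∣ f m ∣ ≤ B

  bounded : ∀ {s} → IsCauchy s → EventuallyBounded s
  bounded {s} cs with cs 1ℚ 0<1
  ... | K , hs = ∣ s K ∣ + 1ℚ
    , <-≤-trans 0<1 (subst (_≤ ∣ s K ∣ + 1ℚ) (+-identityˡ 1ℚ) (+-monoˡ-≤ 1ℚ (0≤∣p∣ (s K))))
    , K , λ m km → ≤-trans (∣p∣≤∣q∣+∣p-q∣ (s m) (s K))
            (+-monoʳ-≤ ∣ s K ∣ (<⇒≤ (hs m K km ℕP.≤-refl)))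

  mul-dist : ∀ a b c d {B C} → ∣ a ∣ ≤ B → ∣ d ∣ ≤ C →
             ∣ a * c - b * d ∣ ≤ B * ∣ c - d ∣ + C * ∣ a - b ∣
  mul-dist a b c d {B} {C} ∣a∣≤B ∣d∣≤C = begin
    ∣ a * c - b * d ∣
      ≡⟨ cong ∣_∣ (solve 4 (λ a b c d → a :* c :- b :* d := a :* (c :- d) :+ d :* (a :- b)) refl a b c d) ⟩
    ∣ a * (c - d) + d * (a - b) ∣
      ≤⟨ ∣p+q∣≤∣p∣+∣q∣ (a * (c - d)) (d * (a - b)) ⟩
    ∣ a * (c - d) ∣ + ∣ d * (a - b) ∣
      ≡⟨ cong₂ _+_ (∣p*q∣≡∣p∣*∣q∣ a (c - d)) (∣p*q∣≡∣p∣*∣q∣ d (a - b)) ⟩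
    ∣ a ∣ * ∣ c - d ∣ + ∣ d ∣ * ∣ a - b ∣
      ≤⟨ +-mono-≤ (mulʳ-≤ (0≤∣p∣ (c - d)) ∣a∣≤B) (mulʳ-≤ (0≤∣p∣ (a - b)) ∣d∣≤C) ⟩
    B * ∣ c - d ∣ + C * ∣ a - b ∣ ∎
    where open ≤-Reasoning

  below⊔ : ∀ a b c d {o} → a ℕ.⊔ b ℕ.⊔ c ℕ.⊔ d ℕ.≤ o →
           a ℕ.≤ o × b ℕ.≤ o × c ℕ.≤ o × d ℕ.≤ o
  below⊔ a b c d {o} h =
    ℕP.m⊔n≤o⇒m≤o a b ab , ℕP.m⊔n≤o⇒n≤o a b ab ,
    ℕP.m⊔n≤o⇒n≤o (a ℕ.⊔ b) c abc , ℕP.m⊔n≤o⇒n≤o (a ℕ.⊔ b ℕ.⊔ c) d h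
    where
    abc : a ℕ.⊔ b ℕ.⊔ c ℕ.≤ o
    abc = ℕP.m⊔n≤o⇒m≤o (a ℕ.⊔ b ℕ.⊔ c) d h
    ab : a ℕ.⊔ b ℕ.≤ o
    ab = ℕP.m⊔n≤o⇒m≤o (a ℕ.⊔ b) c abc

  mul-cauchy : ∀ {s t} → IsCauchy s → IsCauchy t → IsCauchy (λ m → s m * t m)
  mul-cauchy {s} {t} cs ct δ 0<δ = from-bounds (bounded {s} cs) (bounded {t} ct)
    where
    from-bounds : EventuallyBounded s → EventuallyBounded t →
      ∃[ K ] ∀ m n → K ℕ.≤ m → K ℕ.≤ n → ∣ s m * t m - s n * t n ∣ < δ
    from-bounds (B , 0<B , K₁ , hB) (C , 0<C , K₂ , hC) =
      K₁ ℕ.⊔ K₂ ℕ.⊔ proj₁ ht ℕ.⊔ proj₁ hs , go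
      where
      ht = ct (δ * ½ * recip B) (0<* {δ * ½} {recip B} (0<half 0<δ) (0<recip 0<B))
      hs = cs (δ * ½ * recip C) (0<* {δ * ½} {recip C} (0<half 0<δ) (0<recip 0<C))
      go : ∀ m n → K₁ ℕ.⊔ K₂ ℕ.⊔ proj₁ ht ℕ.⊔ proj₁ hs ℕ.≤ m →
           K₁ ℕ.⊔ K₂ ℕ.⊔ proj₁ ht ℕ.⊔ proj₁ hs ℕ.≤ n → ∣ s m * t m - s n * t n ∣ < δ
      go m n km kn =
        let k₁m , _ , k₃m , k₄m = below⊔ K₁ K₂ (proj₁ ht) (proj₁ hs) km
            _ , k₂n , k₃n , k₄n = below⊔ K₁ K₂ (proj₁ ht) (proj₁ hs) kn
        in ≤-<-trans
        (mul-dist (s m) (s n) (t m) (t n) (hB m k₁m) (hC n k₂n))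
        (split {B * ∣ t m - t n ∣} {C * ∣ s m - s n ∣} {δ}
          (scale {B} {∣ t m - t n ∣} {δ * ½} 0<B (proj₂ ht m n k₃m k₃n))
          (scale {C} {∣ s m - s n ∣} {δ * ½} 0<C (proj₂ hs m n k₄m k₄n)))

  vanishing : ∀ {A δ} → 0ℚ < δ → ∃[ N ] ∀ m → N ℕ.≤ m → A * recip (fromℕ (suc m)) < δ
  vanishing {A} {δ} 0<δ with archimedean (A * recip δ)
  ... | N , h = N , λ m N≤m →
    let u   = recip (fromℕ (suc m))
        0<s = 0<fromℕ-suc m
    in subst₂ _<_
         (trans (solve 4 (λ A δ r u → (δ :* u) :* (A :* r) := (δ :* r) :* (A :* u)) refl A δ (recip δ) u)
           (trans (cong (_* (A * u)) (recip-inverseʳ 0<δ)) (*-identityˡ (A * u))))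
         (trans (solve 3 (λ δ s u → (δ :* u) :* s := (s :* u) :* δ) refl δ (fromℕ (suc m)) u)
           (trans (cong (_* δ) (recip-inverseʳ 0<s)) (*-identityˡ δ)))
         (mulˡ-< (0<* 0<δ (0<recip 0<s))
           (<-≤-trans h (fromℕ-mono-≤ {N} {suc m} (ℕP.m≤n⇒m≤1+n N≤m))))

  below-1 : ∀ {p} → 0ℚ < p → ∃[ c ] 0ℚ < c × c ≤ 1ℚ × c ≤ p
  below-1 {p} 0<p with ≤-total p 1ℚ
  ... | inj₁ p≤1 = p , 0<p , p≤1 , ≤-refl
  ... | inj₂ 1≤p = 1ℚ , 0<1 , ≤-refl , 1≤p

  riemann-dist₂ : ∀ {c B} m n p q → 0ℚ < c → c ≤ 1ℚ → 0ℚ ≤ B → c ≤ p → c ≤ q → ∣ q - 1ℚ ∣ ≤ B →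
    ∣ riemann (suc m) p - riemann (suc n) q ∣ ≤
      recip c * recip c * ∣ p - q ∣
        + (B * B * (recip c * recip c) * recip (fromℕ (suc m))
           + B * B * (recip c * recip c) * recip (fromℕ (suc n)))
  riemann-dist₂ {c} {B} m n p q 0<c c≤1 0≤B c≤p c≤q ∣q-1∣≤B = begin
    ∣ riemann (suc m) p - riemann (suc n) q ∣
      ≤⟨ triangle (riemann (suc m) p) (riemann (suc m) q) (riemann (suc n) q) ⟩
    ∣ riemann (suc m) p - riemann (suc m) q ∣ + ∣ riemann (suc m) q - riemann (suc n) q ∣
      ≤⟨ +-mono-≤ (riemann-lipschitz 0<c c≤1 (suc m) c≤p c≤q)
                  (riemann-dist 0<c c≤1 (suc m) (suc n) (0<fromℕ-suc m) (0<fromℕ-suc n) c≤q) ⟩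
    ∣ p - q ∣ * k + ∣ q - 1ℚ ∣ * ∣ q - 1ℚ ∣ * k * (u + v)
      ≤⟨ +-monoʳ-≤ (∣ p - q ∣ * k) (mulʳ-≤ (0≤+ (<⇒≤ (0<recip (0<fromℕ-suc m))) (<⇒≤ (0<recip (0<fromℕ-suc n))))
           (mulʳ-≤ (<⇒≤ (0<* (0<recip 0<c) (0<recip 0<c))) (mul-≤ (0≤∣p∣ (q - 1ℚ)) 0≤B ∣q-1∣≤B ∣q-1∣≤B))) ⟩
    ∣ p - q ∣ * k + B * B * k * (u + v)
      ≡⟨ cong₂ _+_ (*-comm ∣ p - q ∣ k) (*-distribˡ-+ (B * B * k) u v) ⟩
    k * ∣ p - q ∣ + (B * B * k * u + B * B * k * v) ∎
    where
    open ≤-Reasoning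
    k u v : ℚ
    k = recip c * recip c
    u = recip (fromℕ (suc m))
    v = recip (fromℕ (suc n))

  EventuallyPositive : (ℕ → ℚ) → Set
  EventuallyPositive f = ∃[ p ] 0ℚ < p × ∃[ K ] ∀ m → K ℕ.≤ m → p ≤ f m

  ln-cauchy : ∀ {s} → IsCauchy s → EventuallyPositive s → IsCauchy (λ m → riemann (suc m) (s m))
  ln-cauchy {s} cs (p , 0<p , K₁ , hp) δ 0<δ =
    from-bounds (below-1 0<p) (bounded {λ m → s m - 1ℚ} (sub-cauchy {s} {λ _ → 1ℚ} cs (const-cauchy 1ℚ)))
    where
    from-bounds : (∃[ c ] 0ℚ < c × c ≤ 1ℚ × c ≤ p) → EventuallyBounded (λ m → s m - 1ℚ) →
      ∃[ K ] ∀ m n → K ℕ.≤ m → K ℕ.≤ n → ∣ riemann (suc m) (s m) - riemann (suc n) (s n) ∣ < δ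
    from-bounds (c , 0<c , c≤1 , c≤p) (B , 0<B , K₂ , hB) = K₁ ℕ.⊔ K₂ ℕ.⊔ proj₁ hs ℕ.⊔ proj₁ hv , go
      where
      k A : ℚ
      k = recip c * recip c
      A = B * B * k
      0<k : 0ℚ < k
      0<k = 0<* {recip c} {recip c} (0<recip 0<c) (0<recip 0<c)
      hs = cs (δ * ½ * recip k) (0<* {δ * ½} {recip k} (0<half 0<δ) (0<recip 0<k))
      hv = vanishing {A} {δ * ½ * ½} (0<half (0<half 0<δ))
      go : ∀ m n → K₁ ℕ.⊔ K₂ ℕ.⊔ proj₁ hs ℕ.⊔ proj₁ hv ℕ.≤ m →
           K₁ ℕ.⊔ K₂ ℕ.⊔ proj₁ hs ℕ.⊔ proj₁ hv ℕ.≤ n →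
           ∣ riemann (suc m) (s m) - riemann (suc n) (s n) ∣ < δ
      go m n km kn =
        let k₁m , _ , k₃m , k₄m = below⊔ K₁ K₂ (proj₁ hs) (proj₁ hv) km
            k₁n , k₂n , k₃n , k₄n = below⊔ K₁ K₂ (proj₁ hs) (proj₁ hv) kn
        in ≤-<-trans
        (riemann-dist₂ {c} {B} m n (s m) (s n) 0<c c≤1 (<⇒≤ 0<B)
          (≤-trans c≤p (hp m k₁m)) (≤-trans c≤p (hp n k₁n)) (hB n k₂n))
        (split {k * ∣ s m - s n ∣} {A * recip (fromℕ (suc m)) + A * recip (fromℕ (suc n))} {δ}
          (scale {k} {∣ s m - s n ∣} {δ * ½} 0<k (proj₂ hs m n k₃m k₃n))
          (split {A * recip (fromℕ (suc m))} {A * recip (fromℕ (suc n))} {δ * ½}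
            (proj₂ hv m k₄m) (proj₂ hv n k₄n)))

open CauchyLemmas

_-ᴿ_ : ℝ → ℝ → ℝ
x -ᴿ y = record { seq = λ m → seq x m - seq y m ; isCauchy = sub-cauchy {seq x} {seq y} (isCauchy x) (isCauchy y) }

_*ᴿ_ : ℝ → ℝ → ℝ
x *ᴿ y = record { seq = λ m → seq x m * seq y m ; isCauchy = mul-cauchy {seq x} {seq y} (isCauchy x) (isCauchy y) }

∣_∣ᴿ : ℝ → ℝ
∣ x ∣ᴿ = record { seq = λ m → ∣ seq x m ∣ ; isCauchy = abs-cauchy {seq x} (isCauchy x) }

fromℚ : ℚ → ℝ
fromℚ q = record { seq = λ _ → q ; isCauchy = const-cauchy q }

0ᴿ 1ᴿ : ℝ
0ᴿ = fromℚ 0ℚ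
1ᴿ = fromℚ 1ℚ

natᴿ : ℕ → ℝ
natᴿ n = fromℚ (fromℕ n)

0<⇒eventually-≥ : ∀ {x} → 0ᴿ <ᴿ x → EventuallyPositive (seq x)
0<⇒eventually-≥ {x} (δ , 0<δ , K , h) =
  δ , 0<δ , K , λ m km → subst (_≤ seq x m) (+-identityˡ δ) (h m km)

-- ln x = ∫₁ˣ dt/t, as the limit of the Riemann sums of ∫ dt/t from 1 to the
-- m-th approximation of x over m + 1 equal subintervals.
ln : (x : ℝ) → 0ᴿ <ᴿ x → ℝ
ln x 0<x = record
  { seq      = λ m → riemann (suc m) (seq x m)
  ; isCauchy = ln-cauchy {seq x} (isCauchy x) (0<⇒eventually-≥ {x} 0<x)
  }

<ᴿ-trans : ∀ {x y z} → x <ᴿ y → y <ᴿ z → x <ᴿ z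
<ᴿ-trans {x} {y} {z} (δ , 0<δ , K , h) (η , 0<η , L , k) = δ , 0<δ , K ℕ.⊔ L , λ m km →
  ≤-trans (h m (ℕP.m⊔n≤o⇒m≤o K L km))
    (≤-trans (subst (_≤ seq y m + η) (+-identityʳ (seq y m)) (+-monoʳ-≤ (seq y m) (<⇒≤ 0<η)))
      (k m (ℕP.m⊔n≤o⇒n≤o K L km)))

0ᴿ<1ᴿ : 0ᴿ <ᴿ 1ᴿ
0ᴿ<1ᴿ = 1ℚ , 0<1 , 0 , λ _ _ → ≤-reflexive (+-identityˡ 1ℚ)

riemann-≥ : ∀ n {q} → 0ℚ < fromℕ n → 1ℚ ≤ q → (q - 1ℚ) * recip q ≤ riemann n q
riemann-≥ n {q} 0<n 1≤q = subst (_≤ riemann n q) const≡ (sum-mono-≤ n term)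
  where
  open +-*-Solver
  r h : ℚ
  r = recip (fromℕ n)
  h = (q - 1ℚ) * r
  0<q : 0ℚ < q
  0<q = <-≤-trans 0<1 1≤q
  0≤h : 0ℚ ≤ h
  0≤h = 0≤* (p≤q⇒0≤q-p 1≤q) (<⇒≤ (0<recip 0<n))
  nh≡ : fromℕ n * h ≡ q - 1ℚ
  nh≡ = trans (solve 3 (λ n p r → n :* (p :* r) := (n :* r) :* p) refl (fromℕ n) (q - 1ℚ) r)
    (trans (cong (_* (q - 1ℚ)) (recip-inverseʳ 0<n)) (*-identityˡ (q - 1ℚ)))
  const≡ : sum n (λ _ → h * recip q) ≡ (q - 1ℚ) * recip q
  const≡ = trans (sum-const n (h * recip q))
    (trans (sym (*-assoc (fromℕ n) h (recip q))) (cong (_* recip q) nh≡))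
  term : ∀ i → i ℕ.< n → h * recip q ≤ h * recip (1ℚ + fromℕ i * h)
  term i i<n = mulˡ-≤ 0≤h (recip-antimono
    (<-≤-trans 0<1 (point-≥ n i 0<n (ℕP.<⇒≤ i<n) ≤-refl 1≤q))
    (subst (1ℚ + fromℕ i * h ≤_) (trans (cong (1ℚ +_) nh≡) (solve 1 (λ q → con 1ℚ :+ (q :- con 1ℚ) := q) refl q))
      (+-monoʳ-≤ 1ℚ (mulʳ-≤ 0≤h (fromℕ-mono-≤ (ℕP.<⇒≤ i<n))))))

ln-positive : ∀ {x} → 1ᴿ <ᴿ x → (0<x : 0ᴿ <ᴿ x) → 0ᴿ <ᴿ ln x 0<x
ln-positive {x} (δ , 0<δ , K , h) _ = from-bound (bounded {seq x} (isCauchy x))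
  where
  open +-*-Solver
  from-bound : EventuallyBounded (seq x) →
    ∃[ η ] 0ℚ < η × ∃[ N ] ∀ m → N ℕ.≤ m → 0ℚ + η ≤ riemann (suc m) (seq x m)
  from-bound (B , 0<B , L , hB) = δ * recip B , 0<* {δ} {recip B} 0<δ (0<recip 0<B) , K ℕ.⊔ L , go
    where
    go : ∀ m → K ℕ.⊔ L ℕ.≤ m → 0ℚ + δ * recip B ≤ riemann (suc m) (seq x m)
    go m km = begin
      0ℚ + δ * recip B         ≡⟨ +-identityˡ (δ * recip B) ⟩
      δ * recip B              ≤⟨ mul-≤ (<⇒≤ (0<recip 0<B)) (p≤q⇒0≤q-p 1≤) δ≤
                                   (recip-antimono (<-≤-trans 0<1 1≤)
                                     (≤-trans (p≤∣p∣ (seq x m)) (hB m (ℕP.m⊔n≤o⇒n≤o K L km)))) ⟩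
      (seq x m - 1ℚ) * recip (seq x m)  ≤⟨ riemann-≥ (suc m) (0<fromℕ-suc m) 1≤ ⟩
      riemann (suc m) (seq x m)         ∎
      where
      open ≤-Reasoning
      1+δ≤ : 1ℚ + δ ≤ seq x m
      1+δ≤ = h m (ℕP.m⊔n≤o⇒m≤o K L km)
      1≤ : 1ℚ ≤ seq x m
      1≤ = ≤-trans (subst (_≤ 1ℚ + δ) (+-identityʳ 1ℚ) (+-monoʳ-≤ 1ℚ (<⇒≤ 0<δ))) 1+δ≤
      δ≤ : δ ≤ seq x m - 1ℚ
      δ≤ = subst (_≤ seq x m - 1ℚ) (solve 1 (λ d → (con 1ℚ :+ d) :- con 1ℚ := d) refl δ)
             (+-monoˡ-≤ (- 1ℚ) 1+δ≤)

1<natᴿ : ∀ {n} → 3 ℕ.≤ n → 1ᴿ <ᴿ natᴿ n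
1<natᴿ {n} 3≤n = 1ℚ , 0<1 , 0 , λ _ _ → fromℕ-mono-≤ {2} {n} (ℕP.≤-trans (s≤s (s≤s z≤n)) 3≤n)

0<natᴿ : ∀ {n} → 3 ℕ.≤ n → 0ᴿ <ᴿ natᴿ n
0<natᴿ {n} 3≤n = <ᴿ-trans {0ᴿ} {1ᴿ} {natᴿ n} 0ᴿ<1ᴿ (1<natᴿ 3≤n)

lnln : (n : ℕ) → 3 ℕ.≤ n → ℝ
lnln n 3≤n = ln (ln (natᴿ n) (0<natᴿ 3≤n)) (ln-positive {natᴿ n} (1<natᴿ 3≤n) (0<natᴿ 3≤n))

-- For n ≥ 1 every divisor of n is at most n, so the range loses nothing.
ω : ℕ → ℕ
ω n = length (filter (λ p → prime? p ×-dec (p ∣? n)) (upTo (suc n)))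

AtLeast : ℕ → Pred ℕ 0ℓ → Set
AtLeast a S = ∃[ xs ] Unique xs × All S xs × a ℕ.≤ length xs

AtMost : ℕ → Pred ℕ 0ℓ → Set
AtMost b S = ∀ xs → Unique xs → All S xs → length xs ℕ.≤ b

-- lim_{N → ∞} #(S N) / N = ℓ.  Membership in S N may be undecidable, so #(S N)
-- is not available as a natural number; instead it is enclosed between numbers
-- a ≤ #(S N) ≤ b that both satisfy the defining inequality of the limit.  When
-- S N has a cardinality, this says exactly that ∣ #(S N) / N - ℓ ∣ < δ.
LimitingProportion : (ℕ → Pred ℕ 0ℓ) → ℚ → Set
LimitingProportion S ℓ = ∀ δ → 0ℚ < δ → ∃[ N₀ ] ∀ N → .{{_ : ℕ.NonZero N}} → N₀ ℕ.≤ N →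
  ∃[ a ] ∃[ b ] AtLeast a (S N) × AtMost b (S N)
    × ∣ ℤ.+ a / N - ℓ ∣ < δ × ∣ ℤ.+ b / N - ℓ ∣ < δ

HasNaturalDensity : Pred ℕ 0ℓ → ℚ → Set
HasNaturalDensity A = LimitingProportion (λ N n → 1 ℕ.≤ n × n ℕ.≤ N × A n)

-- All positive integers outside a set of natural density 0.
AlmostAll : Pred ℕ 0ℓ → Set₁
AlmostAll P = Σ[ E ∈ Pred ℕ 0ℓ ] HasNaturalDensity E 0ℚ × (∀ n → 1 ℕ.≤ n → ¬ E n → P n)

ωNear : ℝ → Pred ℕ 0ℓ
ωNear ε n = Σ[ 3≤n ∈ 3 ℕ.≤ n ] ∣ natᴿ (ω n) -ᴿ lnln n 3≤n ∣ᴿ <ᴿ ε *ᴿ lnln n 3≤n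

{-# OPTIONS --safe #-}
module Submission where

-- Write P n for the sum of 1/p over the primes p ≤ n.  Expanding the square and
-- using only N/d - 1 < ⌊N/d⌋ ≤ N/d gives Turán's bound
--   Σ_{n ≤ N} (ω n - P N)² ≤ 3 N P N,
-- and P varies by O(1) on [N/s, N], so ω n is close to P n off a set of density 0.
--
-- It remains to see that P n ~ ln ln n.  Euler's product Π_{p ≤ n} (1 + 1/(p - 1))
-- is at least the harmonic number H n, so ln (H n) ≤ P n + 1.  Conversely, an
-- integer with k prime factors has at most k! ordered factorisations into primes
-- and H (x y) ≤ H x + H y, so (P n)ᵏ ≤ k! H (nᵏ) ≤ k! k H n; with k = ⌊P n⌋
-- this gives ln (H n) ≥ P n - O(ln (P n)).  Finally H n = ln n + O(1).

-- Since ln is given by Riemann sums indexed by m, all estimates are made on these sums. Between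
-- fixed rationals they are compared by `≲`, and ln x + a/(1 + a) ≤ ln (x (1 + a)) ≤ ln x + a stands
-- in for the functional equation: a product is treated factor by factor. In ln ln n the inner
-- argument moves with m. Riemann sums are monotone in their endpoint at each single m, so that
-- argument can be exchanged for a fixed rational near H n; this is why the rational H n mediates
-- between P n and ln ln n. The power inequality replaces an exponential: for k close to P n, (P
-- n)ᵏ/k! is nearly the largest term of exp (P n), so (P n)ᵏ/k! ≤ k H n almost says P n ≤ ln (H n).
-- What is lost is logarithmic in P n, and it is only ever used as an arbitrarily small multiple of
-- P n. The exceptional set is defined by comparing ω n with P n. That is a decidable condition on
-- rationals, so its members can be counted, while the inequality of the theorem is one between
-- reals.

open import Defs
import Data.Integer as ℤ
import Data.Integer.Properties as ℤP
open import Data.Empty using (⊥-elim)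
open import Data.List using (List; []; _∷_; length; filter; applyUpTo; _++_)
open import Data.List.Properties using (length-applyUpTo; length-++-sucʳ)
open import Data.List.Membership.Propositional using (_∈_)
open import Data.List.Membership.Propositional.Properties
  using (∈-∃++; ∈-++⁻; ∈-++⁺ˡ; ∈-++⁺ʳ; ∈-filter⁺; ∈-applyUpTo⁺)
open import Data.List.Relation.Binary.Permutation.Propositional.Properties using (↭-length)
open import Data.List.Relation.Unary.All as All using (All; []; _∷_)
import Data.List.Relation.Unary.All.Properties as AllP
open import Data.List.Relation.Unary.AllPairs using ([]; _∷_)
open import Data.List.Relation.Unary.Any using (here; there)
open import Data.List.Relation.Unary.Unique.Propositional using (Unique)
import Data.List.Relation.Unary.Unique.Propositional.Properties as UniqueP
open import Data.Nat as ℕ using (ℕ; zero; suc; z≤n; s≤s; _!)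
open import Data.Nat.Divisibility
  using (_∣_; _∣?_; divides; ∣⇒≤; ∣m+n∣m⇒∣n; n∣m*n; m∣m*n; ∣m⇒∣m*n; *-monoʳ-∣; ∣1⇒≡1)
open import Data.Nat.ListAction using (product)
open import Data.Nat.Primality
  using (Prime; prime?; ¬prime[0]; ¬prime[1]; euclidsLemma; prime⇒irreducible)
open import Data.Nat.Primality.Factorisation
  using (PrimeFactorisation; factors; factorise; factorisationUnique)
import Data.Nat.Properties as ℕP
open import Data.Product using (_×_; _,_; proj₁; proj₂; ∃-syntax)
open import Data.Rational
open import Data.Rational.Properties
open import Data.Rational.Solver using (module +-*-Solver)
import Data.Rational.Unnormalised as ℚᵘ
import Data.Rational.Unnormalised.Properties as ℚᵘP
open import Data.Sum using (inj₁; inj₂)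
open import Function using (_∘_; id)
open import Level using (0ℓ)
open import Relation.Binary.PropositionalEquality
open import Relation.Nullary using (¬_; Dec; yes; no)
open import Relation.Nullary.Decidable using (_×-dec_; ¬?; decidable-stable)
open import Relation.Unary using (Pred; Decidable)

open Lemmas
open CauchyLemmas using (vanishing; split; 0<half)
open PrimeFactorisation using (isFactorisation; factorsPrime)
open +-*-Solver

-- Rational inequalities

-- Linear arithmetic by a ring identity: the hypotheses are added up to `a ≤ b`, and the solver only
-- has to see that the two differences agree.
≤-by : ∀ {a b p q} → a ≤ b → b - a ≡ q - p → p ≤ q
≤-by a≤b e = 0≤q-p⇒p≤q (subst (0ℚ ≤_) e (p≤q⇒0≤q-p a≤b))

p≤p+q : ∀ {p q} → 0ℚ ≤ q → p ≤ p + q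
p≤p+q {p} {q} 0≤q = ≤-by 0≤q (solve 2 (λ p q → q :- con 0ℚ := (p :+ q) :- p) refl p q)

0≤p*p : ∀ p → 0ℚ ≤ p * p
0≤p*p p with ≤-total 0ℚ p
... | inj₁ 0≤p = 0≤* 0≤p 0≤p
... | inj₂ p≤0 = subst (0ℚ ≤_) (solve 1 (λ p → :- p :* :- p := p :* p) refl p) (0≤* 0≤-p 0≤-p)
  where
  0≤-p : 0ℚ ≤ - p
  0≤-p = ≤-by p≤0 (solve 1 (λ p → con 0ℚ :- p := :- p :- con 0ℚ) refl p)

*-cancelʳ-≤ : ∀ {p q} r → 0ℚ < r → p * r ≤ q * r → p ≤ q
*-cancelʳ-≤ r 0<r = *-cancelʳ-≤-pos r {{positive 0<r}}

*-recip-cancel : ∀ {q} p → 0ℚ < q → p * q * recip q ≡ p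
*-recip-cancel {q} p 0<q =
  trans (*-assoc p q (recip q)) (trans (cong (p *_) (recip-inverseʳ 0<q)) (*-identityʳ p))

≤*⇒*recip≤ : ∀ {p q r} → 0ℚ < r → p ≤ q * r → p * recip r ≤ q
≤*⇒*recip≤ {p} {q} {r} 0<r h =
  subst (p * recip r ≤_) (*-recip-cancel q 0<r) (mulʳ-≤ (<⇒≤ (0<recip 0<r)) h)

*≤⇒≤*recip : ∀ {p q r} → 0ℚ < r → p * r ≤ q → p ≤ q * recip r
*≤⇒≤*recip {p} {q} {r} 0<r h =
  subst (_≤ q * recip r) (*-recip-cancel p 0<r) (mulʳ-≤ (<⇒≤ (0<recip 0<r)) h)

recip≤1 : ∀ {q} → 1ℚ ≤ q → recip q ≤ 1ℚ
recip≤1 1≤q = recip-antimono 0<1 1≤q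

inv : ℕ → ℚ
inv n = recip (fromℕ n)

0<inv : ∀ n → 0ℚ < inv (suc n)
0<inv n = 0<recip (0<fromℕ-suc n)

0≤inv : ∀ n → 0ℚ ≤ inv n
0≤inv zero    = ≤-refl
0≤inv (suc n) = <⇒≤ (0<inv n)

fromℕ*inv : ∀ n → fromℕ (suc n) * inv (suc n) ≡ 1ℚ
fromℕ*inv n = recip-inverseʳ (0<fromℕ-suc n)

inv-antimono : ∀ {m n} → m ℕ.≤ n → inv (suc n) ≤ inv (suc m)
inv-antimono {m} m≤n = recip-antimono (0<fromℕ-suc m) (fromℕ-mono-≤ (s≤s m≤n))

inv≤1 : ∀ n → inv n ≤ 1ℚ
inv≤1 zero    = 0≤1
inv≤1 (suc n) = recip≤1 (fromℕ-mono-≤ {1} {suc n} (s≤s z≤n))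

inv-* : ∀ m n → inv (suc m ℕ.* suc n) ≡ inv (suc m) * inv (suc n)
inv-* m n = trans (cong recip (fromℕ-* (suc m) (suc n))) (recip-* (0<fromℕ-suc m) (0<fromℕ-suc n))

fromℕ-cancel-≤ : ∀ {m n} → fromℕ m ≤ fromℕ n → m ℕ.≤ n
fromℕ-cancel-≤ {m} {n} h with m ℕP.≤? n
... | yes m≤n = m≤n
... | no m≰n  = ⊥-elim (<-irrefl refl (<-≤-trans
        (<-≤-trans (subst (fromℕ n <_) (sym (fromℕ-suc n)) (subst (_< fromℕ n + 1ℚ) (+-identityʳ (fromℕ n)) (+-monoʳ-< (fromℕ n) 0<1)))
          (fromℕ-mono-≤ (ℕP.≰⇒> m≰n))) h))

infixr 8 _^ℚ_

_^ℚ_ : ℚ → ℕ → ℚ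
q ^ℚ zero  = 1ℚ
q ^ℚ suc n = q * q ^ℚ n

^ℚ-mono-≤ : ∀ {p q} n → 0ℚ ≤ p → p ≤ q → p ^ℚ n ≤ q ^ℚ n
0≤^ℚ : ∀ {p} n → 0ℚ ≤ p → 0ℚ ≤ p ^ℚ n
0≤^ℚ zero    0≤p = 0≤1
0≤^ℚ (suc n) 0≤p = 0≤* 0≤p (0≤^ℚ n 0≤p)
^ℚ-mono-≤ zero    0≤p p≤q = ≤-refl
^ℚ-mono-≤ (suc n) 0≤p p≤q = mul-≤ (0≤^ℚ n 0≤p) (≤-trans 0≤p p≤q) p≤q (^ℚ-mono-≤ n 0≤p p≤q)

^ℚ-distrib-* : ∀ p q n → (p * q) ^ℚ n ≡ p ^ℚ n * q ^ℚ n
^ℚ-distrib-* p q zero    = refl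
^ℚ-distrib-* p q (suc n) = trans (cong (p * q *_) (^ℚ-distrib-* p q n))
  (solve 4 (λ p q a b → p :* q :* (a :* b) := p :* a :* (q :* b)) refl p q (p ^ℚ n) (q ^ℚ n))

-- Finite sums

Σ₁ : ℕ → (ℕ → ℚ) → ℚ
Σ₁ n f = sum n (λ i → f (suc i))

sum-cong-< : ∀ n {f g : ℕ → ℚ} → (∀ i → i ℕ.< n → f i ≡ g i) → sum n f ≡ sum n g
sum-cong-< n f≡g = ≤-antisym
  (sum-mono-≤ n (λ i i<n → ≤-reflexive (f≡g i i<n)))
  (sum-mono-≤ n (λ i i<n → ≤-reflexive (sym (f≡g i i<n))))

sum-nonneg : ∀ n {f : ℕ → ℚ} → (∀ i → 0ℚ ≤ f i) → 0ℚ ≤ sum n f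
sum-nonneg zero    0≤f = ≤-refl
sum-nonneg (suc n) 0≤f = 0≤+ (sum-nonneg n 0≤f) (0≤f n)

sum-zero : ∀ n {f : ℕ → ℚ} → (∀ i → i ℕ.< n → f i ≡ 0ℚ) → sum n f ≡ 0ℚ
sum-zero n f≡0 = trans (sum-cong-< n f≡0) (trans (sum-const n 0ℚ) (*-zeroʳ (fromℕ n)))

sum-*ˡ : ∀ n c (f : ℕ → ℚ) → sum n (λ i → c * f i) ≡ c * sum n f
sum-*ˡ zero    c f = sym (*-zeroʳ c)
sum-*ˡ (suc n) c f = trans (cong (_+ c * f n) (sum-*ˡ n c f)) (sym (*-distribˡ-+ c (sum n f) (f n)))

sum-*ʳ : ∀ n c (f : ℕ → ℚ) → sum n (λ i → f i * c) ≡ sum n f * c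
sum-*ʳ n c f = trans (sum-cong n (λ i → *-comm (f i) c)) (trans (sum-*ˡ n c f) (*-comm c (sum n f)))

sum-add : ∀ n (f g : ℕ → ℚ) → sum n (λ i → f i + g i) ≡ sum n f + sum n g
sum-add zero    f g = refl
sum-add (suc n) f g = trans (cong (_+ (f n + g n)) (sum-add n f g))
  (solve 4 (λ a b c d → (a :+ b) :+ (c :+ d) := (a :+ c) :+ (b :+ d)) refl (sum n f) (sum n g) (f n) (g n))

sum-swap : ∀ m n (f : ℕ → ℕ → ℚ) → sum m (λ i → sum n (f i)) ≡ sum n (λ j → sum m (λ i → f i j))
sum-swap zero    n f = sym (sum-zero n (λ _ _ → refl))
sum-swap (suc m) n f = trans (cong (_+ sum n (f m)) (sum-swap m n f))
  (sym (sum-add n (λ j → sum m (λ i → f i j)) (f m)))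

sum-* : ∀ m n (f g : ℕ → ℚ) → sum m (λ i → sum n (λ j → f i * g j)) ≡ sum m f * sum n g
sum-* m n f g = trans (sum-cong m (λ i → sum-*ˡ n (f i) g)) (sum-*ʳ m (sum n g) f)

sum-extend : ∀ {m n} {f : ℕ → ℚ} → m ℕ.≤ n → (∀ i → 0ℚ ≤ f i) → sum m f ≤ sum n f
sum-extend {m} {n} {f} m≤n 0≤f = subst (sum m f ≤_)
  (trans (sym (sum-+ m (n ℕ.∸ m) f)) (cong (λ k → sum k f) (ℕP.m+[n∸m]≡n m≤n)))
  (p≤p+q (sum-nonneg (n ℕ.∸ m) (λ i → 0≤f (m ℕ.+ i))))

sum-extend-zero : ∀ {m n} {f : ℕ → ℚ} → m ℕ.≤ n → (∀ i → m ℕ.≤ i → f i ≡ 0ℚ) → sum m f ≡ sum n f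
sum-extend-zero {m} {n} {f} m≤n f≡0 = sym (trans
  (trans (cong (λ k → sum k f) (sym (ℕP.m+[n∸m]≡n m≤n))) (sum-+ m (n ℕ.∸ m) f))
  (trans (cong (sum m f +_) (sum-zero (n ℕ.∸ m) (λ i _ → f≡0 (m ℕ.+ i) (ℕP.m≤m+n m i))))
    (+-identityʳ (sum m f))))

sum-shift : ∀ n (f : ℕ → ℚ) → sum (suc n) f ≡ f 0 + Σ₁ n f
sum-shift n f = trans (sum-+ 1 n f) (cong (_+ Σ₁ n f) (+-identityˡ (f 0)))

-- Indicators of decidable propositions

𝟙 : ∀ {A : Set} → Dec A → ℚ
𝟙 (yes _) = 1ℚ
𝟙 (no _)  = 0ℚ

𝟙-yes : ∀ {A : Set} (d : Dec A) → A → 𝟙 d ≡ 1ℚ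
𝟙-yes (yes _) a = refl
𝟙-yes (no ¬a) a = ⊥-elim (¬a a)

𝟙-no : ∀ {A : Set} (d : Dec A) → ¬ A → 𝟙 d ≡ 0ℚ
𝟙-no (yes a) ¬a = ⊥-elim (¬a a)
𝟙-no (no _)  ¬a = refl

0≤𝟙 : ∀ {A : Set} (d : Dec A) → 0ℚ ≤ 𝟙 d
0≤𝟙 (yes _) = 0≤1
0≤𝟙 (no _)  = ≤-refl

𝟙≤1 : ∀ {A : Set} (d : Dec A) → 𝟙 d ≤ 1ℚ
𝟙≤1 (yes _) = ≤-refl
𝟙≤1 (no _)  = 0≤1

𝟙-mono : ∀ {A B : Set} (d : Dec A) (e : Dec B) → (A → B) → 𝟙 d ≤ 𝟙 e
𝟙-mono (yes a) e f = ≤-reflexive (sym (𝟙-yes e (f a)))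
𝟙-mono (no _)  e f = 0≤𝟙 e

length-filter : ∀ {Q : Pred ℕ 0ℓ} (Q? : Decidable Q) (f : ℕ → ℕ) n →
  fromℕ (length (filter Q? (applyUpTo f n))) ≡ sum n (λ i → 𝟙 (Q? (f i)))
length-filter Q? f zero    = refl
length-filter Q? f (suc n) = trans step (sym (sum-shift n (λ i → 𝟙 (Q? (f i)))))
  where
  step : fromℕ (length (filter Q? (applyUpTo f (suc n)))) ≡ 𝟙 (Q? (f 0)) + Σ₁ n (λ i → 𝟙 (Q? (f i)))
  step with Q? (f 0)
  ... | yes _ = trans (fromℕ-+ 1 (length (filter Q? (applyUpTo (f ∘ suc) n)))) (cong (1ℚ +_) (length-filter Q? (f ∘ suc) n))
  ... | no _  = trans (length-filter Q? (f ∘ suc) n) (sym (+-identityˡ _))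

-- Comparison of sequences up to null sequences

Eventually : (ℕ → Set) → Set
Eventually A = ∃[ K ] ∀ m → K ℕ.≤ m → A m

eventually-map : ∀ {A B : ℕ → Set} → (∀ m → A m → B m) → Eventually A → Eventually B
eventually-map f (K , h) = K , λ m K≤m → f m (h m K≤m)

eventually-× : ∀ {A B : ℕ → Set} → Eventually A → Eventually B → Eventually (λ m → A m × B m)
eventually-× (K , h) (L , k) = K ℕ.⊔ L , λ m km → h m (ℕP.m⊔n≤o⇒m≤o K L km) , k m (ℕP.m⊔n≤o⇒n≤o K L km)

infix 4 _≲_

-- For sequences with limits this means lim f ≤ lim g, so inequalities between logarithms can be
-- chained without mentioning indices.
record _≲_ (f g : ℕ → ℚ) : Set where
  constructor up-to
  field
    within : ∀ δ → 0ℚ < δ → Eventually (λ m → f m ≤ g m + δ)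

open _≲_

≤⇒≲ : ∀ {f g} → (∀ m → f m ≤ g m) → f ≲ g
≤⇒≲ f≤g = up-to λ δ 0<δ → 0 , λ m _ → ≤-trans (f≤g m) (p≤p+q (<⇒≤ 0<δ))

≲-+ : ∀ {f g h k} → f ≲ g → h ≲ k → (λ m → f m + h m) ≲ (λ m → g m + k m)
≲-+ {f} {g} {h} {k} f≲g h≲k = up-to λ δ 0<δ →
  eventually-map (λ m (p , q) → subst (f m + h m ≤_)
      (trans (solve 3 (λ a b c → (a :+ c) :+ (b :+ c) := (a :+ b) :+ (c :+ c)) refl (g m) (k m) (δ * ½))
        (cong (g m + k m +_) (half+half δ)))
      (+-mono-≤ p q))
    (eventually-× (within f≲g (δ * ½) (0<half 0<δ)) (within h≲k (δ * ½) (0<half 0<δ)))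

≲-trans : ∀ {f g h} → f ≲ g → g ≲ h → f ≲ h
≲-trans {f} {g} {h} f≲g g≲h = up-to λ δ 0<δ →
  eventually-map (λ m (p , q) → ≤-trans p
      (subst (g m + δ * ½ ≤_) (trans (+-assoc (h m) (δ * ½) (δ * ½)) (cong (h m +_) (half+half δ)))
        (+-monoˡ-≤ (δ * ½) q)))
    (eventually-× (within f≲g (δ * ½) (0<half 0<δ)) (within g≲h (δ * ½) (0<half 0<δ)))

≲-+ʳ : ∀ {f g} c → f ≲ g → (λ m → f m + c) ≲ (λ m → g m + c)
≲-+ʳ {f} {g} c f≲g = ≲-+ {f} {g} {λ _ → c} {λ _ → c} f≲g (≤⇒≲ (λ _ → ≤-refl))

-- Riemann sums of the logarithm

ℓ : ℚ → ℕ → ℚ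
ℓ q m = riemann (suc m) q

-- Each summand h/(1 + i h) increases with h: after cross-multiplication only `h ≤ h′` remains.
-- Exactness at every `m` is what lets the moving inner argument of ln ln n be replaced by a fixed
-- rational.
riemann-mono-≤ : ∀ m {p q} → 1ℚ ≤ p → p ≤ q → riemann m p ≤ riemann m q
riemann-mono-≤ m {p} {q} 1≤p p≤q = sum-mono-≤ m (λ i _ → term i)
  where
  r h h′ : ℚ
  r  = inv m
  h  = (p - 1ℚ) * r
  h′ = (q - 1ℚ) * r
  0≤h : 0ℚ ≤ h
  0≤h = 0≤* (p≤q⇒0≤q-p 1≤p) (0≤inv m)
  h≤h′ : h ≤ h′
  h≤h′ = mulʳ-≤ (0≤inv m) (+-monoˡ-≤ (- 1ℚ) p≤q)
  0<1+ : ∀ i {x} → 0ℚ ≤ x → 0ℚ < 1ℚ + fromℕ i * x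
  0<1+ i 0≤x = <-≤-trans 0<1 (p≤p+q (0≤* (0≤fromℕ i) 0≤x))
  term : ∀ i → h * recip (1ℚ + fromℕ i * h) ≤ h′ * recip (1ℚ + fromℕ i * h′)
  term i = *≤⇒≤*recip (0<1+ i (≤-trans 0≤h h≤h′)) (subst (_≤ h′)
    (solve 3 (λ h d s → h :* d :* s := h :* s :* d) refl h (1ℚ + fromℕ i * h′) (recip (1ℚ + fromℕ i * h)))
    (≤*⇒*recip≤ (0<1+ i 0≤h) (≤-by h≤h′
      (solve 3 (λ i h k → k :- h := k :* (con 1ℚ :+ i :* h) :- h :* (con 1ℚ :+ i :* k)) refl (fromℕ i) h h′))))

riemann-1 : ∀ m → riemann m 1ℚ ≡ 0ℚ
riemann-1 m = sum-zero m (λ i _ →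
  trans (cong (_* recip (1ℚ + fromℕ i * ((1ℚ - 1ℚ) * inv m))) (*-zeroˡ (inv m)))
    (*-zeroˡ (recip (1ℚ + fromℕ i * ((1ℚ - 1ℚ) * inv m)))))

-- The left Riemann sum of ∫ dt/t over the k intervals of length 1/n starting at 1.
grid : ℕ → ℕ → ℚ
grid n k = sum k (λ i → inv n * recip (1ℚ + fromℕ i * inv n))

module _ {n k s : ℕ} {x y : ℚ} (1≤x : 1ℚ ≤ x)
         (x≡ : fromℕ k * inv n ≡ x - 1ℚ) (y≡ : fromℕ (k ℕ.+ s) * inv n ≡ y - 1ℚ) where

  private
    point : ℕ → ℚ
    point j = 1ℚ + fromℕ (k ℕ.+ j) * inv n

    x≤point : ∀ j → x ≤ point j
    x≤point j = ≤-by {fromℕ k * inv n} {fromℕ (k ℕ.+ j) * inv n}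
      (mulʳ-≤ (0≤inv n) (fromℕ-mono-≤ (ℕP.m≤m+n k j)))
      (trans (cong (λ z → fromℕ (k ℕ.+ j) * inv n - z) x≡)
        (solve 2 (λ u x → u :- (x :- con 1ℚ) := con 1ℚ :+ u :- x) refl (fromℕ (k ℕ.+ j) * inv n) x))

    point≤y : ∀ j → j ℕ.< s → point j ≤ y
    point≤y j j<s = ≤-by {fromℕ (k ℕ.+ j) * inv n} {fromℕ (k ℕ.+ s) * inv n}
      (mulʳ-≤ (0≤inv n) (fromℕ-mono-≤ (ℕP.+-monoʳ-≤ k (ℕP.<⇒≤ j<s))))
      (trans (cong (_- fromℕ (k ℕ.+ j) * inv n) y≡)
        (solve 2 (λ u y → (y :- con 1ℚ) :- u := y :- (con 1ℚ :+ u)) refl (fromℕ (k ℕ.+ j) * inv n) y))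

    s*inv : fromℕ s * inv n ≡ y - x
    s*inv = begin
      fromℕ s * inv n
        ≡⟨ solve 3 (λ s k r → s :* r := (k :+ s) :* r :- k :* r) refl (fromℕ s) (fromℕ k) (inv n) ⟩
      (fromℕ k + fromℕ s) * inv n - fromℕ k * inv n
        ≡⟨ cong₂ _-_ (trans (cong (_* inv n) (sym (fromℕ-+ k s))) y≡) x≡ ⟩
      (y - 1ℚ) - (x - 1ℚ)
        ≡⟨ solve 2 (λ x y → (y :- con 1ℚ) :- (x :- con 1ℚ) := y :- x) refl x y ⟩
      y - x ∎
      where open ≡-Reasoning

    total : ∀ c → sum s (λ _ → inv n * c) ≡ (y - x) * c
    total c = trans (sum-const s (inv n * c))
      (trans (sym (*-assoc (fromℕ s) (inv n) c)) (cong (_* c) s*inv))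

  -- The `s` additional cells have total width y - x and left endpoints in [x, y], where 1/y ≤ 1/t ≤
  -- 1/x.
  grid-upper : grid n (k ℕ.+ s) ≤ grid n k + (y - x) * recip x
  grid-upper = subst₂ _≤_ (sym (sum-+ k s (λ i → inv n * recip (1ℚ + fromℕ i * inv n))))
    (cong (grid n k +_) (total (recip x)))
    (+-monoʳ-≤ (grid n k) (sum-mono-≤ s (λ j _ →
      mulˡ-≤ (0≤inv n) (recip-antimono (<-≤-trans 0<1 1≤x) (x≤point j)))))

  grid-lower : grid n k + (y - x) * recip y ≤ grid n (k ℕ.+ s)
  grid-lower = subst₂ _≤_ (cong (grid n k +_) (total (recip y)))
    (sym (sum-+ k s (λ i → inv n * recip (1ℚ + fromℕ i * inv n))))
    (+-monoʳ-≤ (grid n k) (sum-mono-≤ s (λ j j<s →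
      mulˡ-≤ (0≤inv n) (recip-antimono (<-≤-trans 0<1 (≤-trans 1≤x (x≤point j))) (point≤y j j<s)))))

-- Growth of ln between two rationals, by a common grid

fraction : ∀ {q} → 0ℚ ≤ q → ∃[ a ] ∃[ d ] q * fromℕ (suc d) ≡ fromℕ a
fraction {q@(mkℚ (ℤ.-[1+ _ ]) _ _)} 0≤q = ⊥-elim (<-irrefl refl (<-≤-trans (negative⁻¹ q) 0≤q))
fraction {q@(mkℚ (ℤ.+ a) d _)} _ = a , d , toℚᵘ-injective (begin
    toℚᵘ (q * fromℕ (suc d))                        ≈⟨ toℚᵘ-homo-* q (fromℕ (suc d)) ⟩
    toℚᵘ q ℚᵘ.* toℚᵘ (fromℕ (suc d))                ≈⟨ ℚᵘP.*-congˡ {toℚᵘ q} (toℚᵘ-fromℚᵘ (ℚᵘ.mkℚᵘ (ℤ.+ suc d) 0)) ⟩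
    ℚᵘ.mkℚᵘ (ℤ.+ a) d ℚᵘ.* ℚᵘ.mkℚᵘ (ℤ.+ suc d) 0    ≈⟨ ℚᵘ.*≡* (ℤP.*-assoc (ℤ.+ a) (ℤ.+ suc d) ℤ.1ℤ) ⟩
    ℚᵘ.mkℚᵘ (ℤ.+ a) 0                               ≈⟨ toℚᵘ-fromℚᵘ (ℚᵘ.mkℚᵘ (ℤ.+ a) 0) ⟨
    toℚᵘ (fromℕ a) ∎)
  where open ℚᵘP.≃-Reasoning

-- With q - 1 = a/(d + 1), cutting [1, q] into a (J + 1) cells gives the width 1/((d + 1)(J + 1))
-- exactly, so that Riemann sum is a grid sum; `riemann-dist` compares it with the sum over m + 1
-- cells. If a = 0 then q = 1 and there is nothing to cut, hence the separate case.
ℓ-grid : ∀ {q} a d → 1ℚ ≤ q → (q - 1ℚ) * fromℕ (suc d) ≡ fromℕ a → ∀ δ → 0ℚ < δ →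
  ∃[ K ] ∀ m J → K ℕ.≤ m → K ℕ.≤ J → ∣ ℓ q m - grid (suc d ℕ.* suc J) (a ℕ.* suc J) ∣ ≤ δ
ℓ-grid {q} zero d 1≤q e δ 0<δ = 0 , λ m J _ _ →
  subst (λ z → ∣ z - 0ℚ ∣ ≤ δ) (sym (trans (cong (riemann (suc m)) q≡1) (riemann-1 (suc m)))) (<⇒≤ 0<δ)
  where
  q-1≡0 : q - 1ℚ ≡ 0ℚ
  q-1≡0 = trans (sym (*-recip-cancel (q - 1ℚ) (0<fromℕ-suc d)))
    (trans (cong (_* inv (suc d)) e) (*-zeroˡ (inv (suc d))))
  q≡1 : q ≡ 1ℚ
  q≡1 = trans (solve 1 (λ q → q := (q :- con 1ℚ) :+ con 1ℚ) refl q) (cong (_+ 1ℚ) q-1≡0)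
ℓ-grid {q} a@(suc a-1) d 1≤q e δ 0<δ =
  N , λ m J N≤m N≤J → subst (λ z → ∣ ℓ q m - z ∣ ≤ δ) (on-grid J) (begin
    ∣ ℓ q m - riemann (a ℕ.* suc J) q ∣
      ≤⟨ riemann-dist 0<1 ≤-refl (suc m) (a ℕ.* suc J) (0<fromℕ-suc m) (0<fromℕ-suc (J ℕ.+ a-1 ℕ.* suc J)) 1≤q ⟩
    A * (inv (suc m) + inv (a ℕ.* suc J))
      ≡⟨ *-distribˡ-+ A (inv (suc m)) (inv (a ℕ.* suc J)) ⟩
    A * inv (suc m) + A * inv (a ℕ.* suc J)
      ≤⟨ <⇒≤ (split {A * inv (suc m)} {A * inv (a ℕ.* suc J)} {δ} (small m N≤m)
           (small (J ℕ.+ a-1 ℕ.* suc J) (ℕP.≤-trans N≤J (ℕP.m≤m+n J (a-1 ℕ.* suc J))))) ⟩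
    δ ∎)
  where
  open ≤-Reasoning
  A : ℚ
  A = ∣ q - 1ℚ ∣ * ∣ q - 1ℚ ∣ * (recip 1ℚ * recip 1ℚ)
  N : ℕ
  N = proj₁ (vanishing {A} {δ * ½} (0<half 0<δ))
  small : ∀ m → N ℕ.≤ m → A * inv (suc m) < δ * ½
  small = proj₂ (vanishing {A} {δ * ½} (0<half 0<δ))
  width : ∀ J → (q - 1ℚ) * inv (a ℕ.* suc J) ≡ inv (suc d ℕ.* suc J)
  width J = begin-equality
    (q - 1ℚ) * inv (a ℕ.* suc J)            ≡⟨ cong ((q - 1ℚ) *_) (inv-* a-1 J) ⟩
    (q - 1ℚ) * (inv a * inv (suc J))        ≡⟨ cong (_* (inv a * inv (suc J))) (*-recip-cancel (q - 1ℚ) (0<fromℕ-suc d)) ⟨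
    (q - 1ℚ) * fromℕ (suc d) * inv (suc d) * (inv a * inv (suc J))
      ≡⟨ cong (λ z → z * inv (suc d) * (inv a * inv (suc J))) e ⟩
    fromℕ a * inv (suc d) * (inv a * inv (suc J))
      ≡⟨ solve 4 (λ a d b j → a :* d :* (b :* j) := (a :* b) :* (d :* j)) refl (fromℕ a) (inv (suc d)) (inv a) (inv (suc J)) ⟩
    fromℕ a * inv a * (inv (suc d) * inv (suc J))
      ≡⟨ cong₂ _*_ (fromℕ*inv a-1) (sym (inv-* d J)) ⟩
    1ℚ * inv (suc d ℕ.* suc J)               ≡⟨ *-identityˡ (inv (suc d ℕ.* suc J)) ⟩
    inv (suc d ℕ.* suc J) ∎
  on-grid : ∀ J → riemann (a ℕ.* suc J) q ≡ grid (suc d ℕ.* suc J) (a ℕ.* suc J)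
  on-grid J = cong (λ h → sum (a ℕ.* suc J) (λ i → h * recip (1ℚ + fromℕ i * h))) (width J)

common-fraction : ∀ {p q} → 0ℚ ≤ p → 0ℚ ≤ q →
  ∃[ d ] ∃[ a ] ∃[ b ] p * fromℕ (suc d) ≡ fromℕ a × q * fromℕ (suc d) ≡ fromℕ b
common-fraction {p} {q} 0≤p 0≤q with fraction 0≤p | fraction 0≤q
... | a , d , p≡ | b , e , q≡ = e ℕ.+ d ℕ.* suc e , a ℕ.* suc e , b ℕ.* suc d ,
  (begin
    p * fromℕ (suc d ℕ.* suc e)               ≡⟨ cong (p *_) (fromℕ-* (suc d) (suc e)) ⟩
    p * (fromℕ (suc d) * fromℕ (suc e))       ≡⟨ *-assoc p (fromℕ (suc d)) (fromℕ (suc e)) ⟨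
    p * fromℕ (suc d) * fromℕ (suc e)         ≡⟨ cong (_* fromℕ (suc e)) p≡ ⟩
    fromℕ a * fromℕ (suc e)                   ≡⟨ fromℕ-* a (suc e) ⟨
    fromℕ (a ℕ.* suc e) ∎) ,
  (begin
    q * fromℕ (suc d ℕ.* suc e)               ≡⟨ cong (q *_) (fromℕ-* (suc d) (suc e)) ⟩
    q * (fromℕ (suc d) * fromℕ (suc e))       ≡⟨ solve 3 (λ y d e → y :* (d :* e) := y :* e :* d) refl q (fromℕ (suc d)) (fromℕ (suc e)) ⟩
    q * fromℕ (suc e) * fromℕ (suc d)         ≡⟨ cong (_* fromℕ (suc d)) q≡ ⟩
    fromℕ b * fromℕ (suc d)                   ≡⟨ fromℕ-* b (suc d) ⟨
    fromℕ (b ℕ.* suc d) ∎)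
  where open ≡-Reasoning

∣p-q∣≤⇒p≤q+ : ∀ p q {e} → ∣ p - q ∣ ≤ e → p ≤ q + e
∣p-q∣≤⇒p≤q+ p q {e} h = ≤-by (≤-trans (p≤∣p∣ (p - q)) h)
  (solve 3 (λ p q e → e :- (p :- q) := (q :+ e) :- p) refl p q e)

transfer : ∀ {u U v V c δ} → ∣ u - U ∣ ≤ δ * ½ → ∣ v - V ∣ ≤ δ * ½ → V ≤ U + c → v ≤ u + c + δ
transfer {u} {U} {v} {V} {c} {δ} hu hv h = begin
  v                        ≤⟨ ∣p-q∣≤⇒p≤q+ v V hv ⟩
  V + e                    ≤⟨ +-monoˡ-≤ e h ⟩
  U + c + e                ≤⟨ +-monoˡ-≤ e (+-monoˡ-≤ c (∣p-q∣≤⇒p≤q+ U u (subst (_≤ e) (∣p-q∣≡∣q-p∣ u U) hu))) ⟩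
  u + e + c + e            ≡⟨ solve 3 (λ u c e → u :+ e :+ c :+ e := u :+ c :+ (e :+ e)) refl u c e ⟩
  u + c + (e + e)          ≡⟨ cong (u + c +_) (half+half δ) ⟩
  u + c + δ ∎
  where
  open ≤-Reasoning
  e : ℚ
  e = δ * ½

-- On a common mesh the Riemann sums for x and y differ by the sum over [x, y] only.
module CommonMesh {x y : ℚ} (1≤x : 1ℚ ≤ x) (x≤y : x ≤ y) (D a b : ℕ)
    (x-frac : (x - 1ℚ) * fromℕ (suc D) ≡ fromℕ a) (y-frac : (y - 1ℚ) * fromℕ (suc D) ≡ fromℕ b) where

  private
    1≤y : 1ℚ ≤ y
    1≤y = ≤-trans 1≤x x≤y
    a≤b : a ℕ.≤ b
    a≤b = fromℕ-cancel-≤ (subst₂ _≤_ x-frac y-frac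
      (mulʳ-≤ (0≤fromℕ (suc D)) (+-monoˡ-≤ (- 1ℚ) x≤y)))
    scaled : ∀ {z} c J → (z - 1ℚ) * fromℕ (suc D) ≡ fromℕ c →
             fromℕ (c ℕ.* suc J) * inv (suc D ℕ.* suc J) ≡ z - 1ℚ
    scaled {z} c J h = begin
      fromℕ (c ℕ.* suc J) * inv (suc D ℕ.* suc J)
        ≡⟨ cong₂ _*_ (trans (fromℕ-* c (suc J)) (cong (_* fromℕ (suc J)) (sym h))) (inv-* D J) ⟩
      (z - 1ℚ) * fromℕ (suc D) * fromℕ (suc J) * (inv (suc D) * inv (suc J))
        ≡⟨ solve 5 (λ z d j e k → z :* d :* j :* (e :* k) := z :* (d :* e) :* (j :* k)) refl
             (z - 1ℚ) (fromℕ (suc D)) (fromℕ (suc J)) (inv (suc D)) (inv (suc J)) ⟩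
      (z - 1ℚ) * (fromℕ (suc D) * inv (suc D)) * (fromℕ (suc J) * inv (suc J))
        ≡⟨ cong₂ (λ u v → (z - 1ℚ) * u * v) (fromℕ*inv D) (fromℕ*inv J) ⟩
      (z - 1ℚ) * 1ℚ * 1ℚ
        ≡⟨ solve 1 (λ z → z :* con 1ℚ :* con 1ℚ := z) refl (z - 1ℚ) ⟩
      z - 1ℚ ∎
      where open ≡-Reasoning

    module _ (J : ℕ) where
      s : ℕ
      s = b ℕ.* suc J ℕ.∸ a ℕ.* suc J
      a+s : a ℕ.* suc J ℕ.+ s ≡ b ℕ.* suc J
      a+s = ℕP.m+[n∸m]≡n (ℕP.*-monoˡ-≤ (suc J) a≤b)
      y-scaled : fromℕ (a ℕ.* suc J ℕ.+ s) * inv (suc D ℕ.* suc J) ≡ y - 1ℚ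
      y-scaled = subst (λ z → fromℕ z * inv (suc D ℕ.* suc J) ≡ y - 1ℚ) (sym a+s) (scaled {y} b J y-frac)
      Gx Gy : ℚ
      Gx = grid (suc D ℕ.* suc J) (a ℕ.* suc J)
      Gy = grid (suc D ℕ.* suc J) (b ℕ.* suc J)
      upper : Gy ≤ Gx + (y - x) * recip x
      upper = subst (λ z → grid (suc D ℕ.* suc J) z ≤ Gx + (y - x) * recip x) a+s
        (grid-upper {suc D ℕ.* suc J} {a ℕ.* suc J} {s} {x} {y} 1≤x (scaled {x} a J x-frac) y-scaled)
      lower : Gx + (y - x) * recip y ≤ Gy
      lower = subst (λ z → Gx + (y - x) * recip y ≤ grid (suc D ℕ.* suc J) z) a+s
        (grid-lower {suc D ℕ.* suc J} {a ℕ.* suc J} {s} {x} {y} 1≤x (scaled {x} a J x-frac) y-scaled)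

    near : ∀ δ → 0ℚ < δ → Eventually (λ m → ∃[ J ] (∣ ℓ x m - Gx J ∣ ≤ δ × ∣ ℓ y m - Gy J ∣ ≤ δ))
    near δ 0<δ = join (ℓ-grid {x} a D 1≤x x-frac δ 0<δ) (ℓ-grid {y} b D 1≤y y-frac δ 0<δ)
      where
      join : (∃[ K ] ∀ m J → K ℕ.≤ m → K ℕ.≤ J → ∣ ℓ x m - Gx J ∣ ≤ δ) →
             (∃[ K ] ∀ m J → K ℕ.≤ m → K ℕ.≤ J → ∣ ℓ y m - Gy J ∣ ≤ δ) →
             Eventually (λ m → ∃[ J ] (∣ ℓ x m - Gx J ∣ ≤ δ × ∣ ℓ y m - Gy J ∣ ≤ δ))
      join (K , p) (L , q) = K ℕ.⊔ L , λ m km → K ℕ.⊔ L ,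
        p m (K ℕ.⊔ L) (ℕP.m⊔n≤o⇒m≤o K L km) (ℕP.m≤m⊔n K L) , q m (K ℕ.⊔ L) (ℕP.m⊔n≤o⇒n≤o K L km) (ℕP.m≤n⊔m K L)

  mesh-upper : ℓ y ≲ (λ m → ℓ x m + (y - x) * recip x)
  mesh-upper = up-to λ δ 0<δ → eventually-map
    (λ m (J , hx , hy) → transfer {ℓ x m} {Gx J} {ℓ y m} {Gy J} {(y - x) * recip x} {δ} hx hy (upper J))
    (near (δ * ½) (0<half 0<δ))

  mesh-lower : (λ m → ℓ x m + (y - x) * recip y) ≲ ℓ y
  mesh-lower = up-to λ δ 0<δ → eventually-map
    (λ m (J , hx , hy) →
      rearrange (ℓ x m) (ℓ y m) δ (transfer {ℓ y m} {Gy J} {ℓ x m} {Gx J} {c = - ((y - x) * recip y)} {δ} hy hx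
        (≤-by (lower J) (solve 3 (λ a b c → b :- (a :+ c) := (b :+ :- c) :- a) refl (Gx J) (Gy J) ((y - x) * recip y)))))
    (near (δ * ½) (0<half 0<δ))
    where
    rearrange : ∀ u v δ → u ≤ v + - ((y - x) * recip y) + δ → u + (y - x) * recip y ≤ v + δ
    rearrange u v δ h = ≤-by h
      (solve 4 (λ a b c e → (b :+ :- c :+ e) :- a := (b :+ e) :- (a :+ c)) refl u v ((y - x) * recip y) δ)

-- A common denominator of x - 1 and y - 1 places both points on one grid at every refinement, which
-- yields the mean value bounds for the increment of ln.
ℓ-upper : ∀ x y → 1ℚ ≤ x → x ≤ y → ℓ y ≲ (λ m → ℓ x m + (y - x) * recip x)
ℓ-upper x y 1≤x x≤y =
  let D , a , b , x-frac , y-frac = common-fraction (p≤q⇒0≤q-p 1≤x) (p≤q⇒0≤q-p (≤-trans 1≤x x≤y))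
  in CommonMesh.mesh-upper 1≤x x≤y D a b x-frac y-frac

ℓ-lower : ∀ x y → 1ℚ ≤ x → x ≤ y → (λ m → ℓ x m + (y - x) * recip y) ≲ ℓ y
ℓ-lower x y 1≤x x≤y =
  let D , a , b , x-frac , y-frac = common-fraction (p≤q⇒0≤q-p 1≤x) (p≤q⇒0≤q-p (≤-trans 1≤x x≤y))
  in CommonMesh.mesh-lower 1≤x x≤y D a b x-frac y-frac

ℓ-*-upper : ∀ {x} a → 1ℚ ≤ x → 0ℚ ≤ a → ℓ (x * (1ℚ + a)) ≲ (λ m → ℓ x m + a)
ℓ-*-upper {x} a 1≤x 0≤a = subst (λ z → ℓ (x * (1ℚ + a)) ≲ (λ m → ℓ x m + z))
  (trans (cong (_* recip x) (solve 2 (λ x a → x :* (con 1ℚ :+ a) :- x := a :* x) refl x a)) (*-recip-cancel a 0<x))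
  (ℓ-upper x (x * (1ℚ + a)) 1≤x x≤x*)
  where
  0<x : 0ℚ < x
  0<x = <-≤-trans 0<1 1≤x
  x≤x* : x ≤ x * (1ℚ + a)
  x≤x* = ≤-by (0≤* 0≤a (<⇒≤ 0<x)) (solve 2 (λ x a → a :* x :- con 0ℚ := x :* (con 1ℚ :+ a) :- x) refl x a)

ℓ-*-lower : ∀ {x} a → 1ℚ ≤ x → 0ℚ ≤ a → (λ m → ℓ x m + a * recip (1ℚ + a)) ≲ ℓ (x * (1ℚ + a))
ℓ-*-lower {x} a 1≤x 0≤a = subst (λ z → (λ m → ℓ x m + z) ≲ ℓ (x * (1ℚ + a)))
  (begin
    (x * (1ℚ + a) - x) * recip (x * (1ℚ + a))
      ≡⟨ cong₂ _*_ (solve 2 (λ x a → x :* (con 1ℚ :+ a) :- x := a :* x) refl x a) (recip-* 0<x 0<1+a) ⟩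
    a * x * (recip x * recip (1ℚ + a))
      ≡⟨ *-assoc (a * x) (recip x) (recip (1ℚ + a)) ⟨
    a * x * recip x * recip (1ℚ + a)
      ≡⟨ cong (_* recip (1ℚ + a)) (*-recip-cancel a 0<x) ⟩
    a * recip (1ℚ + a) ∎)
  (ℓ-lower x (x * (1ℚ + a)) 1≤x x≤x*)
  where
  open ≡-Reasoning
  0<x : 0ℚ < x
  0<x = <-≤-trans 0<1 1≤x
  x≤x* : x ≤ x * (1ℚ + a)
  x≤x* = ≤-by (0≤* 0≤a (<⇒≤ 0<x)) (solve 2 (λ x a → a :* x :- con 0ℚ := x :* (con 1ℚ :+ a) :- x) refl x a)
  0<1+a : 0ℚ < 1ℚ + a
  0<1+a = <-≤-trans 0<1 (p≤p+q 0≤a)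

-- Harmonic numbers

H : ℕ → ℚ
H n = Σ₁ n inv

-- From n + 1 to n + 2 the logarithm grows by at most 1/(n + 1), and by at least 1/(n + 2); the
-- latter gives `H≲ℓ`.
ℓ≲H : ∀ n → ℓ (fromℕ (suc n)) ≲ (λ _ → H n)
ℓ≲H zero    = ≤⇒≲ (λ m → ≤-reflexive (riemann-1 (suc m)))
ℓ≲H (suc n) = ≲-trans {g = λ m → ℓ (fromℕ (suc n)) m + inv (suc n)}
  (subst (λ z → ℓ (fromℕ (suc (suc n))) ≲ (λ m → ℓ (fromℕ (suc n)) m + z)) gain
    (ℓ-upper (fromℕ (suc n)) (fromℕ (suc (suc n))) (fromℕ-mono-≤ {1} {suc n} (s≤s z≤n)) (fromℕ-mono-≤ (ℕP.n≤1+n (suc n)))))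
  (≲-+ʳ (inv (suc n)) (ℓ≲H n))
  where
  gain : (fromℕ (suc (suc n)) - fromℕ (suc n)) * inv (suc n) ≡ inv (suc n)
  gain = trans (cong (λ z → (z - fromℕ (suc n)) * inv (suc n)) (fromℕ-suc (suc n)))
    (solve 2 (λ a r → ((a :+ con 1ℚ) :- a) :* r := r) refl (fromℕ (suc n)) (inv (suc n)))

H≲ℓ : ∀ n → (λ _ → H (suc n) - 1ℚ) ≲ ℓ (fromℕ (suc n))
H≲ℓ zero    = ≤⇒≲ (λ m → ≤-reflexive (sym (riemann-1 (suc m))))
H≲ℓ (suc n) = ≲-trans {g = λ m → ℓ (fromℕ (suc n)) m + inv (suc (suc n))}
  (subst (λ z → (λ _ → z) ≲ (λ m → ℓ (fromℕ (suc n)) m + inv (suc (suc n))))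
    (solve 2 (λ h r → (h :- con 1ℚ) :+ r := (h :+ r) :- con 1ℚ) refl (H (suc n)) (inv (suc (suc n))))
    (≲-+ʳ (inv (suc (suc n))) (H≲ℓ n)))
  (subst (λ z → (λ m → ℓ (fromℕ (suc n)) m + z) ≲ ℓ (fromℕ (suc (suc n)))) gain
    (ℓ-lower (fromℕ (suc n)) (fromℕ (suc (suc n))) (fromℕ-mono-≤ {1} {suc n} (s≤s z≤n)) (fromℕ-mono-≤ (ℕP.n≤1+n (suc n)))))
  where
  gain : (fromℕ (suc (suc n)) - fromℕ (suc n)) * inv (suc (suc n)) ≡ inv (suc (suc n))
  gain = trans (cong (λ z → (z - fromℕ (suc n)) * inv (suc (suc n))) (fromℕ-suc (suc n)))
    (solve 2 (λ a r → ((a :+ con 1ℚ) :- a) :* r := r) refl (fromℕ (suc n)) (inv (suc (suc n))))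

-- Indicators of primes and divisors, and the sum of 1/p

𝟙-× : ∀ {A B : Set} (a : Dec A) (b : Dec B) → 𝟙 (a ×-dec b) ≡ 𝟙 a * 𝟙 b
𝟙-× (yes _) (yes _) = refl
𝟙-× (yes _) (no _)  = refl
𝟙-× (no _)  b       = sym (*-zeroˡ (𝟙 b))

sum-𝟙-≟ : ∀ n a → Σ₁ n (λ i → 𝟙 (i ℕP.≟ a)) ≤ 1ℚ
sum-𝟙-≟ zero    a = 0≤1
sum-𝟙-≟ (suc n) a with suc n ℕP.≟ a
... | yes refl = ≤-reflexive (trans
        (cong (_+ 1ℚ) (sum-zero n (λ i i<n → 𝟙-no (suc i ℕP.≟ suc n) (ℕP.<⇒≢ (s≤s i<n)))))
        (+-identityˡ 1ℚ))
... | no _     = subst (_≤ 1ℚ) (sym (+-identityʳ _)) (sum-𝟙-≟ n a)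

χ : ℕ → ℚ
χ p = 𝟙 (prime? p)

D : ℕ → ℕ → ℚ
D d n = 𝟙 (d ∣? n)

P : ℕ → ℚ
P n = Σ₁ n (λ p → χ p * inv p)

0≤χ : ∀ p → 0ℚ ≤ χ p
0≤χ p = 0≤𝟙 (prime? p)

0≤χ*inv : ∀ p → 0ℚ ≤ χ p * inv p
0≤χ*inv p = 0≤* (0≤χ p) (0≤inv p)

0≤P : ∀ n → 0ℚ ≤ P n
0≤P n = sum-nonneg n (λ i → 0≤χ*inv (suc i))

-- Sums over multiples

-- Here `c` and `r` are quotient and remainder of N by d. The identity is quantified over `g` so
-- that one induction on N serves both for counting multiples (g = 1) and for reindexing weighted
-- sums.
Multiples : ℕ → ℕ → Set
Multiples d N = ∃[ c ] ∃[ r ] (r ℕ.< d × N ≡ r ℕ.+ c ℕ.* d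
  × ∀ (g : ℕ → ℚ) → Σ₁ N (λ m → D d m * g m) ≡ Σ₁ c (λ i → g (i ℕ.* d)))

multiples : ∀ d N → Multiples (suc d) N
multiples d zero    = 0 , 0 , s≤s z≤n , refl , λ g → refl
multiples d (suc N) = step (multiples d N)
  where
  step : Multiples (suc d) N → Multiples (suc d) (suc N)
  step (c , r , r<d , N≡ , eq) with suc r ℕP.≟ suc d
  ... | yes refl = suc c , 0 , s≤s z≤n , cong suc N≡ , λ g → cong₂ _+_ (eq g)
        (trans (cong (_* g (suc N)) (𝟙-yes (suc d ∣? suc N) (divides (suc c) (cong suc N≡))))
          (trans (*-identityˡ (g (suc N))) (cong g (cong suc N≡))))
  ... | no 1+r≢d = c , suc r , ℕP.≤∧≢⇒< r<d 1+r≢d , cong suc N≡ , λ g →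
        trans (cong₂ _+_ (eq g)
          (trans (cong (_* g (suc N)) (𝟙-no (suc d ∣? suc N) ∤)) (*-zeroˡ (g (suc N)))))
          (+-identityʳ _)
    where
    ∤ : ¬ (suc d ∣ suc N)
    ∤ h = 1+r≢d (ℕP.≤-antisym r<d (∣⇒≤ (∣m+n∣m⇒∣n
      (subst (suc d ∣_) (trans (cong suc N≡) (ℕP.+-comm (suc r) (c ℕ.* suc d))) h) (n∣m*n c))))

module _ (d N : ℕ) where

  private
    c≤N : ∀ {c r} → N ≡ r ℕ.+ c ℕ.* suc d → c ℕ.≤ N
    c≤N {c} {r} e = subst (c ℕ.≤_) (sym e) (ℕP.≤-trans (ℕP.m≤m*n c (suc d)) (ℕP.m≤n+m (c ℕ.* suc d) r))

  sum-multiples-≤ : ∀ {g} → (∀ m → 0ℚ ≤ g m) →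
    Σ₁ N (λ m → D (suc d) m * g m) ≤ Σ₁ N (λ i → g (i ℕ.* suc d))
  sum-multiples-≤ {g} 0≤g = let c , r , _ , N≡ , eq = multiples d N in
    subst (_≤ Σ₁ N (λ i → g (i ℕ.* suc d))) (sym (eq g))
      (sum-extend (c≤N {c} {r} N≡) (λ i → 0≤g (suc i ℕ.* suc d)))

  sum-multiples-≥ : ∀ {g} M → M ℕ.* suc d ℕ.≤ N → (∀ m → 0ℚ ≤ g m) →
    Σ₁ M (λ i → g (i ℕ.* suc d)) ≤ Σ₁ N (λ m → D (suc d) m * g m)
  sum-multiples-≥ {g} M Md≤N 0≤g = let c , r , r<d , N≡ , eq = multiples d N in
    subst (Σ₁ M (λ i → g (i ℕ.* suc d)) ≤_) (sym (eq g))
      (sum-extend (ℕ.s≤s⁻¹ (ℕP.*-cancelʳ-< (suc d) M (suc c)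
          (ℕP.≤-<-trans Md≤N (subst (ℕ._< suc c ℕ.* suc d) (sym N≡) (ℕP.+-monoˡ-< (c ℕ.* suc d) r<d)))))
        (λ i → 0≤g (suc i ℕ.* suc d)))

  private
    count≡ : ∀ c → (∀ (g : ℕ → ℚ) → Σ₁ N (λ m → D (suc d) m * g m) ≡ Σ₁ c (λ i → g (i ℕ.* suc d))) →
             Σ₁ N (D (suc d)) ≡ fromℕ c
    count≡ c eq = trans (sum-cong N (λ i → sym (*-identityʳ (D (suc d) (suc i)))))
      (trans (eq (λ _ → 1ℚ)) (trans (sum-const c 1ℚ) (*-identityʳ (fromℕ c))))

    fromℕ-N : ∀ {c r} → N ≡ r ℕ.+ c ℕ.* suc d → fromℕ N ≡ fromℕ r + fromℕ c * fromℕ (suc d)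
    fromℕ-N {c} {r} e = trans (cong fromℕ e)
      (trans (fromℕ-+ r (c ℕ.* suc d)) (cong (fromℕ r +_) (fromℕ-* c (suc d))))

  count-multiples-≤ : Σ₁ N (D (suc d)) ≤ fromℕ N * inv (suc d)
  count-multiples-≤ = let c , r , _ , N≡ , eq = multiples d N in
    subst (_≤ fromℕ N * inv (suc d)) (sym (count≡ c eq))
      (*≤⇒≤*recip (0<fromℕ-suc d) (subst (fromℕ c * fromℕ (suc d) ≤_) (sym (fromℕ-N {c} {r} N≡))
        (≤-by (0≤fromℕ r) (solve 2 (λ r x → r :- con 0ℚ := (r :+ x) :- x) refl (fromℕ r) (fromℕ c * fromℕ (suc d))))))

  count-multiples-≥ : fromℕ N * inv (suc d) ≤ Σ₁ N (D (suc d)) + 1ℚ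
  count-multiples-≥ = let c , r , r<d , N≡ , eq = multiples d N in
    ≤*⇒*recip≤ (0<fromℕ-suc d) (subst₂ _≤_ (sym (fromℕ-N {c} {r} N≡))
      (cong (λ z → (z + 1ℚ) * fromℕ (suc d)) (sym (count≡ c eq)))
      (≤-by (fromℕ-mono-≤ (ℕP.<⇒≤ r<d))
        (solve 3 (λ r c d → d :- r := (c :+ con 1ℚ) :* d :- (r :+ c :* d)) refl (fromℕ r) (fromℕ c) (fromℕ (suc d)))))

-- Turán's second moment

primes-coprime : ∀ {p q n} → Prime p → Prime q → p ≢ q → p ∣ n → q ∣ n → p ℕ.* q ∣ n
primes-coprime {p} {q} {n} pp pq p≢q (divides k n≡kp) q∣n
  with euclidsLemma k p pq (subst (q ∣_) n≡kp q∣n)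
... | inj₁ q∣k = subst (p ℕ.* q ∣_) (trans (ℕP.*-comm p k) (sym n≡kp)) (*-monoʳ-∣ p q∣k)
... | inj₂ q∣p with prime⇒irreducible pp q∣p
...   | inj₁ refl = ⊥-elim (¬prime[1] pq)
...   | inj₂ refl = ⊥-elim (p≢q refl)

-- Agrees with ω n for 1 ≤ n ≤ N (see `ω≡w`). The range of p does not depend on n, so sums over n
-- and p can be interchanged.
w : ℕ → ℕ → ℚ
w N n = Σ₁ N (λ p → χ p * D p n)

-- Every index p ≤ N loses at most 1, from N/p ≤ ⌊N/p⌋ + 1. A lower bound for the sum of `w N` is
-- the direction that fits its negative coefficient in the expanded square.
first-moment : ∀ N → fromℕ N * P N ≤ Σ₁ N (w N) + fromℕ N
first-moment N = begin
  fromℕ N * P N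
    ≡⟨ sum-*ˡ N (fromℕ N) (λ i → χ (suc i) * inv (suc i)) ⟨
  Σ₁ N (λ p → fromℕ N * (χ p * inv p))
    ≤⟨ sum-mono-≤ N (λ i _ → term i) ⟩
  Σ₁ N (λ p → Σ₁ N (λ n → χ p * D p n) + 1ℚ)
    ≡⟨ sum-add N (λ i → Σ₁ N (λ n → χ (suc i) * D (suc i) n)) (λ _ → 1ℚ) ⟩
  Σ₁ N (λ p → Σ₁ N (λ n → χ p * D p n)) + sum N (λ _ → 1ℚ)
    ≡⟨ cong₂ _+_ (sum-swap N N (λ i j → χ (suc i) * D (suc i) (suc j)))
         (trans (sum-const N 1ℚ) (*-identityʳ (fromℕ N))) ⟩
  Σ₁ N (w N) + fromℕ N ∎
  where
  open ≤-Reasoning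
  term : ∀ i → fromℕ N * (χ (suc i) * inv (suc i)) ≤ Σ₁ N (λ n → χ (suc i) * D (suc i) n) + 1ℚ
  term i = begin
    fromℕ N * (c * inv (suc i))
      ≡⟨ solve 3 (λ n c r → n :* (c :* r) := c :* (n :* r)) refl (fromℕ N) c (inv (suc i)) ⟩
    c * (fromℕ N * inv (suc i))
      ≤⟨ mulˡ-≤ (0≤χ (suc i)) (count-multiples-≥ i N) ⟩
    c * (Σ₁ N (D (suc i)) + 1ℚ)
      ≡⟨ *-distribˡ-+ c (Σ₁ N (D (suc i))) 1ℚ ⟩
    c * Σ₁ N (D (suc i)) + c * 1ℚ
      ≤⟨ +-mono-≤ (≤-reflexive (sym (sum-*ˡ N c (λ j → D (suc i) (suc j)))))
           (subst (_≤ 1ℚ) (sym (*-identityʳ c)) (𝟙≤1 (prime? (suc i)))) ⟩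
    Σ₁ N (λ n → c * D (suc i) n) + 1ℚ ∎
    where
    c : ℚ
    c = χ (suc i)

prime-pair-≤ : ∀ p q n → p ≢ q → χ p * D p n * (χ q * D q n) ≤ χ p * χ q * D (p ℕ.* q) n
prime-pair-≤ p q n p≢q = subst₂ _≤_
  (trans (𝟙-× (prime? p ×-dec p ∣? n) (prime? q ×-dec q ∣? n))
    (cong₂ _*_ (𝟙-× (prime? p) (p ∣? n)) (𝟙-× (prime? q) (q ∣? n))))
  (trans (𝟙-× (prime? p ×-dec prime? q) (p ℕ.* q ∣? n)) (cong (_* D (p ℕ.* q) n) (𝟙-× (prime? p) (prime? q))))
  (𝟙-mono ((prime? p ×-dec p ∣? n) ×-dec (prime? q ×-dec q ∣? n)) ((prime? p ×-dec prime? q) ×-dec p ℕ.* q ∣? n)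
    (λ ((pp , p∣n) , (pq , q∣n)) → (pp , pq) , primes-coprime pp pq p≢q p∣n q∣n))

𝟙*𝟙 : ∀ {A : Set} (d : Dec A) → 𝟙 d * 𝟙 d ≡ 𝟙 d
𝟙*𝟙 (yes _) = refl
𝟙*𝟙 (no _)  = refl

-- Distinct primes both divide n only if their product does, which leaves at most N/(pq) such n. On
-- the diagonal the product of indicators collapses to one, giving N/p; the indicator of q = p joins
-- the two cases in one bound.
pair-count-≤ : ∀ N i j → let p = suc i ; q = suc j in
  Σ₁ N (λ n → χ p * D p n * (χ q * D q n)) ≤
    fromℕ N * (χ p * inv p) * (χ q * inv q) + fromℕ N * (χ p * inv p) * 𝟙 (q ℕP.≟ p)
pair-count-≤ N i j with suc j ℕP.≟ suc i
... | yes refl = begin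
  Σ₁ N (λ n → χ p * D p n * (χ p * D p n))
    ≡⟨ sum-cong N (λ k → trans
         (solve 2 (λ c d → c :* d :* (c :* d) := (c :* c) :* (d :* d)) refl (χ p) (D p (suc k)))
         (cong₂ _*_ (𝟙*𝟙 (prime? p)) (𝟙*𝟙 (p ∣? suc k)))) ⟩
  Σ₁ N (λ n → χ p * D p n)
    ≡⟨ sum-*ˡ N (χ p) (λ k → D p (suc k)) ⟩
  χ p * Σ₁ N (D p)
    ≤⟨ mulˡ-≤ (0≤χ p) (count-multiples-≤ i N) ⟩
  χ p * (fromℕ N * inv p)
    ≡⟨ solve 3 (λ c n r → c :* (n :* r) := n :* (c :* r)) refl (χ p) (fromℕ N) (inv p) ⟩
  A
    ≤⟨ p≤p+q (0≤* (0≤* (0≤fromℕ N) (0≤χ*inv p)) (0≤χ*inv p)) ⟩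
  A + A * (χ p * inv p)
    ≡⟨ solve 2 (λ a c → a :+ a :* c := a :* c :+ a :* con 1ℚ) refl A (χ p * inv p) ⟩
  A * (χ p * inv p) + A * 1ℚ ∎
  where
  open ≤-Reasoning
  p : ℕ
  p = suc i
  A : ℚ
  A = fromℕ N * (χ p * inv p)
... | no q≢p = begin
  Σ₁ N (λ n → χ p * D p n * (χ q * D q n))
    ≤⟨ sum-mono-≤ N (λ k _ → prime-pair-≤ p q (suc k) (q≢p ∘ sym)) ⟩
  Σ₁ N (λ n → χ p * χ q * D (p ℕ.* q) n)
    ≡⟨ sum-*ˡ N (χ p * χ q) (λ k → D (p ℕ.* q) (suc k)) ⟩
  χ p * χ q * Σ₁ N (D (p ℕ.* q))
    ≤⟨ mulˡ-≤ (0≤* (0≤χ p) (0≤χ q)) (count-multiples-≤ (j ℕ.+ i ℕ.* q) N) ⟩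
  χ p * χ q * (fromℕ N * inv (p ℕ.* q))
    ≡⟨ cong (λ z → χ p * χ q * (fromℕ N * z)) (inv-* i j) ⟩
  χ p * χ q * (fromℕ N * (inv p * inv q))
    ≡⟨ solve 5 (λ c d n r s → c :* d :* (n :* (r :* s)) := n :* (c :* r) :* (d :* s)) refl (χ p) (χ q) (fromℕ N) (inv p) (inv q) ⟩
  A * (χ q * inv q)
    ≡⟨ solve 2 (λ a b → b := b :+ a :* con 0ℚ) refl A (A * (χ q * inv q)) ⟩
  A * (χ q * inv q) + A * 0ℚ ∎
  where
  open ≤-Reasoning
  p q : ℕ
  p = suc i
  q = suc j
  A : ℚ
  A = fromℕ N * (χ p * inv p)

second-moment : ∀ N → Σ₁ N (λ n → w N n * w N n) ≤ fromℕ N * P N * P N + fromℕ N * P N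
second-moment N = begin
  Σ₁ N (λ n → w N n * w N n)
    ≡⟨ sum-cong N (λ k → sym (sum-* N N (λ i → χ (suc i) * D (suc i) (suc k)) (λ j → χ (suc j) * D (suc j) (suc k)))) ⟩
  Σ₁ N (λ n → Σ₁ N (λ p → Σ₁ N (λ q → χ p * D p n * (χ q * D q n))))
    ≡⟨ sum-swap N N (λ k i → Σ₁ N (λ q → χ (suc i) * D (suc i) (suc k) * (χ q * D q (suc k)))) ⟩
  Σ₁ N (λ p → Σ₁ N (λ n → Σ₁ N (λ q → χ p * D p n * (χ q * D q n))))
    ≡⟨ sum-cong N (λ i → sum-swap N N (λ k j → χ (suc i) * D (suc i) (suc k) * (χ (suc j) * D (suc j) (suc k)))) ⟩
  Σ₁ N (λ p → Σ₁ N (λ q → Σ₁ N (λ n → χ p * D p n * (χ q * D q n))))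
    ≤⟨ sum-mono-≤ N (λ i _ → sum-mono-≤ N (λ j _ → pair-count-≤ N i j)) ⟩
  Σ₁ N (λ p → Σ₁ N (λ q → A p * (χ q * inv q) + A p * 𝟙 (q ℕP.≟ p)))
    ≤⟨ sum-mono-≤ N (λ i _ → inner i) ⟩
  Σ₁ N (λ p → fromℕ N * (P N + 1ℚ) * (χ p * inv p))
    ≡⟨ sum-*ˡ N (fromℕ N * (P N + 1ℚ)) (λ i → χ (suc i) * inv (suc i)) ⟩
  fromℕ N * (P N + 1ℚ) * P N
    ≡⟨ solve 2 (λ n x → n :* (x :+ con 1ℚ) :* x := n :* x :* x :+ n :* x) refl (fromℕ N) (P N) ⟩
  fromℕ N * P N * P N + fromℕ N * P N ∎
  where
  open ≤-Reasoning
  A : ℕ → ℚ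
  A p = fromℕ N * (χ p * inv p)
  inner : ∀ i → Σ₁ N (λ q → A (suc i) * (χ q * inv q) + A (suc i) * 𝟙 (q ℕP.≟ suc i)) ≤
                fromℕ N * (P N + 1ℚ) * (χ (suc i) * inv (suc i))
  inner i = begin
    Σ₁ N (λ q → A p * (χ q * inv q) + A p * 𝟙 (q ℕP.≟ p))
      ≡⟨ sum-add N (λ j → A p * (χ (suc j) * inv (suc j))) (λ j → A p * 𝟙 (suc j ℕP.≟ p)) ⟩
    Σ₁ N (λ q → A p * (χ q * inv q)) + Σ₁ N (λ q → A p * 𝟙 (q ℕP.≟ p))
      ≡⟨ cong₂ _+_ (sum-*ˡ N (A p) (λ j → χ (suc j) * inv (suc j))) (sum-*ˡ N (A p) (λ j → 𝟙 (suc j ℕP.≟ p))) ⟩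
    A p * P N + A p * Σ₁ N (λ q → 𝟙 (q ℕP.≟ p))
      ≤⟨ +-monoʳ-≤ (A p * P N) (mulˡ-≤ (0≤* (0≤fromℕ N) (0≤χ*inv p)) (sum-𝟙-≟ N p)) ⟩
    A p * P N + A p * 1ℚ
      ≡⟨ solve 3 (λ n c x → n :* c :* x :+ n :* c :* con 1ℚ := n :* (x :+ con 1ℚ) :* c) refl (fromℕ N) (χ p * inv p) (P N) ⟩
    fromℕ N * (P N + 1ℚ) * (χ p * inv p) ∎
    where
    p : ℕ
    p = suc i

-- The squares of `P N` cancel. Of the factor 3, one N P comes from the diagonal in `second-moment`,
-- and two from 2 P times the error N of `first-moment`.
turán : ∀ N → Σ₁ N (λ n → (w N n - P N) * (w N n - P N)) ≤ fromℕ 3 * (fromℕ N * P N)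
turán N = begin
  Σ₁ N (λ n → (w N n - x) * (w N n - x))
    ≡⟨ sum-cong N (λ k → solve 2 (λ w x → (w :- x) :* (w :- x) := (w :* w :+ (:- (x :+ x)) :* w) :+ x :* x) refl (w N (suc k)) x) ⟩
  Σ₁ N (λ n → (w N n * w N n + - (x + x) * w N n) + x * x)
    ≡⟨ sum-add N (λ k → w N (suc k) * w N (suc k) + - (x + x) * w N (suc k)) (λ _ → x * x) ⟩
  Σ₁ N (λ n → w N n * w N n + - (x + x) * w N n) + sum N (λ _ → x * x)
    ≡⟨ cong₂ _+_ (trans (sum-add N (λ k → w N (suc k) * w N (suc k)) (λ k → - (x + x) * w N (suc k)))
                   (cong (S₂ +_) (sum-*ˡ N (- (x + x)) (λ k → w N (suc k))))) (sum-const N (x * x)) ⟩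
  S₂ + - (x + x) * S₁ + n * (x * x)
    ≤⟨ +-monoˡ-≤ (n * (x * x)) (+-monoˡ-≤ (- (x + x) * S₁) (second-moment N)) ⟩
  n * x * x + n * x + - (x + x) * S₁ + n * (x * x)
    ≤⟨ ≤-by (mulˡ-≤ (0≤+ (0≤P N) (0≤P N)) (first-moment N))
         (solve 3 (λ n x s → (x :+ x) :* (s :+ n) :- (x :+ x) :* (n :* x) :=
            con (fromℕ 3) :* (n :* x) :- (n :* x :* x :+ n :* x :+ (:- (x :+ x)) :* s :+ n :* (x :* x))) refl n x S₁) ⟩
  fromℕ 3 * (n * x) ∎
  where
  open ≤-Reasoning
  n x S₁ S₂ : ℚ
  n = fromℕ N
  x = P N
  S₁ = Σ₁ N (w N)
  S₂ = Σ₁ N (λ n → w N n * w N n)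

-- Euler's product, a lower bound for the sum of 1/p

-- The indicator that m has no prime divisor up to y, written as a product so that passing to the
-- next prime changes a single factor.
ρ : ℕ → ℕ → ℚ
ρ zero    m = 1ℚ
ρ (suc y) m = ρ y m * (1ℚ - χ (suc y) * D (suc y) m)

χ*D≤1 : ∀ p m → χ p * D p m ≤ 1ℚ
χ*D≤1 p m = mul-≤ (0≤𝟙 (p ∣? m)) 0≤1 (𝟙≤1 (prime? p)) (𝟙≤1 (p ∣? m))

0≤ρ : ∀ y m → 0ℚ ≤ ρ y m
0≤ρ zero    m = 0≤1
0≤ρ (suc y) m = 0≤* (0≤ρ y m) (p≤q⇒0≤q-p (χ*D≤1 (suc y) m))

ρ≤1 : ∀ y m → ρ y m ≤ 1ℚ
ρ≤1 zero    m = ≤-refl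
ρ≤1 (suc y) m = mul-≤ (p≤q⇒0≤q-p (χ*D≤1 (suc y) m)) 0≤1 (ρ≤1 y m)
  (≤-by (0≤* (0≤χ (suc y)) (0≤𝟙 (suc y ∣? m)))
    (solve 1 (λ a → a :- con 0ℚ := con 1ℚ :- (con 1ℚ :- a)) refl (χ (suc y) * D (suc y) m)))

ρ-multiple : ∀ y i d → ρ y (i ℕ.* d) ≤ ρ y i
ρ-multiple zero    i d = ≤-refl
ρ-multiple (suc y) i d = mul-≤ (p≤q⇒0≤q-p (χ*D≤1 (suc y) (i ℕ.* d))) (0≤ρ y i) (ρ-multiple y i d)
  (≤-by (mulˡ-≤ (0≤χ (suc y)) (𝟙-mono (suc y ∣? i) (suc y ∣? i ℕ.* d) (∣m⇒∣m*n d)))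
    (solve 2 (λ a b → b :- a := (con 1ℚ :- a) :- (con 1ℚ :- b)) refl (χ (suc y) * D (suc y) i) (χ (suc y) * D (suc y) (i ℕ.* d))))

ρ-divisible : ∀ y {p m} → Prime p → p ∣ m → p ℕ.≤ y → ρ y m ≡ 0ℚ
ρ-divisible zero    {p} pp p∣m z≤n = ⊥-elim (¬prime[0] pp)
ρ-divisible (suc y) {p} {m} pp p∣m p≤1+y with p ℕP.≟ suc y
... | yes refl = trans
        (cong₂ (λ a b → ρ y m * (1ℚ - a * b)) (𝟙-yes (prime? p) pp) (𝟙-yes (p ∣? m) p∣m))
        (*-zeroʳ (ρ y m))
... | no p≢    = trans
        (cong (_* (1ℚ - χ (suc y) * D (suc y) m)) (ρ-divisible y pp p∣m (ℕ.s≤s⁻¹ (ℕP.≤∧≢⇒< p≤1+y p≢))))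
        (*-zeroˡ (1ℚ - χ (suc y) * D (suc y) m))

-- The sum of 1/m over those m ≤ n without prime divisors up to y.
roughSum : ℕ → ℕ → ℚ
roughSum y n = Σ₁ n (λ m → ρ y m * inv m)

roughSum-split : ∀ y n → roughSum y n ≡
  roughSum (suc y) n + χ (suc y) * Σ₁ n (λ m → D (suc y) m * (ρ y m * inv m))
roughSum-split y n = begin
  roughSum y n
    ≡⟨ sum-cong n (λ i → solve 4 (λ r c d v → r :* v := r :* (con 1ℚ :- c :* d) :* v :+ c :* (d :* (r :* v))) refl
         (ρ y (suc i)) (χ p) (D p (suc i)) (inv (suc i))) ⟩
  Σ₁ n (λ m → ρ p m * inv m + χ p * (D p m * (ρ y m * inv m)))
    ≡⟨ sum-add n (λ i → ρ p (suc i) * inv (suc i)) (λ i → χ p * (D p (suc i) * (ρ y (suc i) * inv (suc i)))) ⟩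
  roughSum p n + Σ₁ n (λ m → χ p * (D p m * (ρ y m * inv m)))
    ≡⟨ cong (roughSum p n +_) (sum-*ˡ n (χ p) (λ i → D p (suc i) * (ρ y (suc i) * inv (suc i)))) ⟩
  roughSum p n + χ p * Σ₁ n (λ m → D p m * (ρ y m * inv m)) ∎
  where
  open ≡-Reasoning
  p : ℕ
  p = suc y

-- Put m = i p. The number i p has at least the prime divisors of i, so its ρ is no larger, and i
-- stays below n.
roughSum-multiples : ∀ y n → Σ₁ n (λ m → D (suc y) m * (ρ y m * inv m)) ≤ roughSum y n * inv (suc y)
roughSum-multiples y n = begin
  Σ₁ n (λ m → D p m * (ρ y m * inv m))
    ≤⟨ sum-multiples-≤ y n (λ m → 0≤* (0≤ρ y m) (0≤inv m)) ⟩
  Σ₁ n (λ i → ρ y (i ℕ.* p) * inv (i ℕ.* p))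
    ≤⟨ sum-mono-≤ n (λ i _ → mulʳ-≤ (0≤inv (suc i ℕ.* p)) (ρ-multiple y (suc i) p)) ⟩
  Σ₁ n (λ i → ρ y i * inv (i ℕ.* p))
    ≡⟨ sum-cong n (λ i → trans (cong (ρ y (suc i) *_) (inv-* i y)) (sym (*-assoc (ρ y (suc i)) (inv (suc i)) (inv p)))) ⟩
  Σ₁ n (λ i → ρ y i * inv i * inv p)
    ≡⟨ sum-*ʳ n (inv p) (λ i → ρ y (suc i) * inv (suc i)) ⟩
  roughSum y n * inv p ∎
  where
  open ≤-Reasoning
  p : ℕ
  p = suc y

-- With p = y + 2 the hypothesis reads t (1 - 1/p) ≤ u, and 1/(1 - 1/p) = 1 + 1/(p - 1).
euler-factor : ∀ y {t u} → t ≤ u + t * inv (suc (suc y)) → t ≤ u * (1ℚ + inv (suc y))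
euler-factor y {t} {u} h = subst (t ≤_)
  (begin-equality
    u * (a + 1ℚ) * inv (suc y)      ≡⟨ solve 3 (λ u a r → u :* (a :+ con 1ℚ) :* r := u :* (a :* r :+ r)) refl u a (inv (suc y)) ⟩
    u * (a * inv (suc y) + inv (suc y)) ≡⟨ cong (λ z → u * (z + inv (suc y))) (fromℕ*inv y) ⟩
    u * (1ℚ + inv (suc y)) ∎)
  (*≤⇒≤*recip {t} {u * (a + 1ℚ)} (0<fromℕ-suc y) (≤-by scaled
    (solve 3 (λ t u a → (u :* (a :+ con 1ℚ) :+ t) :- t :* (a :+ con 1ℚ) := u :* (a :+ con 1ℚ) :- t :* a) refl t u a)))
  where
  open ≤-Reasoning
  a : ℚ
  a = fromℕ (suc y)
  scaled : t * (a + 1ℚ) ≤ u * (a + 1ℚ) + t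
  scaled = begin
    t * (a + 1ℚ)                              ≡⟨ cong (t *_) (fromℕ-suc (suc y)) ⟨
    t * fromℕ (suc (suc y))                   ≤⟨ mulʳ-≤ (0≤fromℕ (suc (suc y))) h ⟩
    (u + t * inv (suc (suc y))) * fromℕ (suc (suc y))
      ≡⟨ solve 4 (λ u t r p → (u :+ t :* r) :* p := u :* p :+ t :* (p :* r)) refl u t (inv (suc (suc y))) (fromℕ (suc (suc y))) ⟩
    u * fromℕ (suc (suc y)) + t * (fromℕ (suc (suc y)) * inv (suc (suc y)))
      ≡⟨ cong₂ (λ p o → u * p + t * o) (fromℕ-suc (suc y)) (fromℕ*inv (suc y)) ⟩
    u * (a + 1ℚ) + t * 1ℚ                     ≡⟨ cong (u * (a + 1ℚ) +_) (*-identityʳ t) ⟩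
    u * (a + 1ℚ) + t ∎

roughSum-step : ∀ y n → roughSum y n ≤ roughSum (suc y) n * (1ℚ + χ (suc y) * inv y)
roughSum-step y n = go y {u = roughSum (suc y) n} (prime? (suc y)) (roughSum-split y n) (roughSum-multiples y n)
  where
  go : ∀ y {t u b} (d : Dec (Prime (suc y))) → t ≡ u + 𝟙 d * b → b ≤ t * inv (suc y) → t ≤ u * (1ℚ + 𝟙 d * inv y)
  go y {t} {u} {b} (no _) eq _ = ≤-reflexive (trans eq
    (solve 3 (λ u b v → u :+ con 0ℚ :* b := u :* (con 1ℚ :+ con 0ℚ :* v)) refl u b (inv y)))
  go zero    (yes pp) _ _ = ⊥-elim (¬prime[1] pp)
  go (suc y) {t} {u} {b} (yes _) eq h = subst (λ z → t ≤ u * (1ℚ + z)) (sym (*-identityˡ (inv (suc y))))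
    (euler-factor y {t} {u} (≤-trans (≤-reflexive (trans eq (cong (u +_) (*-identityˡ b)))) (+-monoʳ-≤ u h)))

-- For p = `suc n` the factor 1 + 1/(p - 1) is the full geometric series of 1/p. At p = 1 the factor
-- is 1, as χ 1 = 0.
eulerProduct : ℕ → ℚ
eulerProduct zero    = 1ℚ
eulerProduct (suc n) = eulerProduct n * (1ℚ + χ (suc n) * inv n)

1≤eulerProduct : ∀ n → 1ℚ ≤ eulerProduct n
1≤eulerProduct zero    = ≤-refl
1≤eulerProduct (suc n) = ≤-trans (1≤eulerProduct n) (≤-by
  (0≤* (≤-trans 0≤1 (1≤eulerProduct n)) (0≤* (0≤χ (suc n)) (0≤inv n)))
  (solve 2 (λ e x → e :* x :- con 0ℚ := e :* (con 1ℚ :+ x) :- e) refl (eulerProduct n) (χ (suc n) * inv n)))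

H≤roughSum*eulerProduct : ∀ y n → H n ≤ roughSum y n * eulerProduct y
H≤roughSum*eulerProduct zero    n = ≤-reflexive (trans
  (sum-cong n (λ i → sym (*-identityˡ (inv (suc i))))) (sym (*-identityʳ (roughSum 0 n))))
H≤roughSum*eulerProduct (suc y) n = begin
  H n                                       ≤⟨ H≤roughSum*eulerProduct y n ⟩
  roughSum y n * eulerProduct y             ≤⟨ mulʳ-≤ (≤-trans 0≤1 (1≤eulerProduct y)) (roughSum-step y n) ⟩
  roughSum (suc y) n * f * eulerProduct y   ≡⟨ solve 3 (λ t f e → t :* f :* e := t :* (e :* f)) refl (roughSum (suc y) n) f (eulerProduct y) ⟩
  roughSum (suc y) n * eulerProduct (suc y) ∎
  where
  open ≤-Reasoning
  f : ℚ
  f = 1ℚ + χ (suc y) * inv y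

prime-divisor : ∀ m → ∃[ p ] Prime p × p ∣ suc (suc m)
prime-divisor m = go (factors f) (isFactorisation f) (factorsPrime f)
  where
  f : PrimeFactorisation (suc (suc m))
  f = factorise (suc (suc m))
  go : ∀ ps → suc (suc m) ≡ product ps → All Prime ps → ∃[ p ] Prime p × p ∣ suc (suc m)
  go (p ∷ ps) eq (pp ∷ _) = p , pp , subst (p ∣_) (sym eq) (m∣m*n (product ps))

-- Every m from 2 to n + 1 has a prime divisor in the sieved range, so only m = 1 can survive.
roughSum-diagonal : ∀ n → roughSum (suc n) (suc n) ≤ 1ℚ
roughSum-diagonal n = begin
  roughSum (suc n) (suc n)
    ≡⟨ sum-shift n (λ i → ρ (suc n) (suc i) * inv (suc i)) ⟩
  ρ (suc n) 1 * inv 1 + sum n (λ i → ρ (suc n) (suc (suc i)) * inv (suc (suc i)))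
    ≡⟨ cong₂ _+_ (*-identityʳ (ρ (suc n) 1)) (sum-zero n rest) ⟩
  ρ (suc n) 1 + 0ℚ
    ≡⟨ +-identityʳ (ρ (suc n) 1) ⟩
  ρ (suc n) 1
    ≤⟨ ρ≤1 (suc n) 1 ⟩
  1ℚ ∎
  where
  open ≤-Reasoning
  rest : ∀ i → i ℕ.< n → ρ (suc n) (suc (suc i)) * inv (suc (suc i)) ≡ 0ℚ
  rest i i<n = let p , pp , p∣ = prime-divisor i in
    trans (cong (_* inv (suc (suc i))) (ρ-divisible (suc n) pp p∣ (ℕP.≤-trans (∣⇒≤ p∣) (s≤s i<n))))
      (*-zeroˡ (inv (suc (suc i))))

H≤eulerProduct : ∀ n → H n ≤ eulerProduct n
H≤eulerProduct zero    = 0≤1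
H≤eulerProduct (suc n) = ≤-trans (H≤roughSum*eulerProduct (suc n) (suc n))
  (subst (roughSum (suc n) (suc n) * eulerProduct (suc n) ≤_) (*-identityˡ (eulerProduct (suc n)))
    (mulʳ-≤ (≤-trans 0≤1 (1≤eulerProduct (suc n))) (roughSum-diagonal n)))

ℓ-eulerProduct : ∀ n → ℓ (eulerProduct n) ≲ (λ _ → sum n (λ i → χ (suc i) * inv i))
ℓ-eulerProduct zero    = ≤⇒≲ (λ m → ≤-reflexive (riemann-1 (suc m)))
ℓ-eulerProduct (suc n) = ≲-trans
  (ℓ-*-upper (χ (suc n) * inv n) (1≤eulerProduct n) (0≤* (0≤χ (suc n)) (0≤inv n)))
  (≲-+ʳ (χ (suc n) * inv n) (ℓ-eulerProduct n))

-- The sum of 1/(p - 1) - 1/p telescopes.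
sum-χ/pred≤P+1 : ∀ n → sum (suc n) (λ i → χ (suc i) * inv i) + inv (suc n) ≤ P (suc n) + 1ℚ
sum-χ/pred≤P+1 zero    = ≤-refl
sum-χ/pred≤P+1 (suc n) = ≤-by (+-mono-≤ (sum-χ/pred≤P+1 n) step)
  (solve 6 (λ s p a b x y → ((p :+ con 1ℚ) :+ (y :+ a)) :- ((s :+ a) :+ (x :+ b)) :=
      (p :+ y :+ con 1ℚ) :- (s :+ x :+ b)) refl
    (sum (suc n) (λ i → χ (suc i) * inv i)) (P (suc n)) a b (c * a) (c * b))
  where
  a b c : ℚ
  a = inv (suc n)
  b = inv (suc (suc n))
  c = χ (suc (suc n))
  step : c * a + b ≤ c * b + a
  step = ≤-by (mulʳ-≤ (p≤q⇒0≤q-p (inv-antimono (ℕP.n≤1+n n))) (𝟙≤1 (prime? (suc (suc n)))))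
    (solve 3 (λ c a b → con 1ℚ :* (a :- b) :- c :* (a :- b) := (c :* b :+ a) :- (c :* a :+ b)) refl c a b)

-- Powers of the sum of 1/p, an upper bound for it

-- Prime factors are counted with multiplicity, so that multiplying by a prime adds exactly 1 even
-- if it already divides.
Ω : ℕ → ℕ
Ω zero    = 0
Ω (suc n) = length (factors (factorise (suc n)))

Ω-prime-* : ∀ p m → Prime (suc p) → Ω (suc m ℕ.* suc p) ≡ suc (Ω (suc m))
Ω-prime-* p m pp = ↭-length (factorisationUnique (factorise (suc m ℕ.* suc p)) extended)
  where
  f : PrimeFactorisation (suc m)
  f = factorise (suc m)
  extended : PrimeFactorisation (suc m ℕ.* suc p)
  extended = record
    { factors         = suc p ∷ factors f
    ; isFactorisation = trans (ℕP.*-comm (suc m) (suc p)) (cong (suc p ℕ.*_) (isFactorisation f))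
    ; factorsPrime    = pp ∷ factorsPrime f
    }

-- A prime dividing `a * product ps` equals `a` or divides `product ps`, so each entry contributes
-- at most 1.
χ*D-product : ∀ N ps → All Prime ps → Σ₁ N (λ p → χ p * D p (product ps)) ≤ fromℕ (length ps)
χ*D-product N [] [] = ≤-reflexive (sum-zero N (λ i _ → unit (suc i)))
  where
  unit : ∀ p → χ p * D p 1 ≡ 0ℚ
  unit p = trans (sym (𝟙-× (prime? p) (p ∣? 1))) (𝟙-no (prime? p ×-dec p ∣? 1)
    (λ (pp , p∣1) → ¬prime[1] (subst Prime (∣1⇒≡1 p∣1) pp)))
χ*D-product N (a ∷ ps) (pa ∷ pps) = begin
  Σ₁ N (λ p → χ p * D p (a ℕ.* product ps))
    ≤⟨ sum-mono-≤ N (λ i _ → term (suc i)) ⟩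
  Σ₁ N (λ p → 𝟙 (p ℕP.≟ a) + χ p * D p (product ps))
    ≡⟨ sum-add N (λ i → 𝟙 (suc i ℕP.≟ a)) (λ i → χ (suc i) * D (suc i) (product ps)) ⟩
  Σ₁ N (λ p → 𝟙 (p ℕP.≟ a)) + Σ₁ N (λ p → χ p * D p (product ps))
    ≤⟨ +-mono-≤ (sum-𝟙-≟ N a) (χ*D-product N ps pps) ⟩
  1ℚ + fromℕ (length ps)
    ≡⟨ fromℕ-+ 1 (length ps) ⟨
  fromℕ (suc (length ps)) ∎
  where
  open ≤-Reasoning
  m : ℕ
  m = product ps
  0≤χD : ∀ p → 0ℚ ≤ χ p * D p m
  0≤χD p = 0≤* (0≤χ p) (0≤𝟙 (p ∣? m))
  term : ∀ p → χ p * D p (a ℕ.* m) ≤ 𝟙 (p ℕP.≟ a) + χ p * D p m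
  term p = subst (_≤ 𝟙 (p ℕP.≟ a) + χ p * D p m) (𝟙-× (prime? p) (p ∣? a ℕ.* m)) (cases (prime? p ×-dec p ∣? a ℕ.* m))
    where
    cases : (d : Dec (Prime p × p ∣ a ℕ.* m)) → 𝟙 d ≤ 𝟙 (p ℕP.≟ a) + χ p * D p m
    cases (no _) = 0≤+ (0≤𝟙 (p ℕP.≟ a)) (0≤χD p)
    cases (yes (pp , p∣am)) with euclidsLemma a m pp p∣am
    ... | inj₂ p∣m = ≤-by (0≤𝟙 (p ℕP.≟ a)) (trans
            (solve 1 (λ x → x :- con 0ℚ := (x :+ con 1ℚ :* con 1ℚ) :- con 1ℚ) refl (𝟙 (p ℕP.≟ a)))
            (cong₂ (λ u v → 𝟙 (p ℕP.≟ a) + u * v - 1ℚ) (sym (𝟙-yes (prime? p) pp)) (sym (𝟙-yes (p ∣? m) p∣m))))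
    ... | inj₁ p∣a with prime⇒irreducible pa p∣a
    ...   | inj₁ refl = ⊥-elim (¬prime[1] pp)
    ...   | inj₂ refl = subst (λ z → 1ℚ ≤ z + χ p * D p m) (sym (𝟙-yes (p ℕP.≟ p) refl)) (p≤p+q (0≤χD p))

w≤Ω : ∀ N m → w N (suc m) ≤ fromℕ (Ω (suc m))
w≤Ω N m = subst (λ z → w N z ≤ fromℕ (Ω (suc m))) (sym (isFactorisation f))
  (χ*D-product N (factors f) (factorsPrime f))
  where
  f : PrimeFactorisation (suc m)
  f = factorise (suc m)

-- Reciprocal sums over the integers with k prime factors

g : ℕ → ℕ → ℚ
g k m = 𝟙 (Ω m ℕP.≟ k) * inv m

0≤g : ∀ k m → 0ℚ ≤ g k m
0≤g k m = 0≤* (0≤𝟙 (Ω m ℕP.≟ k)) (0≤inv m)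

W : ℕ → ℕ → ℚ
W k M = Σ₁ M (g k)

W≤H : ∀ k M → W k M ≤ H M
W≤H k M = sum-mono-≤ M (λ i _ → subst (g k (suc i) ≤_) (*-identityˡ (inv (suc i)))
  (mulʳ-≤ (0≤inv (suc i)) (𝟙≤1 (Ω (suc i) ℕP.≟ k))))

g-prime-* : ∀ k i m → Prime (suc i) → inv (suc i) * g k (suc m) ≤ g (suc k) (suc m ℕ.* suc i)
g-prime-* k i m pp = subst (_≤ g (suc k) (suc m ℕ.* suc i))
  (trans (cong (e *_) (inv-* m i)) (solve 3 (λ e a b → e :* (a :* b) := b :* (e :* a)) refl e (inv (suc m)) (inv (suc i))))
  (mulʳ-≤ (0≤inv (suc m ℕ.* suc i)) (𝟙-mono (Ω (suc m) ℕP.≟ k) (Ω (suc m ℕ.* suc i) ℕP.≟ suc k)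
    (λ e → trans (Ω-prime-* i m pp) (cong suc e))))
  where
  e : ℚ
  e = 𝟙 (Ω (suc m) ℕP.≟ k)

w*g≤ : ∀ k n m → w n (suc m) * g k (suc m) ≤ fromℕ k * g k (suc m)
w*g≤ k n m with Ω (suc m) ℕP.≟ k
... | yes refl = mulʳ-≤ (0≤* 0≤1 (0≤inv (suc m))) (w≤Ω n m)
... | no _     = ≤-reflexive (solve 3 (λ a b v → a :* (con 0ℚ :* v) := b :* (con 0ℚ :* v)) refl
                   (w n (suc m)) (fromℕ k) (inv (suc m)))

-- Expand the left side into terms 1/(p m). Each p m is at most n M and has k + 1 prime factors, and
-- an integer with k + 1 prime factors arises from at most k + 1 choices of p.
P*W : ∀ k n M → P n * W k M ≤ fromℕ (suc k) * W (suc k) (n ℕ.* M)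
P*W k n M = begin
  P n * W k M
    ≡⟨ sum-*ʳ n (W k M) (λ i → χ (suc i) * inv (suc i)) ⟨
  Σ₁ n (λ p → χ p * inv p * W k M)
    ≤⟨ sum-mono-≤ n prime-part ⟩
  Σ₁ n (λ p → χ p * Σ₁ nM (λ m → D p m * g (suc k) m))
    ≡⟨ sum-cong n (λ i → sym (sum-*ˡ nM (χ (suc i)) (λ j → D (suc i) (suc j) * g (suc k) (suc j)))) ⟩
  Σ₁ n (λ p → Σ₁ nM (λ m → χ p * (D p m * g (suc k) m)))
    ≡⟨ sum-swap n nM (λ i j → χ (suc i) * (D (suc i) (suc j) * g (suc k) (suc j))) ⟩
  Σ₁ nM (λ m → Σ₁ n (λ p → χ p * (D p m * g (suc k) m)))
    ≡⟨ sum-cong nM (λ j → trans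
         (sum-cong n (λ i → sym (*-assoc (χ (suc i)) (D (suc i) (suc j)) (g (suc k) (suc j)))))
         (sum-*ʳ n (g (suc k) (suc j)) (λ i → χ (suc i) * D (suc i) (suc j)))) ⟩
  Σ₁ nM (λ m → w n m * g (suc k) m)
    ≤⟨ sum-mono-≤ nM (λ j _ → w*g≤ (suc k) n j) ⟩
  Σ₁ nM (λ m → fromℕ (suc k) * g (suc k) m)
    ≡⟨ sum-*ˡ nM (fromℕ (suc k)) (λ j → g (suc k) (suc j)) ⟩
  fromℕ (suc k) * W (suc k) nM ∎
  where
  open ≤-Reasoning
  nM : ℕ
  nM = n ℕ.* M
  prime-part : ∀ i → i ℕ.< n → χ (suc i) * inv (suc i) * W k M ≤
               χ (suc i) * Σ₁ nM (λ m → D (suc i) m * g (suc k) m)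
  prime-part i i<n = cases (prime? (suc i))
    where
    S : ℚ
    S = Σ₁ nM (λ m → D (suc i) m * g (suc k) m)
    cases : (d : Dec (Prime (suc i))) → 𝟙 d * inv (suc i) * W k M ≤ 𝟙 d * S
    cases (no _) = ≤-reflexive (solve 3 (λ a b c → con 0ℚ :* a :* b := con 0ℚ :* c) refl (inv (suc i)) (W k M) S)
    cases (yes pp) = begin
      1ℚ * inv (suc i) * W k M
        ≡⟨ solve 2 (λ a b → con 1ℚ :* a :* b := a :* b) refl (inv (suc i)) (W k M) ⟩
      inv (suc i) * W k M
        ≡⟨ sum-*ˡ M (inv (suc i)) (λ j → g k (suc j)) ⟨
      Σ₁ M (λ m → inv (suc i) * g k m)
        ≤⟨ sum-mono-≤ M (λ j _ → g-prime-* k i j pp) ⟩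
      Σ₁ M (λ m → g (suc k) (m ℕ.* suc i))
        ≤⟨ sum-multiples-≥ i nM M (subst (M ℕ.* suc i ℕ.≤_) (ℕP.*-comm M n) (ℕP.*-monoʳ-≤ M i<n)) (0≤g (suc k)) ⟩
      S
        ≡⟨ *-identityˡ S ⟨
      1ℚ * S ∎

P^≤!*W : ∀ k n → P n ^ℚ k ≤ fromℕ (k !) * W k (n ℕ.^ k)
P^≤!*W zero    n = ≤-refl
P^≤!*W (suc k) n = begin
  P n * P n ^ℚ k
    ≤⟨ mulˡ-≤ (0≤P n) (P^≤!*W k n) ⟩
  P n * (fromℕ (k !) * W k (n ℕ.^ k))
    ≡⟨ solve 3 (λ a b c → a :* (b :* c) := b :* (a :* c)) refl (P n) (fromℕ (k !)) (W k (n ℕ.^ k)) ⟩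
  fromℕ (k !) * (P n * W k (n ℕ.^ k))
    ≤⟨ mulˡ-≤ (0≤fromℕ (k !)) (P*W k n (n ℕ.^ k)) ⟩
  fromℕ (k !) * (fromℕ (suc k) * W (suc k) (n ℕ.^ suc k))
    ≡⟨ solve 3 (λ a b c → a :* (b :* c) := b :* a :* c) refl (fromℕ (k !)) (fromℕ (suc k)) (W (suc k) (n ℕ.^ suc k)) ⟩
  fromℕ (suc k) * fromℕ (k !) * W (suc k) (n ℕ.^ suc k)
    ≡⟨ cong (_* W (suc k) (n ℕ.^ suc k)) (fromℕ-* (suc k) (k !)) ⟨
  fromℕ (suc k !) * W (suc k) (n ℕ.^ suc k) ∎
  where open ≤-Reasoning

-- Harmonic numbers of products and powers

0≤H : ∀ n → 0ℚ ≤ H n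
0≤H n = sum-nonneg n (λ i → 0≤inv (suc i))

-- Cut the range into y blocks of length x. Block 0 sums to `H x`; in block i ≥ 1 the x terms are
-- each at most 1/(i x), so it contributes at most 1/i.
H-* : ∀ y x → H (y ℕ.* x) ≤ H x + H y
H-* zero    x = 0≤+ (0≤H x) ≤-refl
H-* (suc y) zero = subst (λ z → H z ≤ 0ℚ + H (suc y)) (sym (ℕP.*-zeroʳ (suc y)))
  (0≤+ ≤-refl (0≤H (suc y)))
H-* (suc y) x@(suc x-1) = begin
  H (suc y ℕ.* x)
    ≡⟨ sum-blocks (suc y) x (λ i → inv (suc i)) ⟩
  sum (suc y) block
    ≡⟨ sum-shift y block ⟩
  H x + Σ₁ y block
    ≤⟨ +-monoʳ-≤ (H x) (sum-mono-≤ y (λ i _ → block≤ i)) ⟩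
  H x + H y
    ≤⟨ +-monoʳ-≤ (H x) (sum-extend (ℕP.n≤1+n y) (λ i → 0≤inv (suc i))) ⟩
  H x + H (suc y) ∎
  where
  open ≤-Reasoning
  block : ℕ → ℚ
  block i = sum x (λ j → inv (suc (i ℕ.* x ℕ.+ j)))
  block≤ : ∀ i → block (suc i) ≤ inv (suc i)
  block≤ i = begin
    block (suc i)
      ≤⟨ sum-mono-≤ x (λ j _ → inv-antimono (ℕP.≤-trans (ℕP.n≤1+n _) (ℕP.m≤m+n (suc i ℕ.* x) j))) ⟩
    sum x (λ _ → inv (suc i ℕ.* x))
      ≡⟨ sum-const x (inv (suc i ℕ.* x)) ⟩
    fromℕ x * inv (suc i ℕ.* x)
      ≡⟨ cong (fromℕ x *_) (inv-* i x-1) ⟩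
    fromℕ x * (inv (suc i) * inv x)
      ≡⟨ solve 3 (λ x a b → x :* (a :* b) := a :* (x :* b)) refl (fromℕ x) (inv (suc i)) (inv x) ⟩
    inv (suc i) * (fromℕ x * inv x)
      ≡⟨ cong (inv (suc i) *_) (fromℕ*inv x-1) ⟩
    inv (suc i) * 1ℚ
      ≡⟨ *-identityʳ (inv (suc i)) ⟩
    inv (suc i) ∎

H-^ : ∀ k n → H (n ℕ.^ suc k) ≤ fromℕ (suc k) * H n
H-^ zero    n = ≤-reflexive (trans (cong H (ℕP.*-identityʳ n)) (sym (*-identityˡ (H n))))
H-^ (suc k) n = begin
  H (n ℕ.* n ℕ.^ suc k)           ≤⟨ H-* n (n ℕ.^ suc k) ⟩
  H (n ℕ.^ suc k) + H n           ≤⟨ +-monoˡ-≤ (H n) (H-^ k n) ⟩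
  fromℕ (suc k) * H n + H n       ≡⟨ solve 2 (λ k h → k :* h :+ h := (k :+ con 1ℚ) :* h) refl (fromℕ (suc k)) (H n) ⟩
  (fromℕ (suc k) + 1ℚ) * H n      ≡⟨ cong (_* H n) (fromℕ-suc (suc k)) ⟨
  fromℕ (suc (suc k)) * H n ∎
  where open ≤-Reasoning

-- X i = (i + 1)ⁱ / (i + 1)!, as a product whose logarithm can be bounded factor by factor.
X : ℕ → ℚ
X zero    = 1ℚ
X (suc i) = X i * (1ℚ + inv (suc i)) ^ℚ i

0<! : ∀ n → 0ℚ < fromℕ (n !)
0<! zero    = 0<1
0<! (suc n) = subst (0ℚ <_) (sym (fromℕ-* (suc n) (n !))) (0<* (0<fromℕ-suc n) (0<! n))

X*! : ∀ i → X i * fromℕ (suc i !) ≡ fromℕ (suc i) ^ℚ i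
X*! zero    = refl
X*! (suc i) = begin
  X i * (1ℚ + inv a) ^ℚ i * fromℕ (suc a !)
    ≡⟨ cong (X i * (1ℚ + inv a) ^ℚ i *_) (fromℕ-* (suc a) (a !)) ⟩
  X i * (1ℚ + inv a) ^ℚ i * (fromℕ (suc a) * fromℕ (a !))
    ≡⟨ solve 4 (λ x y b f → x :* y :* (b :* f) := b :* (x :* f :* y)) refl (X i) ((1ℚ + inv a) ^ℚ i) (fromℕ (suc a)) (fromℕ (a !)) ⟩
  fromℕ (suc a) * (X i * fromℕ (a !) * (1ℚ + inv a) ^ℚ i)
    ≡⟨ cong (λ z → fromℕ (suc a) * (z * (1ℚ + inv a) ^ℚ i)) (X*! i) ⟩
  fromℕ (suc a) * (fromℕ a ^ℚ i * (1ℚ + inv a) ^ℚ i)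
    ≡⟨ cong (fromℕ (suc a) *_) (^ℚ-distrib-* (fromℕ a) (1ℚ + inv a) i) ⟨
  fromℕ (suc a) * (fromℕ a * (1ℚ + inv a)) ^ℚ i
    ≡⟨ cong (λ z → fromℕ (suc a) * z ^ℚ i) base ⟩
  fromℕ (suc a) * fromℕ (suc a) ^ℚ i ∎
  where
  open ≡-Reasoning
  a : ℕ
  a = suc i
  base : fromℕ a * (1ℚ + inv a) ≡ fromℕ (suc a)
  base = begin
    fromℕ a * (1ℚ + inv a)        ≡⟨ solve 2 (λ a r → a :* (con 1ℚ :+ r) := a :+ a :* r) refl (fromℕ a) (inv a) ⟩
    fromℕ a + fromℕ a * inv a     ≡⟨ cong (fromℕ a +_) (fromℕ*inv i) ⟩
    fromℕ a + 1ℚ                  ≡⟨ fromℕ-suc a ⟨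
    fromℕ (suc a) ∎

-- With k = i + 1, k^k ≤ (P n)^k ≤ k! H (n^k) ≤ k! k H n. Dividing by k · k! leaves k^(k-1)/k!,
-- which is `X i`.
X≤H : ∀ i n → fromℕ (suc i) ≤ P n → X i ≤ H n
X≤H i n i+1≤P = *-cancelʳ-≤ (fromℕ a * fromℕ (a !)) (0<* (0<fromℕ-suc i) (0<! a)) (begin
  X i * (fromℕ a * fromℕ (a !))        ≡⟨ solve 3 (λ x a f → x :* (a :* f) := a :* (x :* f)) refl (X i) (fromℕ a) (fromℕ (a !)) ⟩
  fromℕ a * (X i * fromℕ (a !))        ≡⟨ cong (fromℕ a *_) (X*! i) ⟩
  fromℕ a ^ℚ a                         ≤⟨ ^ℚ-mono-≤ a (0≤fromℕ a) i+1≤P ⟩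
  P n ^ℚ a                             ≤⟨ P^≤!*W a n ⟩
  fromℕ (a !) * W a (n ℕ.^ a)          ≤⟨ mulˡ-≤ (0≤fromℕ (a !)) (≤-trans (W≤H a (n ℕ.^ a)) (H-^ i n)) ⟩
  fromℕ (a !) * (fromℕ a * H n)        ≡⟨ solve 3 (λ f a h → f :* (a :* h) := h :* (a :* f)) refl (fromℕ (a !)) (fromℕ a) (H n) ⟩
  H n * (fromℕ a * fromℕ (a !)) ∎)
  where
  open ≤-Reasoning
  a : ℕ
  a = suc i

-- Comparison with ln ln

H-double : ∀ n → H (suc n) + ½ ≤ H (2 ℕ.* suc n)
H-double n = subst (H a + ½ ≤_)
  (trans (sym (sum-+ a a (λ i → inv (suc i)))) (cong (λ z → H (a ℕ.+ z)) (sym (ℕP.+-identityʳ a))))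
  (+-monoʳ-≤ (H a) (begin
    ½
      ≡⟨ *-identityˡ ½ ⟨
    1ℚ * ½
      ≡⟨ cong (_* ½) (fromℕ*inv n) ⟨
    fromℕ a * inv a * ½
      ≡⟨ solve 3 (λ x r h → x :* r :* h := x :* (h :* r)) refl (fromℕ a) (inv a) ½ ⟩
    fromℕ a * (inv 2 * inv a)
      ≡⟨ cong (fromℕ a *_) (inv-* 1 n) ⟨
    fromℕ a * inv (2 ℕ.* a)
      ≡⟨ sum-const a (inv (2 ℕ.* a)) ⟨
    sum a (λ _ → inv (2 ℕ.* a))
      ≤⟨ sum-mono-≤ a (λ j j<a → inv-antimono (ℕ.s≤s⁻¹
           (subst (suc (a ℕ.+ j) ℕ.≤_) (cong (a ℕ.+_) (sym (ℕP.+-identityʳ a))) (ℕP.+-monoʳ-< a j<a)))) ⟩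
    sum a (λ j → inv (suc (a ℕ.+ j))) ∎))
  where
  open ≤-Reasoning
  a : ℕ
  a = suc n

H-2^ : ∀ k → ∃[ n ] fromℕ k * ½ ≤ H (suc n)
H-2^ zero    = 0 , 0≤H 1
-- The successor of this witness is 2 (n + 1), so the index doubles at each step.
H-2^ (suc k) = let n , h = H-2^ k in n ℕ.+ 1 ℕ.* suc n , ≤-trans
  (≤-by (+-monoˡ-≤ ½ h) (trans
    (solve 3 (λ k h e → (h :+ e) :- (k :* e :+ e) := (h :+ e) :- (k :+ con 1ℚ) :* e) refl (fromℕ k) (H (suc n)) ½)
    (cong (λ z → H (suc n) + ½ - z * ½) (sym (fromℕ-suc k)))))
  (H-double n)

H-mono-≤ : ∀ {m n} → m ℕ.≤ n → H m ≤ H n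
H-mono-≤ m≤n = sum-extend m≤n (λ i → 0≤inv (suc i))

H-unbounded : ∀ B → ∃[ n₀ ] ∀ n → n₀ ℕ.≤ n → fromℕ B ≤ H n
H-unbounded B = let n₀ , h = H-2^ (B ℕ.* 2) in suc n₀ , λ n n₀≤n →
  ≤-trans (subst (_≤ H (suc n₀)) halve h) (H-mono-≤ n₀≤n)
  where
  halve : fromℕ (B ℕ.* 2) * ½ ≡ fromℕ B
  halve = trans (cong (_* ½) (fromℕ-* B 2)) (trans (*-assoc (fromℕ B) (fromℕ 2) ½) (*-identityʳ (fromℕ B)))

P≤H : ∀ n → P n ≤ H n
P≤H n = sum-mono-≤ n (λ i _ → subst (χ (suc i) * inv (suc i) ≤_) (*-identityˡ (inv (suc i)))
  (mulʳ-≤ (0≤inv (suc i)) (𝟙≤1 (prime? (suc i)))))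

H≤fromℕ : ∀ n → H n ≤ fromℕ n
H≤fromℕ n = subst (H n ≤_) (trans (sum-const n 1ℚ) (*-identityʳ (fromℕ n))) (sum-mono-≤ n (λ i _ → inv≤1 (suc i)))

-- The first t + 1 terms are at most 1 and all later ones at most 1/(t + 1). This makes H j = o(j)
-- quantitative, so that the loss 2 H in `lowerX` can be absorbed into a small multiple of P.
H-sublinear : ∀ t j → H j ≤ fromℕ (suc t) + fromℕ j * inv (suc t)
H-sublinear t zero = 0≤+ (0≤fromℕ (suc t)) (0≤* ≤-refl (0≤inv (suc t)))
H-sublinear t (suc j) with ℕP.≤-total t j
... | inj₁ t≤j = ≤-by (+-mono-≤ (H-sublinear t j) (inv-antimono t≤j)) (trans
        (solve 5 (λ h r a j s → (a :+ j :* s :+ s) :- (h :+ r) := (a :+ (j :+ con 1ℚ) :* s) :- (h :+ r)) refl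
          (H j) (inv (suc j)) (fromℕ (suc t)) (fromℕ j) (inv (suc t)))
        (cong (λ z → fromℕ (suc t) + z * inv (suc t) - H (suc j)) (sym (fromℕ-suc j))))
... | inj₂ j≤t = ≤-trans (≤-trans (H≤fromℕ (suc j)) (fromℕ-mono-≤ (s≤s j≤t)))
        (p≤p+q (0≤* (0≤fromℕ (suc j)) (0≤inv (suc t))))

ℓ-mono-≤ : ∀ {p q} → 1ℚ ≤ p → p ≤ q → ℓ p ≲ ℓ q
ℓ-mono-≤ 1≤p p≤q = ≤⇒≲ (λ m → riemann-mono-≤ (suc m) 1≤p p≤q)

ℓ-eulerProduct≲P : ∀ n → ℓ (eulerProduct (suc n)) ≲ (λ _ → P (suc n) + 1ℚ)
ℓ-eulerProduct≲P n = ≲-trans (ℓ-eulerProduct (suc n))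
  (≤⇒≲ (λ _ → ≤-trans (p≤p+q (0≤inv (suc n))) (sum-χ/pred≤P+1 n)))

ℓH≲P : ∀ n → 1ℚ ≤ H (suc n) → ℓ (H (suc n)) ≲ (λ _ → P (suc n) + 1ℚ)
ℓH≲P n 1≤H = ≲-trans (ℓ-mono-≤ 1≤H (H≤eulerProduct (suc n))) (ℓ-eulerProduct≲P n)

1≤H : ∀ n → 1ℚ ≤ H (suc n)
1≤H n = H-mono-≤ {1} {suc n} (s≤s z≤n)

-- Once H n ≥ M + 1, ln (M + 1) ≤ ln (H n) ≤ P n + 1. The 3 covers the 1 lost in `H≲ℓ`, the 1 lost
-- in `ℓH≲P` and a tolerance 1 of `≲`; both sides are free of the index, so a single index suffices.
P-unbounded : ∀ B → ∃[ n₀ ] ∀ n → n₀ ℕ.≤ n → fromℕ B ≤ P n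
P-unbounded B =
  let M , hM = H-unbounded (B ℕ.+ 3)
      n₀ , hn = H-unbounded (suc M)
  in suc n₀ , λ { (suc n) n₀≤n → bound M n (hM (suc M) (ℕP.n≤1+n M)) (hn (suc n) (ℕP.≤-trans (ℕP.n≤1+n n₀) n₀≤n)) }
  where
  bound : ∀ M n → fromℕ (B ℕ.+ 3) ≤ H (suc M) → fromℕ (suc M) ≤ H (suc n) → fromℕ B ≤ P (suc n)
  bound M n h k = from-eventually (within chain 1ℚ 0<1)
    where
    chain : (λ _ → H (suc M) - 1ℚ) ≲ (λ _ → P (suc n) + 1ℚ)
    chain = ≲-trans (H≲ℓ M) (≲-trans (ℓ-mono-≤ (fromℕ-mono-≤ {1} {suc M} (s≤s z≤n)) k) (ℓH≲P n (1≤H n)))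
    from-eventually : Eventually (λ _ → H (suc M) - 1ℚ ≤ P (suc n) + 1ℚ + 1ℚ) → fromℕ B ≤ P (suc n)
    from-eventually (K , e) = ≤-by (+-mono-≤ (e K ℕP.≤-refl) (subst (_≤ H (suc M)) (fromℕ-+ B 3) h))
      (solve 3 (λ h p b → (p :+ con 1ℚ :+ con 1ℚ :+ h) :- (h :- con 1ℚ :+ (b :+ con (fromℕ 3))) := p :- b) refl
        (H (suc M)) (P (suc n)) (fromℕ B))

-- A Stirling-type lower bound for ln (X i)

ℓ-*^-lower : ∀ {x} a k → 1ℚ ≤ x → 0ℚ ≤ a →
  (λ m → ℓ x m + fromℕ k * (a * recip (1ℚ + a))) ≲ ℓ (x * (1ℚ + a) ^ℚ k)
ℓ-*^-lower {x} a zero 1≤x 0≤a = ≤⇒≲ (λ m → ≤-reflexive (trans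
  (solve 2 (λ l b → l :+ con 0ℚ :* b := l) refl (ℓ x m) (a * recip (1ℚ + a)))
  (cong (λ z → ℓ z m) (sym (*-identityʳ x)))))
ℓ-*^-lower {x} a (suc k) 1≤x 0≤a = ≲-trans
  (≤⇒≲ (λ m → ≤-reflexive (trans (cong (λ z → ℓ x m + z * b) (fromℕ-suc k))
    (solve 3 (λ l k b → l :+ (k :+ con 1ℚ) :* b := (l :+ b) :+ k :* b) refl (ℓ x m) (fromℕ k) b))))
  (≲-trans (≲-+ʳ (fromℕ k * b) (ℓ-*-lower a 1≤x 0≤a))
    (subst (λ z → (λ m → ℓ (x * (1ℚ + a)) m + fromℕ k * b) ≲ ℓ z) (*-assoc x (1ℚ + a) ((1ℚ + a) ^ℚ k))
      (ℓ-*^-lower a k (mul-≤ 0≤1 (≤-trans 0≤1 1≤x) 1≤x (p≤p+q 0≤a)) 0≤a)))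
  where
  b : ℚ
  b = a * recip (1ℚ + a)

gain : ∀ i → inv (suc i) * recip (1ℚ + inv (suc i)) ≡ inv (suc (suc i))
gain i = begin
  r * recip (1ℚ + r)
    ≡⟨ cong (λ z → r * recip z) 1+r ⟩
  r * recip (fromℕ (suc (suc i)) * r)
    ≡⟨ cong (r *_) (recip-* (0<fromℕ-suc (suc i)) (0<inv i)) ⟩
  r * (inv (suc (suc i)) * recip r)
    ≡⟨ solve 3 (λ r v s → r :* (v :* s) := v :* (r :* s)) refl r (inv (suc (suc i))) (recip r) ⟩
  inv (suc (suc i)) * (r * recip r)
    ≡⟨ cong (inv (suc (suc i)) *_) (recip-inverseʳ (0<inv i)) ⟩
  inv (suc (suc i)) * 1ℚ
    ≡⟨ *-identityʳ (inv (suc (suc i))) ⟩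
  inv (suc (suc i)) ∎
  where
  open ≡-Reasoning
  r : ℚ
  r = inv (suc i)
  1+r : 1ℚ + r ≡ fromℕ (suc (suc i)) * r
  1+r = begin
    1ℚ + r                          ≡⟨ cong (_+ r) (fromℕ*inv i) ⟨
    fromℕ (suc i) * r + r           ≡⟨ solve 2 (λ a r → a :* r :+ r := (a :+ con 1ℚ) :* r) refl (fromℕ (suc i)) r ⟩
    (fromℕ (suc i) + 1ℚ) * r        ≡⟨ cong (_* r) (fromℕ-suc (suc i)) ⟨
    fromℕ (suc (suc i)) * r ∎

1≤X : ∀ i → 1ℚ ≤ X i
1≤X zero    = ≤-refl
1≤X (suc i) = mul-≤ 0≤1 (≤-trans 0≤1 (1≤X i)) (1≤X i) (1≤^ i)
  where
  1≤^ : ∀ k → 1ℚ ≤ (1ℚ + inv (suc i)) ^ℚ k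
  1≤^ zero    = ≤-refl
  1≤^ (suc k) = mul-≤ {1ℚ} {1ℚ + inv (suc i)} {1ℚ} 0≤1 (0≤+ 0≤1 (0≤inv (suc i))) (p≤p+q (0≤inv (suc i))) (1≤^ k)

-- The ratio X (j + 1)/X j = (1 + 1/(j + 1))^j has logarithm at least j/(j + 2) = 1 - 2/(j + 2).
-- Summing over j < i gives i - 2 (H (i + 1) - 1), which is this expression.
lowerX : ℕ → ℚ
lowerX i = fromℕ i + fromℕ 2 - fromℕ 2 * H (suc i)

lowerX≲ℓX : ∀ i → (λ _ → lowerX i) ≲ ℓ (X i)
lowerX≲ℓX zero    = ≤⇒≲ (λ m → ≤-reflexive (sym (riemann-1 (suc m))))
lowerX≲ℓX (suc i) = ≲-trans
  (subst (λ z → (λ _ → z) ≲ (λ m → ℓ (X i) m + fromℕ i * v)) eq (≲-+ʳ (fromℕ i * v) (lowerX≲ℓX i)))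
  (subst (λ z → (λ m → ℓ (X i) m + fromℕ i * z) ≲ ℓ (X (suc i))) (gain i)
    (ℓ-*^-lower (inv (suc i)) i (1≤X i) (0≤inv (suc i))))
  where
  v : ℚ
  v = inv (suc (suc i))
  unit : (fromℕ i + fromℕ 2) * v ≡ 1ℚ
  unit = trans (cong (_* v) (trans (sym (fromℕ-+ i 2)) (cong fromℕ (ℕP.+-comm i 2)))) (fromℕ*inv (suc i))
  eq : lowerX i + fromℕ i * v ≡ lowerX (suc i)
  eq = begin
    lowerX i + fromℕ i * v
      ≡⟨ solve 3 (λ i h v → (i :+ con (fromℕ 2) :- con (fromℕ 2) :* h) :+ i :* v :=
           i :+ con (fromℕ 2) :- con (fromℕ 2) :* (h :+ v) :+ (i :+ con (fromℕ 2)) :* v) refl (fromℕ i) (H (suc i)) v ⟩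
    fromℕ i + fromℕ 2 - fromℕ 2 * (H (suc i) + v) + (fromℕ i + fromℕ 2) * v
      ≡⟨ cong (fromℕ i + fromℕ 2 - fromℕ 2 * (H (suc i) + v) +_) unit ⟩
    fromℕ i + fromℕ 2 - fromℕ 2 * (H (suc i) + v) + 1ℚ
      ≡⟨ solve 2 (λ i h → i :+ con (fromℕ 2) :- con (fromℕ 2) :* h :+ con 1ℚ := (i :+ con 1ℚ) :+ con (fromℕ 2) :- con (fromℕ 2) :* h) refl
           (fromℕ i) (H (suc i) + v) ⟩
    (fromℕ i + 1ℚ) + fromℕ 2 - fromℕ 2 * (H (suc i) + v)
      ≡⟨ cong (λ z → z + fromℕ 2 - fromℕ 2 * (H (suc i) + v)) (fromℕ-suc i) ⟨
    lowerX (suc i) ∎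
    where open ≡-Reasoning

-- seq (lnln n _) is definitionally L n.
L : ℕ → ℕ → ℚ
L n m = ℓ (ℓ (fromℕ n) m) m

module _ (n : ℕ) (4≤H : fromℕ 4 ≤ H (suc n)) where

  private
    h : ℚ
    h = H (suc n)

  -- Eventually h - 2 ≤ ln (n + 1) ≤ h + 1 on the indices, and h + 1 = h (1 + 1/h). The 3 is the 1
  -- of `ℓH≲P`, the bound 1/h ≤ 1 and a tolerance 1.
  L-upper : Eventually (λ m → L (suc n) m ≤ P (suc n) + fromℕ 3)
  L-upper = eventually-map combine (eventually-× (within (H≲ℓ n) 1ℚ 0<1)
    (eventually-× (within (ℓ≲H n) 1ℚ 0<1) (within chain 1ℚ 0<1)))
    where
    chain : ℓ (h * (1ℚ + recip h)) ≲ (λ _ → P (suc n) + 1ℚ + 1ℚ)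
    chain = ≲-trans (ℓ-*-upper (recip h) (1≤H n) (<⇒≤ (0<recip (<-≤-trans 0<1 (1≤H n)))))
      (≲-+ (ℓH≲P n (1≤H n)) (≤⇒≲ (λ _ → recip≤1 (1≤H n))))
    combine : ∀ m → (h - 1ℚ ≤ ℓ (fromℕ (suc n)) m + 1ℚ) × (ℓ (fromℕ (suc n)) m ≤ H n + 1ℚ)
      × (ℓ (h * (1ℚ + recip h)) m ≤ P (suc n) + 1ℚ + 1ℚ + 1ℚ) → L (suc n) m ≤ P (suc n) + fromℕ 3
    combine m (a , b , c) = ≤-trans (riemann-mono-≤ (suc m) 1≤ℓ ℓ≤)
      (subst (ℓ (h * (1ℚ + recip h)) m ≤_)
        (solve 1 (λ p → p :+ con 1ℚ :+ con 1ℚ :+ con 1ℚ := p :+ con (fromℕ 3)) refl (P (suc n))) c)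
      where
      1≤ℓ : 1ℚ ≤ ℓ (fromℕ (suc n)) m
      1≤ℓ = ≤-by (+-mono-≤ (+-mono-≤ a 4≤H) 0≤1)
        (solve 2 (λ l h → (l :+ con 1ℚ :+ h :+ con 1ℚ) :- (h :- con 1ℚ :+ con (fromℕ 4) :+ con 0ℚ) := l :- con 1ℚ) refl
          (ℓ (fromℕ (suc n)) m) h)
      ℓ≤ : ℓ (fromℕ (suc n)) m ≤ h * (1ℚ + recip h)
      ℓ≤ = ≤-trans b (≤-trans (+-monoˡ-≤ 1ℚ (H-mono-≤ (ℕP.n≤1+n n))) (≤-reflexive (trans
        (cong (h +_) (sym (recip-inverseʳ (<-≤-trans 0<1 (1≤H n)))))
        (solve 2 (λ h r → h :+ h :* r := h :* (con 1ℚ :+ r)) refl h (recip h)))))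

  -- As h ≥ 4, the inner logarithm is eventually at least h - 2 ≥ h/2, and ln h ≤ ln (h/2) + 1 by a
  -- single factor 1 + 1. The remaining unit of the 2 is a tolerance.
  L-lower : ∀ i → fromℕ (suc i) ≤ P (suc n) → Eventually (λ m → lowerX i ≤ L (suc n) m + fromℕ 2)
  L-lower i i+1≤P = eventually-map combine (eventually-× (within (H≲ℓ n) 1ℚ 0<1) (within chain 1ℚ 0<1))
    where
    1≤h/2 : 1ℚ ≤ h * ½
    1≤h/2 = ≤-trans (≤-by 0≤1 refl) (mulʳ-≤ (<⇒≤ 0<½) 4≤H)
    chain : (λ _ → lowerX i) ≲ (λ m → ℓ (h * ½) m + 1ℚ)
    chain = ≲-trans (lowerX≲ℓX i) (≲-trans (ℓ-mono-≤ (1≤X i) (X≤H i (suc n) i+1≤P))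
      (subst (λ z → ℓ z ≲ (λ m → ℓ (h * ½) m + 1ℚ))
        (trans (*-assoc h ½ (1ℚ + 1ℚ)) (*-identityʳ h))
        (ℓ-*-upper 1ℚ 1≤h/2 0≤1)))
    combine : ∀ m → (h - 1ℚ ≤ ℓ (fromℕ (suc n)) m + 1ℚ) × (lowerX i ≤ ℓ (h * ½) m + 1ℚ + 1ℚ) →
              lowerX i ≤ L (suc n) m + fromℕ 2
    combine m (a , c) = ≤-trans c (subst (ℓ (h * ½) m + 1ℚ + 1ℚ ≤_)
      (+-assoc (L (suc n) m) 1ℚ 1ℚ)
      (+-monoˡ-≤ 1ℚ (+-monoˡ-≤ 1ℚ (riemann-mono-≤ (suc m) 1≤h/2 h/2≤ℓ))))
      where
      h/2≤ℓ : h * ½ ≤ ℓ (fromℕ (suc n)) m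
      h/2≤ℓ = ≤-by (+-mono-≤ a (mulʳ-≤ (<⇒≤ 0<½) 4≤H))
        (solve 2 (λ l h → (l :+ con 1ℚ :+ h :* con ½) :- (h :- con 1ℚ :+ con (fromℕ 4) :* con ½) := l :- h :* con ½) refl
          (ℓ (fromℕ (suc n)) m) h)

ℕ-floor : ∀ {q} N → 1ℚ ≤ q → q ≤ fromℕ N → ∃[ i ] fromℕ (suc i) ≤ q × q ≤ fromℕ (suc i) + 1ℚ
ℕ-floor {q} zero 1≤q q≤N = ⊥-elim (<-irrefl refl (<-≤-trans 0<1 (≤-trans 1≤q q≤N)))
ℕ-floor {q} (suc N) 1≤q q≤N with ≤-total q (fromℕ N)
... | inj₁ q≤N′ = ℕ-floor N 1≤q q≤N′
ℕ-floor {q} (suc zero) 1≤q q≤N | inj₂ _ = 0 , 1≤q , ≤-trans q≤N (p≤p+q 0≤1)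
ℕ-floor {q} (suc (suc N)) 1≤q q≤N | inj₂ N≤q = N , N≤q , ≤-trans q≤N (≤-reflexive (fromℕ-suc (suc N)))

-- `lowerX i` is i + 2 ≥ q minus 2 H (i + 1), and `H-sublinear` bounds that harmonic number.
lowerX-≥ : ∀ t i {q} → fromℕ (suc i) ≤ q → q ≤ fromℕ (suc i) + 1ℚ →
  q ≤ lowerX i + fromℕ 2 * (fromℕ (suc t) + q * inv (suc t))
lowerX-≥ t i {q} i<q q≤i+2 = ≤-trans q≤i+2 (≤-by
  (mulˡ-≤ (0≤fromℕ 2) (≤-trans (H-sublinear t (suc i))
    (+-monoʳ-≤ (fromℕ (suc t)) (mulʳ-≤ (0≤inv (suc t)) i<q))))
  (trans (solve 3 (λ h i b → con (fromℕ 2) :* b :- con (fromℕ 2) :* h :=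
      (i :+ con (fromℕ 2) :- con (fromℕ 2) :* h) :+ con (fromℕ 2) :* b :- (i :+ con 1ℚ :+ con 1ℚ)) refl
      (H (suc i)) (fromℕ i) (fromℕ (suc t) + q * inv (suc t)))
    (cong (λ z → lowerX i + fromℕ 2 * (fromℕ (suc t) + q * inv (suc t)) - (z + 1ℚ)) (sym (fromℕ-suc i)))))

-- A weak form of Mertens' second theorem: P n ~ ln ln n.
mertens : ∀ t → ∃[ n₀ ] ∀ n → n₀ ℕ.≤ n →
  1ℚ ≤ P n × Eventually (λ m → ∣ P n - L n m ∣ ≤ fromℕ 3 * (P n * inv (suc t)))
mertens t = let n₀ , h = P-unbounded B in suc n₀ , λ { (suc n) n₀<n → at n (h (suc n) (ℕP.≤-trans (ℕP.n≤1+n n₀) n₀<n)) }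
  where
  c B : ℕ
  -- Write s for P/(t + 1). The lower side loses 2 + 2 (t + 1) + 2 s, which is at most 3 s once s ≥
  -- 5 + 2 (t + 1); P ≥ `B` ensures this. The 5 also gives H ≥ P ≥ 4, as `L-upper` and `L-lower`
  -- require.
  c = 5 ℕ.+ 2 ℕ.* suc t
  B = c ℕ.* suc t
  5≤B : 5 ℕ.≤ B
  5≤B = ℕP.≤-trans (ℕP.m≤m+n 5 (2 ℕ.* suc t)) (ℕP.m≤m*n c (suc t))
  at : ∀ n → fromℕ B ≤ P (suc n) →
       1ℚ ≤ P (suc n) × Eventually (λ m → ∣ P (suc n) - L (suc n) m ∣ ≤ fromℕ 3 * (P (suc n) * inv (suc t)))
  at n B≤P = 1≤p , close (ℕ-floor N 1≤p (<⇒≤ p<N))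
    where
    p : ℚ
    p = P (suc n)
    1≤p : 1ℚ ≤ p
    1≤p = ≤-trans (fromℕ-mono-≤ {1} (ℕP.≤-trans (s≤s z≤n) 5≤B)) B≤P
    4≤H : fromℕ 4 ≤ H (suc n)
    4≤H = ≤-trans (≤-trans (fromℕ-mono-≤ {4} (ℕP.≤-trans (ℕP.n≤1+n 4) 5≤B)) B≤P) (P≤H (suc n))
    N : ℕ
    N = proj₁ (archimedean p)
    p<N : p < fromℕ N
    p<N = proj₂ (archimedean p)
    c≤ : fromℕ c ≤ p * inv (suc t)
    c≤ = *≤⇒≤*recip (0<fromℕ-suc t) (subst (_≤ p) (fromℕ-* c (suc t)) B≤P)
    s : ℚ
    s = p * inv (suc t)
    c≡ : fromℕ c ≡ fromℕ 5 + fromℕ 2 * fromℕ (suc t)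
    c≡ = trans (fromℕ-+ 5 (2 ℕ.* suc t)) (cong (fromℕ 5 +_) (fromℕ-* 2 (suc t)))
    close : (∃[ i ] fromℕ (suc i) ≤ p × p ≤ fromℕ (suc i) + 1ℚ) → Eventually (λ m → ∣ p - L (suc n) m ∣ ≤ fromℕ 3 * s)
    close (i , i<p , p≤i+2) = eventually-map (λ m (a , b) → abs-≤ (below m b) (above m a))
      (eventually-× (L-upper n 4≤H) (L-lower n 4≤H i i<p))
      where
      5+2t≤s : fromℕ 5 + fromℕ 2 * fromℕ (suc t) ≤ s
      5+2t≤s = subst (_≤ s) c≡ c≤
      below : ∀ m → lowerX i ≤ L (suc n) m + fromℕ 2 → p - L (suc n) m ≤ fromℕ 3 * s
      below m b = ≤-by (+-mono-≤ (+-mono-≤ (lowerX-≥ t i i<p p≤i+2) b) (+-mono-≤ 5+2t≤s (0≤fromℕ 3)))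
        (solve 5 (λ p x l s t → (x :+ con (fromℕ 2) :* (t :+ s) :+ (l :+ con (fromℕ 2)) :+ (s :+ con (fromℕ 3)))
            :- (p :+ x :+ (con (fromℕ 5) :+ con (fromℕ 2) :* t :+ con 0ℚ)) := con (fromℕ 3) :* s :- (p :- l)) refl
          p (lowerX i) (L (suc n) m) s (fromℕ (suc t)))
      above : ∀ m → L (suc n) m ≤ p + fromℕ 3 → - (p - L (suc n) m) ≤ fromℕ 3 * s
      above m a = ≤-trans (≤-by a (solve 2 (λ p l → (p :+ con (fromℕ 3)) :- l := con (fromℕ 3) :- :- (p :- l)) refl p (L (suc n) m)))
        (subst (_≤ fromℕ 3 * s) (*-identityʳ (fromℕ 3)) (mulˡ-≤ (0≤fromℕ 3) 1≤s))
        where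
        1≤s : 1ℚ ≤ s
        1≤s = ≤-trans (fromℕ-mono-≤ {1} {c} (s≤s z≤n)) c≤

-- The normal order of ω
ωNear-if-near-P : ∀ ε → 0ᴿ <ᴿ ε → ∃[ t ] ∃[ n₀ ] ∀ n → n₀ ℕ.≤ n →
  ∣ fromℕ (ω n) - P n ∣ ≤ P n * inv (suc t) → ωNear ε n
ωNear-if-near-P ε (e , 0<e , K , e≤ε) =
  t , 3 ℕ.⊔ proj₁ (mertens t) , λ n n₀≤n close →
    ℕP.m⊔n≤o⇒m≤o 3 (proj₁ (mertens t)) n₀≤n ,
    inv (suc t) * ½ , 0<* (0<inv t) 0<½ ,
    at n close (proj₂ (mertens t) n (ℕP.m⊔n≤o⇒n≤o 3 (proj₁ (mertens t)) n₀≤n))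
  where
  T t : ℕ
  T = proj₁ (archimedean (fromℕ 9 * recip e))
  -- With v = 1/(t + 1), the 5 gives 3 v ≤ 1/2, hence L ≥ P/2 ≥ 1/2; the `T` gives 9 v ≤ e. The
  -- distance from ω n to L is at most 4 v P ≤ 8 v L, and the margin v/2 demanded by `<ᴿ` is at most
  -- v L: together 9 v L.
  t = 5 ℕ.+ T
  v : ℚ
  v = inv (suc t)
  v≤1/6 : fromℕ 3 * v ≤ ½
  v≤1/6 = mulˡ-≤ {fromℕ 3} (0≤fromℕ 3) (inv-antimono {5} {t} (ℕP.m≤m+n 5 T))
  9v≤e : fromℕ 9 * v ≤ e
  9v≤e = ≤*⇒*recip≤ (0<fromℕ-suc t) (subst (_≤ e * fromℕ (suc t)) cancel (mulˡ-≤ (<⇒≤ 0<e)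
    (≤-trans (<⇒≤ (proj₂ (archimedean (fromℕ 9 * recip e)))) (fromℕ-mono-≤ (ℕP.≤-trans (ℕP.m≤n+m T 5) (ℕP.n≤1+n t))))))
    where
    cancel : e * (fromℕ 9 * recip e) ≡ fromℕ 9
    cancel = trans (solve 3 (λ e a r → e :* (a :* r) := a :* (e :* r)) refl e (fromℕ 9) (recip e))
      (trans (cong (fromℕ 9 *_) (recip-inverseʳ 0<e)) (*-identityʳ (fromℕ 9)))
  at : ∀ n → ∣ fromℕ (ω n) - P n ∣ ≤ P n * v →
       1ℚ ≤ P n × Eventually (λ m → ∣ P n - L n m ∣ ≤ fromℕ 3 * (P n * v)) →
       Eventually (λ m → ∣ fromℕ (ω n) - L n m ∣ + v * ½ ≤ seq ε m * L n m)
  at n close (1≤P , ev) = eventually-map combine (eventually-× ev (K , e≤ε))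
    where
    combine : ∀ m → ∣ P n - L n m ∣ ≤ fromℕ 3 * (P n * v) × 0ℚ + e ≤ seq ε m →
              ∣ fromℕ (ω n) - L n m ∣ + v * ½ ≤ seq ε m * L n m
    combine m (d , e≤εm) = begin
      ∣ fromℕ (ω n) - l ∣ + v * ½
        ≤⟨ +-monoˡ-≤ (v * ½) (≤-trans (triangle (fromℕ (ω n)) p l) (+-mono-≤ close d)) ⟩
      p * v + fromℕ 3 * (p * v) + v * ½
        ≡⟨ solve 2 (λ p v → p :* v :+ con (fromℕ 3) :* (p :* v) :+ v :* con ½ :=
             v :* (con (fromℕ 8) :* (p :* con ½) :+ con ½)) refl p v ⟩
      v * (fromℕ 8 * (p * ½) + ½)
        ≤⟨ mulˡ-≤ (0≤inv (suc t)) (+-mono-≤ (mulˡ-≤ {fromℕ 8} (0≤fromℕ 8) p/2≤l) ½≤l) ⟩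
      v * (fromℕ 8 * l + l)
        ≡⟨ solve 2 (λ v l → v :* (con (fromℕ 8) :* l :+ l) := con (fromℕ 9) :* v :* l) refl v l ⟩
      fromℕ 9 * v * l
        ≤⟨ mulʳ-≤ 0≤l (≤-trans 9v≤e (subst (_≤ seq ε m) (+-identityˡ e) e≤εm)) ⟩
      seq ε m * l ∎
      where
      open ≤-Reasoning
      p l : ℚ
      p = P n
      l = L n m
      p/2≤l : p * ½ ≤ l
      p/2≤l = ≤-by (+-mono-≤ (≤-trans (p≤∣p∣ (p - l)) d) (mulˡ-≤ (0≤P n) v≤1/6))
        (solve 3 (λ p l v → (con (fromℕ 3) :* (p :* v) :+ p :* con ½) :- (p :- l :+ p :* (con (fromℕ 3) :* v)) := l :- p :* con ½) refl p l v)
      ½≤l : ½ ≤ l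
      ½≤l = ≤-trans (subst (_≤ p * ½) (*-identityˡ ½) (mulʳ-≤ (<⇒≤ 0<½) 1≤P)) p/2≤l
      0≤l : 0ℚ ≤ l
      0≤l = ≤-trans (<⇒≤ 0<½) ½≤l

-- The density of the exceptional set

ω≡w : ∀ {N} n → suc n ℕ.≤ N → fromℕ (ω (suc n)) ≡ w N (suc n)
ω≡w {N} n n<N = begin
  fromℕ (ω a)
    ≡⟨ length-filter Q? id (suc a) ⟩
  sum (suc a) (λ p → 𝟙 (Q? p))
    ≡⟨ sum-shift a (λ p → 𝟙 (Q? p)) ⟩
  𝟙 (Q? 0) + Σ₁ a (λ p → 𝟙 (Q? p))
    ≡⟨ cong₂ _+_ (𝟙-no (Q? 0) (¬prime[0] ∘ proj₁)) (sum-cong a (λ i → 𝟙-× (prime? (suc i)) (suc i ∣? a))) ⟩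
  0ℚ + w a a
    ≡⟨ +-identityˡ (w a a) ⟩
  w a a
    ≡⟨ sum-extend-zero n<N (λ i a≤i → trans
         (cong (χ (suc i) *_) (𝟙-no (suc i ∣? a) (λ i∣a → ℕP.<⇒≱ (s≤s a≤i) (∣⇒≤ i∣a))))
         (*-zeroʳ (χ (suc i)))) ⟩
  w N a ∎
  where
  open ≡-Reasoning
  a : ℕ
  a = suc n
  Q? : Decidable (λ p → _)
  Q? p = prime? p ×-dec (p ∣? a)

P-mono-≤ : ∀ {m n} → m ℕ.≤ n → P m ≤ P n
P-mono-≤ m≤n = sum-extend m≤n (λ i → 0≤χ*inv (suc i))

-- At most N ≤ (n + 1)(s + 1) terms are added, each at most 1/(n + 1). The drift is bounded while P
-- N tends to infinity.
P-drift : ∀ {N} s n → suc n ℕ.≤ N → N ℕ.≤ suc n ℕ.* suc s → P N ≤ P (suc n) + fromℕ (suc s)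
P-drift {N} s n n<N N≤ = begin
  P N
    ≡⟨ cong P (ℕP.m+[n∸m]≡n n<N) ⟨
  P (a ℕ.+ k)
    ≡⟨ sum-+ a k (λ i → χ (suc i) * inv (suc i)) ⟩
  P a + sum k (λ j → χ (suc (a ℕ.+ j)) * inv (suc (a ℕ.+ j)))
    ≤⟨ +-monoʳ-≤ (P a) (sum-mono-≤ k (λ j _ → mul-≤ (0≤inv (suc (a ℕ.+ j))) 0≤1 (𝟙≤1 (prime? (suc (a ℕ.+ j))))
         (inv-antimono (ℕP.≤-trans (ℕP.n≤1+n n) (ℕP.m≤m+n a j))))) ⟩
  P a + sum k (λ _ → 1ℚ * inv a)
    ≡⟨ cong (P a +_) (trans (sum-const k (1ℚ * inv a)) (cong (fromℕ k *_) (*-identityˡ (inv a)))) ⟩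
  P a + fromℕ k * inv a
    ≤⟨ +-monoʳ-≤ (P a) (≤*⇒*recip≤ (0<fromℕ-suc n) (subst (fromℕ k ≤_) (fromℕ-* (suc s) a)
         (fromℕ-mono-≤ (ℕP.≤-trans (ℕP.m∸n≤m N a) (subst (N ℕ.≤_) (ℕP.*-comm a (suc s)) N≤))))) ⟩
  P a + fromℕ (suc s) ∎
  where
  open ≤-Reasoning
  a k : ℕ
  a = suc n
  k = N ℕ.∸ a

-- Such n correspond to the multiples n (s + 1) up to N. The detour through the range N (s + 1)
-- gives every n ≤ N its multiple before the cut at N.
small-count : ∀ s N → Σ₁ N (λ n → 𝟙 (n ℕ.* suc s ℕP.≤? N)) ≤ fromℕ N * inv (suc s)
small-count s N = begin
  Σ₁ N (λ n → 𝟙 (n ℕ.* suc s ℕP.≤? N))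
    ≤⟨ sum-multiples-≥ s (N ℕ.* suc s) {λ m → 𝟙 (m ℕP.≤? N)} N ℕP.≤-refl (λ m → 0≤𝟙 (m ℕP.≤? N)) ⟩
  Σ₁ (N ℕ.* suc s) (λ m → D (suc s) m * 𝟙 (m ℕP.≤? N))
    ≡⟨ sum-extend-zero (ℕP.m≤m*n N (suc s)) (λ i N≤i → trans
         (cong (D (suc s) (suc i) *_) (𝟙-no (suc i ℕP.≤? N) (ℕP.<⇒≱ (s≤s N≤i))))
         (*-zeroʳ (D (suc s) (suc i)))) ⟨
  Σ₁ N (λ m → D (suc s) m * 𝟙 (m ℕP.≤? N))
    ≤⟨ sum-mono-≤ N (λ i _ → subst (D (suc s) (suc i) * 𝟙 (suc i ℕP.≤? N) ≤_) (*-identityʳ (D (suc s) (suc i)))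
         (mulˡ-≤ (0≤𝟙 (suc s ∣? suc i)) (𝟙≤1 (suc i ℕP.≤? N)))) ⟩
  Σ₁ N (D (suc s))
    ≤⟨ count-multiples-≤ s N ⟩
  fromℕ N * inv (suc s) ∎
  where open ≤-Reasoning

square-mono-≤ : ∀ {a} x → 0ℚ ≤ a → a ≤ ∣ x ∣ → a * a ≤ x * x
square-mono-≤ {a} x 0≤a a≤x with ∣p∣≡p∨∣p∣≡-p x
... | inj₁ e = subst (λ z → a * a ≤ z * z) e (mul-≤ 0≤a (0≤∣p∣ x) a≤x a≤x)
... | inj₂ e = subst (a * a ≤_) (solve 1 (λ x → :- x :* :- x := x :* x) refl x)
                 (subst (λ z → a * a ≤ z * z) e (mul-≤ 0≤a (0≤∣p∣ x) a≤x a≤x))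

module _ (n₀ t : ℕ) where

  -- A decidable condition sufficient for `ωNear`, so that it and its complement can be counted by
  -- filtering.
  Near : Pred ℕ 0ℓ
  Near n = n₀ ℕ.≤ n × ∣ fromℕ (ω n) - P n ∣ ≤ P n * inv (suc t)

  near? : Decidable Near
  near? n = n₀ ℕP.≤? n ×-dec ∣ fromℕ (ω n) - P n ∣ ≤? P n * inv (suc t)

  -- `N-large` puts every n > N/(s + 1) beyond n₀. The 12 is chosen for y = P N/(2 (t + 1)): then y²
  -- ≥ 3 (s + 1) P N, so Turán's bound divided by y² is at most N/(s + 1).
  module _ (s N : ℕ) (N-large : n₀ ℕ.* suc s ℕ.≤ N)
           (P-large : fromℕ (12 ℕ.* suc s ℕ.* suc t ℕ.* suc t) ≤ P N) where

    private
      v q y S : ℚ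
      v = inv (suc t)
      q = P N
      y = q * v * ½
      S = fromℕ (suc s)

      12S≤qvv : fromℕ 12 * S ≤ q * v * v
      12S≤qvv = *≤⇒≤*recip (0<fromℕ-suc t) (*≤⇒≤*recip (0<fromℕ-suc t) (subst (_≤ q)
        (trans (fromℕ-* (12 ℕ.* suc s ℕ.* suc t) (suc t)) (cong (_* fromℕ (suc t))
          (trans (fromℕ-* (12 ℕ.* suc s) (suc t)) (cong (_* fromℕ (suc t)) (fromℕ-* 12 (suc s)))))) P-large))

      0≤v : 0ℚ ≤ v
      0≤v = 0≤inv (suc t)
      0≤q : 0ℚ ≤ q
      0≤q = 0≤P N
      0≤y : 0ℚ ≤ y
      0≤y = 0≤* (0≤* 0≤q 0≤v) (<⇒≤ 0<½)

      2S≤y : S + S ≤ y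
      2S≤y = ≤-by (mulʳ-≤ (<⇒≤ 0<½) (≤-trans (≤-by (+-mono-≤ (mulˡ-≤ {fromℕ 8} (0≤fromℕ 8) (0≤fromℕ (suc s)))
                12S≤qvv)
                (solve 2 (λ s x → (con (fromℕ 8) :* s :+ x) :- (con (fromℕ 8) :* con 0ℚ :+ con (fromℕ 12) :* s) := x :- con (fromℕ 4) :* s) refl S (q * v * v)))
              (subst (q * v * v ≤_) (*-identityʳ (q * v)) (mulˡ-≤ (0≤* 0≤q 0≤v) (inv≤1 (suc t))))))
        (solve 2 (λ s x → x :* con ½ :- con (fromℕ 4) :* s :* con ½ := x :* con ½ :- (s :+ s)) refl S (q * v))

      -- With S = s + 1 and q = P N, the drift turns a deviation from P n exceeding v P n into one
      -- from q of at least v (q - S) - S ≥ 2 y - 2 S ≥ y.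
      far : ∀ n → suc n ℕ.≤ N → N ℕ.< suc n ℕ.* suc s → ¬ Near (suc n) → y ≤ ∣ w N (suc n) - q ∣
      far n n<N N< ¬near = ≤-by two-y (solve 2 (λ c y → (c :+ y) :- (y :+ y) := c :- y) refl ∣ x - q ∣ y)
        where
        open ≤-Reasoning
        p x : ℚ
        p = P (suc n)
        x = w N (suc n)
        n₀≤n : n₀ ℕ.≤ suc n
        n₀≤n = ℕP.<⇒≤ (ℕP.*-cancelʳ-< (suc s) n₀ (suc n) (ℕP.≤-<-trans N-large N<))
        dev : p * v ≤ ∣ x - p ∣
        dev = <⇒≤ (≰⇒> (λ h → ¬near (n₀≤n , subst (λ z → ∣ z - p ∣ ≤ p * v) (sym (ω≡w n n<N)) h)))
        q≤p+S : q ≤ p + S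
        q≤p+S = P-drift s n n<N (ℕP.<⇒≤ N<)
        drift : ∣ q - p ∣ ≤ S
        drift = abs-≤ (≤-by q≤p+S (solve 3 (λ p q s → (p :+ s) :- q := s :- (q :- p)) refl p q S))
          (≤-by (+-mono-≤ (P-mono-≤ n<N) (0≤fromℕ (suc s)))
            (solve 3 (λ p q s → (q :+ s) :- (p :+ con 0ℚ) := s :- :- (q :- p)) refl p q S))
        S*v≤S : S * v ≤ S
        S*v≤S = subst (S * v ≤_) (*-identityʳ S) (mulˡ-≤ (0≤fromℕ (suc s)) (inv≤1 (suc t)))
        two-y : y + y ≤ ∣ x - q ∣ + y
        two-y = begin
          y + y                        ≡⟨ half+half (q * v) ⟩
          q * v                        ≤⟨ mulʳ-≤ 0≤v q≤p+S ⟩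
          (p + S) * v                  ≡⟨ *-distribʳ-+ v p S ⟩
          p * v + S * v                ≤⟨ +-mono-≤ (≤-trans dev (≤-trans (triangle x q p) (+-monoʳ-≤ ∣ x - q ∣ drift))) S*v≤S ⟩
          ∣ x - q ∣ + S + S            ≡⟨ +-assoc ∣ x - q ∣ S S ⟩
          ∣ x - q ∣ + (S + S)          ≤⟨ +-monoʳ-≤ ∣ x - q ∣ 2S≤y ⟩
          ∣ x - q ∣ + y ∎

      -- Chebyshev's inequality term by term, with the n up to N/(s + 1), where the drift is not
      -- controlled, simply charged in full.
      bad-term : ∀ n → suc n ℕ.≤ N → y * y * 𝟙 (¬? (near? (suc n))) ≤
        y * y * 𝟙 (suc n ℕ.* suc s ℕP.≤? N) + (w N (suc n) - q) * (w N (suc n) - q)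
      bad-term n n<N = cases (¬? (near? (suc n))) (suc n ℕ.* suc s ℕP.≤? N)
        where
        z : ℚ
        z = w N (suc n) - q
        cases : (d : Dec (¬ Near (suc n))) (e : Dec (suc n ℕ.* suc s ℕ.≤ N)) →
                y * y * 𝟙 d ≤ y * y * 𝟙 e + z * z
        cases d (yes _) = ≤-trans (mulˡ-≤ (0≤p*p y) (𝟙≤1 d)) (p≤p+q (0≤p*p z))
        cases (no _) (no _) = ≤-trans (≤-reflexive (*-zeroʳ (y * y)))
          (0≤+ (≤-reflexive (sym (*-zeroʳ (y * y)))) (0≤p*p z))
        cases (yes ¬near) (no large) = subst₂ _≤_ (sym (*-identityʳ (y * y)))
          (solve 2 (λ y z → z :* z := y :* y :* con 0ℚ :+ z :* z) refl y z)
          (square-mono-≤ z 0≤y (far n n<N (ℕP.≰⇒> large) ¬near))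

      3q≤ : fromℕ 3 * q ≤ y * y * inv (suc s)
      3q≤ = *≤⇒≤*recip {fromℕ 3 * q} {y * y} {S} (0<fromℕ-suc s) (≤-by (mulˡ-≤ (0≤* 0≤q (0≤* (<⇒≤ 0<½) (<⇒≤ 0<½))) 12S≤qvv)
        (solve 3 (λ q s v → q :* (con ½ :* con ½) :* (q :* v :* v) :- q :* (con ½ :* con ½) :* (con (fromℕ 12) :* s) :=
           q :* v :* con ½ :* (q :* v :* con ½) :- con (fromℕ 3) :* q :* s) refl q S v))

      0<q : 0ℚ < q
      0<q = <-≤-trans 0<1 (≤-trans (fromℕ-mono-≤ {1} {12 ℕ.* suc s ℕ.* suc t ℕ.* suc t} (s≤s z≤n)) P-large)

      0<y : 0ℚ < y
      0<y = 0<* (0<* 0<q (0<inv t)) 0<½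

    -- One N/(s + 1) comes from the small n and one from Turán's bound.
    bad-sum : Σ₁ N (λ n → 𝟙 (¬? (near? n))) ≤ fromℕ 2 * (fromℕ N * inv (suc s))
    bad-sum = *-cancelʳ-≤ (y * y) (0<* 0<y 0<y) (begin
      Σ₁ N (λ n → 𝟙 (¬? (near? n))) * (y * y)
        ≡⟨ *-comm (Σ₁ N (λ n → 𝟙 (¬? (near? n)))) (y * y) ⟩
      y * y * Σ₁ N (λ n → 𝟙 (¬? (near? n)))
        ≡⟨ sum-*ˡ N (y * y) (λ i → 𝟙 (¬? (near? (suc i)))) ⟨
      Σ₁ N (λ n → y * y * 𝟙 (¬? (near? n)))
        ≤⟨ sum-mono-≤ N (λ i i<N → bad-term i i<N) ⟩
      Σ₁ N (λ n → y * y * 𝟙 (n ℕ.* suc s ℕP.≤? N) + (w N n - q) * (w N n - q))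
        ≡⟨ sum-add N (λ i → y * y * 𝟙 (suc i ℕ.* suc s ℕP.≤? N)) (λ i → (w N (suc i) - q) * (w N (suc i) - q)) ⟩
      Σ₁ N (λ n → y * y * 𝟙 (n ℕ.* suc s ℕP.≤? N)) + Σ₁ N (λ n → (w N n - q) * (w N n - q))
        ≤⟨ +-mono-≤ (≤-trans (≤-reflexive (sum-*ˡ N (y * y) (λ i → 𝟙 (suc i ℕ.* suc s ℕP.≤? N))))
             (mulˡ-≤ (0≤p*p y) (small-count s N))) (turán N) ⟩
      y * y * (fromℕ N * inv (suc s)) + fromℕ 3 * (fromℕ N * q)
        ≡⟨ cong (y * y * (fromℕ N * inv (suc s)) +_) (solve 3 (λ c n q → c :* (n :* q) := n :* (c :* q)) refl (fromℕ 3) (fromℕ N) q) ⟩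
      y * y * (fromℕ N * inv (suc s)) + fromℕ N * (fromℕ 3 * q)
        ≤⟨ +-monoʳ-≤ (y * y * (fromℕ N * inv (suc s))) (mulˡ-≤ (0≤fromℕ N) 3q≤) ⟩
      y * y * (fromℕ N * inv (suc s)) + fromℕ N * (y * y * inv (suc s))
        ≡⟨ solve 3 (λ a n r → a :* (n :* r) :+ n :* (a :* r) := con (fromℕ 2) :* (n :* r) :* a) refl (y * y) (fromℕ N) (inv (suc s)) ⟩
      fromℕ 2 * (fromℕ N * inv (suc s)) * (y * y) ∎)
      where open ≤-Reasoning

  bad-density : ∀ δ → 0ℚ < δ → ∃[ N₀ ] ∀ N → N₀ ℕ.< N → Σ₁ N (λ n → 𝟙 (¬? (near? n))) * inv N < δ
  bad-density δ 0<δ = N₀ , λ { (suc N) (s≤s N₀≤N) → bound N (ℕP.≤-trans N₀≤N (ℕP.n≤1+n N)) }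
    where
    s K N₀ : ℕ
    -- Chosen so that 2/(s + 1) < δ, the proportion left by `bad-sum`.
    s  = proj₁ (vanishing {fromℕ 2} {δ} 0<δ)
    K  = proj₁ (P-unbounded (12 ℕ.* suc s ℕ.* suc t ℕ.* suc t))
    N₀ = n₀ ℕ.* suc s ℕ.⊔ K
    bound : ∀ N → N₀ ℕ.≤ suc N → Σ₁ (suc N) (λ n → 𝟙 (¬? (near? n))) * inv (suc N) < δ
    bound N N₀≤ = ≤-<-trans
      (≤*⇒*recip≤ (0<fromℕ-suc N) (≤-trans
        (bad-sum s (suc N) (ℕP.m⊔n≤o⇒m≤o (n₀ ℕ.* suc s) K N₀≤)
          (proj₂ (P-unbounded (12 ℕ.* suc s ℕ.* suc t ℕ.* suc t)) (suc N) (ℕP.m⊔n≤o⇒n≤o (n₀ ℕ.* suc s) K N₀≤)))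
        (≤-reflexive (solve 3 (λ c n r → c :* (n :* r) := c :* r :* n) refl (fromℕ 2) (fromℕ (suc N)) (inv (suc s))))))
      (proj₂ (vanishing {fromℕ 2} {δ} 0<δ) s ℕP.≤-refl)

-- Natural density

unique-⊆-length : ∀ {xs ys : List ℕ} → Unique xs → (∀ {v} → v ∈ xs → v ∈ ys) → length xs ℕ.≤ length ys
unique-⊆-length {[]} _ _ = z≤n
unique-⊆-length {x ∷ xs} {ys} (x∉xs ∷ u) xs⊆ys with ∈-∃++ (xs⊆ys (here refl))
... | as , bs , refl = subst (suc (length xs) ℕ.≤_) (sym (length-++-sucʳ as x bs))
        (s≤s (unique-⊆-length u remove))
  where
  remove : ∀ {v} → v ∈ xs → v ∈ as ++ bs
  remove v∈xs with ∈-++⁻ as (xs⊆ys (there v∈xs))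
  ... | inj₁ v∈as         = ∈-++⁺ˡ v∈as
  ... | inj₂ (here refl)  = ⊥-elim (All.lookup x∉xs v∈xs refl)
  ... | inj₂ (there v∈bs) = ∈-++⁺ʳ as v∈bs

module _ {A : Pred ℕ 0ℓ} (A? : Decidable A) (N : ℕ) where

  members : List ℕ
  members = filter A? (applyUpTo suc N)

  fromℕ-members : fromℕ (length members) ≡ Σ₁ N (λ n → 𝟙 (A? n))
  fromℕ-members = length-filter A? suc N

  atLeast-members : AtLeast (length members) (λ n → 1 ℕ.≤ n × n ℕ.≤ N × A n)
  atLeast-members = members
    , UniqueP.filter⁺ A? (UniqueP.applyUpTo⁺₁ suc N (λ i<j _ e → ℕP.<⇒≢ i<j (ℕP.suc-injective e)))
    , All.zipWith (λ ((1≤n , n≤N) , a) → 1≤n , n≤N , a)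
        (AllP.filter⁺ A? (AllP.applyUpTo⁺₁ {P = λ n → 1 ℕ.≤ n × n ℕ.≤ N} suc N (λ i<N → s≤s z≤n , i<N)) , AllP.all-filter A? (applyUpTo suc N))
    , ℕP.≤-refl

  atMost-members : AtMost (length members) (λ n → 1 ℕ.≤ n × n ℕ.≤ N × A n)
  atMost-members xs u all = unique-⊆-length u (λ v∈xs → member (All.lookup all v∈xs))
    where
    member : ∀ {n} → 1 ℕ.≤ n × n ℕ.≤ N × A n → n ∈ members
    member {suc n} (_ , n<N , a) = ∈-filter⁺ A? (∈-applyUpTo⁺ suc n<N) a

fraction≡ : ∀ a N → ℤ.+ a / suc N ≡ fromℕ a * inv (suc N)
fraction≡ a N = trans (sym (*-recip-cancel (ℤ.+ a / suc N) (0<fromℕ-suc N)))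
  (cong (_* inv (suc N)) (toℚᵘ-injective (begin
    toℚᵘ (ℤ.+ a / suc N * fromℕ (suc N))
      ≈⟨ toℚᵘ-homo-* (ℤ.+ a / suc N) (fromℕ (suc N)) ⟩
    toℚᵘ (ℤ.+ a / suc N) ℚᵘ.* toℚᵘ (fromℕ (suc N))
      ≈⟨ ℚᵘP.*-cong (toℚᵘ-fromℚᵘ (ℚᵘ.mkℚᵘ (ℤ.+ a) N)) (toℚᵘ-fromℚᵘ (ℚᵘ.mkℚᵘ (ℤ.+ suc N) 0)) ⟩
    ℚᵘ.mkℚᵘ (ℤ.+ a) N ℚᵘ.* ℚᵘ.mkℚᵘ (ℤ.+ suc N) 0
      ≈⟨ ℚᵘ.*≡* (ℤP.*-assoc (ℤ.+ a) (ℤ.+ suc N) ℤ.1ℤ) ⟩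
    ℚᵘ.mkℚᵘ (ℤ.+ a) 0
      ≈⟨ toℚᵘ-fromℚᵘ (ℚᵘ.mkℚᵘ (ℤ.+ a) 0) ⟨
    toℚᵘ (fromℕ a) ∎)))
  where open ℚᵘP.≃-Reasoning

module _ (n₀ t : ℕ) where

  Bad : Pred ℕ 0ℓ
  Bad n = ¬ Near n₀ t n

  bad-zero-density : HasNaturalDensity Bad 0ℚ
  bad-zero-density δ 0<δ = suc (proj₁ (bad-density n₀ t δ 0<δ)) , λ N N₀<N → at N (proj₂ (bad-density n₀ t δ 0<δ) N N₀<N)
    where
    at : ∀ N → .{{_ : ℕ.NonZero N}} → Σ₁ N (λ n → 𝟙 (¬? (near? n₀ t n))) * inv N < δ →
      ∃[ a ] ∃[ b ] AtLeast a (λ n → 1 ℕ.≤ n × n ℕ.≤ N × Bad n) × AtMost b (λ n → 1 ℕ.≤ n × n ℕ.≤ N × Bad n)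
        × ∣ ℤ.+ a / N - 0ℚ ∣ < δ × ∣ ℤ.+ b / N - 0ℚ ∣ < δ
    at (suc N) few = c , c , atLeast-members bad? (suc N) , atMost-members bad? (suc N) , close , close
      where
      bad? : Decidable Bad
      bad? n = ¬? (near? n₀ t n)
      c : ℕ
      c = length (members bad? (suc N))
      c/N : ℤ.+ c / suc N - 0ℚ ≡ Σ₁ (suc N) (λ n → 𝟙 (bad? n)) * inv (suc N)
      c/N = trans (solve 1 (λ x → x :- con 0ℚ := x) refl (ℤ.+ c / suc N))
        (trans (fraction≡ c N) (cong (_* inv (suc N)) (fromℕ-members bad? (suc N))))
      close : ∣ ℤ.+ c / suc N - 0ℚ ∣ < δ
      close = subst (_< δ) (sym (trans (cong ∣_∣ c/N)
          (0≤p⇒∣p∣≡p (0≤* (sum-nonneg (suc N) (λ i → 0≤𝟙 (bad? (suc i)))) (0≤inv (suc N))))))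
        few

  -- `Q` may be undecidable, so its count is enclosed: from below by the number of near n, which is
  -- N minus the bad ones, and from above by N itself.
  near-full-density : ∀ {Q : Pred ℕ 0ℓ} → 3 ℕ.≤ n₀ → (∀ n → Near n₀ t n → Q n) →
    LimitingProportion (λ N n → 3 ℕ.≤ n × n ℕ.≤ N × Q n) 1ℚ
  near-full-density {Q} 3≤n₀ near⇒Q δ 0<δ = suc (proj₁ (bad-density n₀ t δ 0<δ)) , λ N N₀<N → at N (proj₂ (bad-density n₀ t δ 0<δ) N N₀<N)
    where
    at : ∀ N → .{{_ : ℕ.NonZero N}} → Σ₁ N (λ n → 𝟙 (¬? (near? n₀ t n))) * inv N < δ →
      ∃[ a ] ∃[ b ] AtLeast a (λ n → 3 ℕ.≤ n × n ℕ.≤ N × Q n) × AtMost b (λ n → 3 ℕ.≤ n × n ℕ.≤ N × Q n)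
        × ∣ ℤ.+ a / N - 1ℚ ∣ < δ × ∣ ℤ.+ b / N - 1ℚ ∣ < δ
    at (suc N) few = a , suc N , atLeast , atMost , close-a , close-N
      where
      near : Decidable (Near n₀ t)
      near = near? n₀ t
      a : ℕ
      a = length (members near (suc N))
      atLeast : AtLeast a (λ n → 3 ℕ.≤ n × n ℕ.≤ suc N × Q n)
      atLeast = let xs , u , all , a≤ = atLeast-members near (suc N) in
        xs , u , All.map (λ {n} (_ , n≤N , nr) → ℕP.≤-trans 3≤n₀ (proj₁ nr) , n≤N , near⇒Q n nr) all , a≤
      atMost : AtMost (suc N) (λ n → 3 ℕ.≤ n × n ℕ.≤ suc N × Q n)
      atMost xs u all = subst (length xs ℕ.≤_) (length-applyUpTo suc (suc N))
        (unique-⊆-length u (λ v∈xs → member (All.lookup all v∈xs)))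
        where
        member : ∀ {n} → 3 ℕ.≤ n × n ℕ.≤ suc N × Q n → n ∈ applyUpTo suc (suc N)
        member {suc n} (_ , n<N , _) = ∈-applyUpTo⁺ suc n<N
      G B : ℚ
      G = Σ₁ (suc N) (λ n → 𝟙 (near n))
      B = Σ₁ (suc N) (λ n → 𝟙 (¬? (near n)))
      complement : ∀ n → (d : Dec (Near n₀ t n)) → 𝟙 d + 𝟙 (¬? d) ≡ 1ℚ
      complement n (yes _) = refl
      complement n (no _)  = refl
      G+B : G + B ≡ fromℕ (suc N)
      G+B = trans (sym (sum-add (suc N) (λ i → 𝟙 (near (suc i))) (λ i → 𝟙 (¬? (near (suc i))))))
        (trans (sum-cong (suc N) (λ i → complement (suc i) (near (suc i))))
          (trans (sum-const (suc N) 1ℚ) (*-identityʳ (fromℕ (suc N)))))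
      1-a/N : 1ℚ - ℤ.+ a / suc N ≡ B * inv (suc N)
      1-a/N = trans
        (cong₂ _-_ (sym (trans (cong (_* inv (suc N)) G+B) (fromℕ*inv N)))
          (trans (fraction≡ a N) (cong (_* inv (suc N)) (fromℕ-members near (suc N)))))
        (solve 3 (λ g b r → (g :+ b) :* r :- g :* r := b :* r) refl G B (inv (suc N)))
      close-a : ∣ ℤ.+ a / suc N - 1ℚ ∣ < δ
      close-a = subst (_< δ) (sym (trans (∣p-q∣≡∣q-p∣ (ℤ.+ a / suc N) 1ℚ) (trans (cong ∣_∣ 1-a/N)
          (0≤p⇒∣p∣≡p (0≤* (sum-nonneg (suc N) (λ i → 0≤𝟙 (¬? (near (suc i))))) (0≤inv (suc N)))))))
        few
      close-N : ∣ ℤ.+ suc N / suc N - 1ℚ ∣ < δ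
      close-N = subst (λ z → ∣ z - 1ℚ ∣ < δ) (sym (trans (fraction≡ (suc N) N) (fromℕ*inv N))) 0<δ

mainTheorem3 : (ε : ℝ) → 0ᴿ <ᴿ ε →
    AlmostAll (ωNear ε) ×
    LimitingProportion (λ N n → 3 ℕ.≤ n × n ℕ.≤ N × ωNear ε n) 1ℚ
mainTheorem3 ε 0<ε =
  let t , n₀ , h = ωNear-if-near-P ε 0<ε
      -- The threshold `3 ⊔ n₀` makes `Near` imply 3 ≤ n, the range over which the second limit
      -- counts.
      near⇒ωNear = λ n ((n₀≤n , close) : Near (3 ℕ.⊔ n₀) t n) → h n (ℕP.m⊔n≤o⇒n≤o 3 n₀ n₀≤n) close
  in (Bad (3 ℕ.⊔ n₀) t , bad-zero-density (3 ℕ.⊔ n₀) t ,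
       λ n _ ¬bad → near⇒ωNear n (decidable-stable (near? (3 ℕ.⊔ n₀) t n) ¬bad))
   , near-full-density (3 ℕ.⊔ n₀) t (ℕP.m≤m⊔n 3 n₀) near⇒ωNear
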